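{- Let $m\ge1$ and write $m^+=m+1$. Let $Z$ be the unique formal power series in $t$ with constant term $0$ such that $t=Z(1-m^+Z)^m$, and let $U$ be the unique formal power series in $t$ with coefficients in $\mathbb{Q}[x]$ such that \[ x=\frac{U}{1-m^+Z}\left(1-Z\,\frac{U^{m+1}-1}{U-1}\right). \] Then the generating function $I$ of greedy $m$-Tamari intervals of positive size, counted by size (variable $t$) and final descent length of the maximal element (variable $x$), is given by \[ x^2 I=\frac{Z U^{m+2}}{(1-m^+Z)^2}\left(1-Z\sum_{e=0}^m U^e(m+1-e)\right)=\frac{ZU^{m+2}}{1-m^+Z}\cdot\frac{x-1}{U-1}. \] In particular \[ I(1)=\frac{Z}{(1-m^+Z)^2}\left(1-\binom{m+2}{2}Z\right). \] More generally, for $0\le i\le m+1$, the generating function $J_i$ of the set $\mathcal J_i$ satisfies \[ \frac{J_i}{x^{m-i-1}}=Z(1-m^+Z)^{m-i-1}H_i(Z;U), \] where $H_i(z;u)$ are the polynomials \[ H_{m+1}(z;u)=u^{m+2}\left(1-z\sum_{e=0}^m u^e(m+1-e)\right), \] and, for $0\le i\le m$, \[ H_i(z;u)=u^{i+1}\left(1+\sum_{k=1}^{i+1}(-z)^k\binom{i+1}{k}\sum_{e=0}^{m-i}\binom{e+k-1}{e}u^e+\sum_{k=1}^{i}(-z)^k\binom{m+k-i-1}{k-1}\sum_{e=0}^{i-k}\binom{e+k}{e}u^{m+1-k-e}\right). \]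
   Context: An $m$-Dyck path of size $n$ is a word with $n$ letters $1$ (up steps $(+m,+m)$) and $mn$ letters $0$ (down steps $(+1,-1)$) whose lattice path from $(0,0)$ never goes strictly below the horizontal axis; $\varnothing$ denotes the empty path. The final descent length $d(w)$ is the length $k$ of the longest suffix $0^k$ of $w$. A valley is an occurrence of $01$; a Dyck factor is a factor which is itself an $m$-Dyck path. The greedy $m$-Tamari order is generated by the cover relations $w\triangleleft w'$, one per valley of $w$, where $w'$ is obtained by swapping the down step of the valley with the longest Dyck factor immediately following it. An interval $[v,w]$ is a pair of paths of the same size $n$ with $v\le w$; generating functions weight it by $t^nx^{d(w)}$, and $F(1)$ denotes specialisation at $x=1$. $D(w_1,\dots,w_{m+1})$ denotes $1w_10\,w_20\cdots w_m0\,w_{m+1}$. For $0\le i\le m+1$, $\mathcal J_i$ is the set of greedy intervals $[v,w]$ of positive size with $v=D(v_1,\dots,v_i,\varnothing,\dots,\varnothing)$ for some (possibly empty) $m$-Dyck paths $v_1,\dots,v_i$; $J_i$ is its generating function (so $\mathcal J_0=\{[10^m,10^m]\}$ and $J_{m+1}=I$). -}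

module Defs where

open import Data.Bool using (Bool; true; false)
open import Data.Nat as ℕ using (ℕ; zero; suc; _∸_; _≤_; _<_)
open import Data.Nat.Combinatorics using (_C_)
open import Data.Integer using (+_)
open import Data.Rational as ℚ using (ℚ; 0ℚ; 1ℚ)
open import Data.List using (List; []; _∷_; _++_; length; reverse; concat; map; replicate)
open import Data.List.Relation.Unary.All using (All)
open import Data.List.Relation.Unary.Unique.Propositional using (Unique)
open import Data.List.Membership.Propositional using (_∈_)
open import Data.Product using (Σ; _×_; ∃; ∃-syntax)
open import Relation.Binary.PropositionalEquality using (_≡_)
open import Relation.Binary.Construct.Closure.ReflexiveTransitive using (Star)

-- m-Dyck paths. A word is a list of letters; true = letter 1 (up step
-- (+m,+m)), false = letter 0 (down step (+1,-1)).

Word : Set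
Word = List Bool

ones : Word → ℕ
ones []          = 0
ones (true  ∷ w) = suc (ones w)
ones (false ∷ w) = ones w

zeros : Word → ℕ
zeros []          = 0
zeros (true  ∷ w) = zeros w
zeros (false ∷ w) = suc (zeros w)

IsDyck : ℕ → ℕ → Word → Set
IsDyck m n w =
  ones w ≡ n × zeros w ≡ m ℕ.* n ×
  (∀ p s → w ≡ p ++ s → zeros p ≤ m ℕ.* ones p)

IsDyckAny : ℕ → Word → Set
IsDyckAny m w = ∃[ n ] IsDyck m n w

lead0 : Word → ℕ
lead0 (false ∷ w) = suc (lead0 w)
lead0 _           = 0

finalDescent : Word → ℕ
finalDescent w = lead0 (reverse w)

Cover : ℕ → Word → Word → Set
Cover m w w' =
  ∃[ p ] ∃[ s ] ∃[ u ] ∃[ s' ]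
    (w ≡ p ++ false ∷ true ∷ s) ×
    (true ∷ s ≡ u ++ s') ×
    IsDyckAny m u ×
    (∀ u₁ s₁ → true ∷ s ≡ u₁ ++ s₁ → IsDyckAny m u₁ → length u₁ ≤ length u) ×
    (w' ≡ p ++ u ++ false ∷ s')

_≤G[_]_ : Word → ℕ → Word → Set
v ≤G[ m ] w = Star (Cover m) v w

D : List Word → Word
D []       = true ∷ []
D (w ∷ ws) = true ∷ w ++ concat (map (λ u → false ∷ u) ws)

GInterval : ℕ → ℕ → Word × Word → Set
GInterval m n (v Data.Product., w) =
  1 ≤ n × IsDyck m n v × IsDyck m n w × v ≤G[ m ] w

GIntervalD : ℕ → ℕ → ℕ → Word × Word → Set
GIntervalD m n k (v Data.Product., w) =
  GInterval m n (v Data.Product., w) × finalDescent w ≡ k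

JInterval : ℕ → ℕ → ℕ → ℕ → Word × Word → Set
JInterval m i n k (v Data.Product., w) =
  GIntervalD m n k (v Data.Product., w) ×
  ∃[ vs ] (length vs ≡ i × All (IsDyckAny m) vs ×
           v ≡ D (vs ++ replicate (suc m ∸ i) []))

HasCard : (Word × Word → Set) → ℕ → Set
HasCard P c =
  Σ (List (Word × Word)) λ L →
    Unique L × (∀ q → q ∈ L → P q) × (∀ q → P q → q ∈ L) × length L ≡ c

-- Formal power series in t and x over ℚ: f n k = [t^n x^k] f.

Ser : Set
Ser = ℕ → ℕ → ℚ

sumℚ : ℕ → ℕ → (ℕ → ℚ) → ℚ
sumℚ lo zero      f = 0ℚ
sumℚ lo (suc cnt) f = f lo ℚ.+ sumℚ (suc lo) cnt f

_≈ˢ_ : Ser → Ser → Set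
f ≈ˢ g = ∀ n k → f n k ≡ g n k
infix 4 _≈ˢ_

fromℕℚ : ℕ → ℚ
fromℕℚ n = (+ n) ℚ./ 1

constˢ : ℚ → Ser
constˢ c zero zero = c
constˢ c _    _    = 0ℚ

0ˢ 1ˢ tˢ xˢ : Ser
0ˢ _ _ = 0ℚ
1ˢ = constˢ 1ℚ
tˢ 1 0 = 1ℚ
tˢ _ _ = 0ℚ
xˢ 0 1 = 1ℚ
xˢ _ _ = 0ℚ

_+ˢ_ _-ˢ_ _*ˢ_ : Ser → Ser → Ser
(f +ˢ g) n k = f n k ℚ.+ g n k
(f -ˢ g) n k = f n k ℚ.- g n k
(f *ˢ g) n k =
  sumℚ 0 (suc n) λ a → sumℚ 0 (suc k) λ b → f a b ℚ.* g (n ∸ a) (k ∸ b)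
infixl 6 _+ˢ_ _-ˢ_
infixl 7 _*ˢ_

_·ˢ_ : ℚ → Ser → Ser
(c ·ˢ f) n k = c ℚ.* f n k
infixl 7 _·ˢ_

_^ˢ_ : Ser → ℕ → Ser
f ^ˢ zero  = 1ˢ
f ^ˢ suc e = f *ˢ (f ^ˢ e)
infixr 8 _^ˢ_

sumˢ : ℕ → ℕ → (ℕ → Ser) → Ser
sumˢ lo zero      F = 0ˢ
sumˢ lo (suc cnt) F = F lo +ˢ sumˢ (suc lo) cnt F

sgn : ℕ → ℚ
sgn zero    = 1ℚ
sgn (suc k) = ℚ.- sgn k

tSeries : (ℕ → ℕ) → Ser
tSeries c n zero    = fromℕℚ (c n)
tSeries c n (suc k) = 0ℚ

natSeries : (ℕ → ℕ → ℕ) → Ser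
natSeries c n k = fromℕℚ (c n k)

Htop : ℕ → Ser → Ser → Ser
Htop m z u =
  u ^ˢ (suc (suc m)) *ˢ
  (1ˢ -ˢ z *ˢ sumˢ 0 (suc m) (λ e → fromℕℚ (suc m ∸ e) ·ˢ u ^ˢ e))

Hlow : ℕ → ℕ → Ser → Ser → Ser
Hlow m i z u =
  u ^ˢ (suc i) *ˢ
  (1ˢ
   +ˢ sumˢ 1 (suc i) (λ k →
        (sgn k ℚ.* fromℕℚ (suc i C k)) ·ˢ z ^ˢ k *ˢ
        sumˢ 0 (suc (m ∸ i)) (λ e → fromℕℚ ((e ℕ.+ k ∸ 1) C e) ·ˢ u ^ˢ e))
   +ˢ sumˢ 1 i (λ k →
        (sgn k ℚ.* fromℕℚ ((m ℕ.+ k ∸ i ∸ 1) C (k ∸ 1))) ·ˢ z ^ˢ k *ˢ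
        sumˢ 0 (suc (i ∸ k)) (λ e → fromℕℚ ((e ℕ.+ k) C e) ·ˢ
                                     u ^ˢ (suc m ∸ k ∸ e))))

{-# OPTIONS --safe #-}
module Submission where

-- Let v = D(v₁, …, vᵢ, b, ∅, …, ∅) with b nonempty, so that v = A b 0^j₀ with j₀ = m − i, and let
-- a = A 0^j₀ = D(v₁, …, vᵢ, ∅, …, ∅). A cover of A′ b′ 0^j (where a′ = A′ 0^j) acts either on b′ or on
-- a′, and in the latter case may push one more down step past b′. Hence the paths above v are exactly
-- the A′ b′ 0^j with a ≤ a′, b ≤ b′ and j₀ ≤ j ≤ d(a′), without repetition, and the final descent of
-- such a path is d(b′) + j. Summing x^j over j gives
--   (x − 1)(Jᵢ₊₁ − Jᵢ) = J_{m+1} (x Jᵢ − x^(m−i) Jᵢ(1)),   J₀ = t x^m.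
-- By induction on the power of t this system has a unique solution whose coefficients are polynomials
-- in x. Put c = 1 − m⁺Z, S = 1 − Z Σ_{e≤m} U^e and hᵢ = Hᵢ / u^(i+1), so that x c = U S. The claimed
-- series are t x^m S^(−i−1) hᵢ(Z;U), their values at x = 1 are t c^(−i−1) hᵢ(Z;1), and the system
-- reduces to the polynomial recurrence
--   (u − 1) hᵢ₊₁(u) = (u − 1) hᵢ(u) − z (u^(m−i) hᵢ(1) − hᵢ(u)),
-- which follows coefficientwise from Pascal's rule. The value x = 1 corresponds to U = 1 because
-- (U − 1) h_{m+1}(Z;U) = c (x − 1).

open import Data.Nat as ℕ using (ℕ; zero; suc; _∸_; _≤_; _<_; z≤n; s≤s)
import Data.Nat.Properties as ℕ
open import Algebra using (CommutativeRing)
import Algebra.Properties.Ring as RingProperties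
import Algebra.Properties.Semiring.Mult.TCOptimised as SemiringMult
open import Algebra.Solver.Ring.AlmostCommutativeRing using (fromCommutativeRing; _-Raw-AlmostCommutative⟶_)
import Algebra.Solver.Ring as RingSolver
open import Data.Integer as ℤ using (ℤ; +_; -[1+_])
import Data.Integer.Properties as ℤ
open import Data.Maybe using (Maybe; just; nothing)
import Data.Sign as Sign
import Relation.Binary.PropositionalEquality as ≡
open ≡ using (_≡_)
open import Relation.Nullary using (yes; no)
import Algebra.Properties.Semiring.Exp as SemiringExp
open import Data.Nat.Combinatorics using (_C_; nCk+nC[k+1]≡[n+1]C[k+1]; nCn≡1; nC1≡n; nCk≡nC[n∸k]; k>n⇒nCk≡0)
open import Relation.Binary using (Rel)
import Algebra.Properties.CommutativeSemiring.Exp as CommutativeSemiringExp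
import Algebra.Construct.Pointwise as Pointwise
open import Data.Product using (_,_)

-- The obstacle is the value at x = 1, which makes no sense for a general series in t and x. It is
-- therefore encoded as a relation: `f ~ g` says that g is free of x and that f - g is x - 1 times a
-- series whose rows (the coefficients of the powers of t) are polynomials in x. This relation is a
-- congruence for the ring operations, so U ~ 1 spreads to every expression in U; and it is
-- functional, because a polynomial whose product with x - 1 is constant must vanish. U ~ 1 itself
-- comes from dividing by `h (suc m)`, which is invertible with polynomial rows. Uniqueness holds
-- because J_{m+1} and the bracket are both divisible by t: row n of the right side sees only rows
-- below n, and x - 1 cancels row by row. On the side of paths, the longest Dyck factor is replaced
-- by a local condition, that no up step follows. The bound j₀ ≤ j comes from `Tight`: a Dyck factor
-- that follows a down step of A never reaches the end of A, so covers of a leave its last j₀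
-- letters alone. Larger j arise when b is swapped with down steps before it.

-- Ring identities with integer coefficients in any commutative ring

module IntegerSolver {r ℓ} (R : CommutativeRing r ℓ) where
  open CommutativeRing R
  open RingProperties ring
  open SemiringMult semiring
  open import Relation.Binary.Reasoning.Setoid setoid

  -- With this variant of `_×_` the multiple `1 × 1#` reduces to `1#`, so the solver constants `𝟙`
  -- and `𝟘` denote `1#` and `0#` definitionally and solved equations match the goals as written.
  ⟦_⟧ : ℤ → Carrier
  ⟦ + n ⟧      = n × 1#
  ⟦ -[1+ n ] ⟧ = - (suc n × 1#)

  suc× : ∀ n → suc n × 1# ≈ 1# + n × 1#
  suc× n = ×-homo-+ 1# 1 n

  ⊖-homo : ∀ m n → ⟦ m ℤ.⊖ n ⟧ ≈ m × 1# - n × 1#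
  ⊖-homo zero zero = sym (-‿inverseʳ 0#)
  ⊖-homo zero (suc n) = sym (+-identityˡ _)
  ⊖-homo (suc m) zero = sym (trans (+-congˡ -0#≈0#) (+-identityʳ _))
  ⊖-homo (suc m) (suc n) = begin
    ⟦ suc m ℤ.⊖ suc n ⟧                   ≡⟨ ≡.cong ⟦_⟧ (ℤ.[1+m]⊖[1+n]≡m⊖n m n) ⟩
    ⟦ m ℤ.⊖ n ⟧                           ≈⟨ ⊖-homo m n ⟩
    m × 1# - n × 1#                       ≈⟨ +-congʳ (sym (xyx⁻¹≈y 1# (m × 1#))) ⟩
    1# + m × 1# - 1# - n × 1#             ≈⟨ +-assoc _ _ _ ⟩
    1# + m × 1# + (- 1# - n × 1#)         ≈⟨ +-congˡ (-‿+-comm _ _) ⟩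
    (1# + m × 1#) - (1# + n × 1#)         ≈⟨ +-cong (sym (suc× m)) (-‿cong (sym (suc× n))) ⟩
    suc m × 1# - suc n × 1#               ∎

  neg-homo : ∀ i → ⟦ ℤ.- i ⟧ ≈ - ⟦ i ⟧
  neg-homo (+ zero)  = sym -0#≈0#
  neg-homo (+ suc n) = refl
  neg-homo -[1+ n ]  = sym (-‿involutive _)

  +-homo : ∀ i j → ⟦ i ℤ.+ j ⟧ ≈ ⟦ i ⟧ + ⟦ j ⟧
  +-homo (+ m)    (+ n)    = ×-homo-+ 1# m n
  +-homo (+ m)    -[1+ n ] = ⊖-homo m (suc n)
  +-homo -[1+ m ] (+ n)    = trans (⊖-homo n (suc m)) (+-comm _ _)
  +-homo -[1+ m ] -[1+ n ] = begin
    - (suc (suc (m ℕ.+ n)) × 1#)      ≡⟨ ≡.cong (λ k → - (k × 1#)) (≡.cong suc (≡.sym (ℕ.+-suc m n))) ⟩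
    - ((suc m ℕ.+ suc n) × 1#)        ≈⟨ -‿cong (×-homo-+ 1# (suc m) (suc n)) ⟩
    - (suc m × 1# + suc n × 1#)       ≈⟨ sym (-‿+-comm _ _) ⟩
    - (suc m × 1#) - suc n × 1#       ∎

  -◃-homo : ∀ n → ⟦ Sign.- ℤ.◃ n ⟧ ≈ - (n × 1#)
  -◃-homo zero    = sym -0#≈0#
  -◃-homo (suc n) = refl

  *-homo : ∀ i j → ⟦ i ℤ.* j ⟧ ≈ ⟦ i ⟧ * ⟦ j ⟧
  *-homo (+ m) (+ n) = begin
    ⟦ Sign.+ ℤ.◃ m ℕ.* n ⟧   ≡⟨ ≡.cong ⟦_⟧ (ℤ.+◃n≡+n (m ℕ.* n)) ⟩
    (m ℕ.* n) × 1#           ≈⟨ ×1-homo-* m n ⟩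
    m × 1# * n × 1#          ∎
  *-homo (+ m) -[1+ n ] = begin
    ⟦ Sign.- ℤ.◃ m ℕ.* suc n ⟧     ≈⟨ -◃-homo (m ℕ.* suc n) ⟩
    - ((m ℕ.* suc n) × 1#)         ≈⟨ -‿cong (×1-homo-* m (suc n)) ⟩
    - (m × 1# * (suc n × 1#))      ≈⟨ -‿distribʳ-* _ _ ⟩
    m × 1# * - (suc n × 1#)        ∎
  *-homo -[1+ m ] (+ n) = begin
    ⟦ Sign.- ℤ.◃ suc m ℕ.* n ⟧     ≈⟨ -◃-homo (suc m ℕ.* n) ⟩
    - ((suc m ℕ.* n) × 1#)         ≈⟨ -‿cong (×1-homo-* (suc m) n) ⟩
    - ((suc m × 1#) * (n × 1#))    ≈⟨ -‿distribˡ-* _ _ ⟩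
    - (suc m × 1#) * (n × 1#)      ∎
  *-homo -[1+ m ] -[1+ n ] = begin
    (suc m ℕ.* suc n) × 1#                ≈⟨ ×1-homo-* (suc m) (suc n) ⟩
    (suc m × 1#) * (suc n × 1#)           ≈⟨ sym (-‿involutive _) ⟩
    - - ((suc m × 1#) * (suc n × 1#))     ≈⟨ -‿cong (-‿distribˡ-* _ _) ⟩
    - (- (suc m × 1#) * (suc n × 1#))     ≈⟨ -‿distribʳ-* _ _ ⟩
    - (suc m × 1#) * - (suc n × 1#)       ∎

  morphism : ℤ.+-*-rawRing -Raw-AlmostCommutative⟶ fromCommutativeRing R
  morphism = record
    { ⟦_⟧    = ⟦_⟧
    ; +-homo = +-homo
    ; *-homo = *-homo
    ; -‿homo = neg-homo
    ; 0-homo = refl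
    ; 1-homo = refl
    }

  weakly-≟ : ∀ i j → Maybe (⟦ i ⟧ ≈ ⟦ j ⟧)
  weakly-≟ i j with i ℤ.≟ j
  ... | yes ≡.refl = just refl
  ... | no _       = nothing

  open RingSolver ℤ.+-*-rawRing (fromCommutativeRing R) morphism weakly-≟ public
    using (solve; _:=_; _:+_; _:*_; _:-_; :-_; con; _:^_; Polynomial)
  𝟙 : ∀ {n} → Polynomial n
  𝟙 = con (+ 1)

  𝟘 : ∀ {n} → Polynomial n
  𝟘 = con (+ 0)

-- Binomial coefficients as multiset numbers

-- The number of multisets of size `e` on `k` kinds, that is binom(e+k-1, e) without truncated
-- subtraction. Its value 0 at `k = 0` and positive `e` later lets one formula cover i = m+1 too.
multichoose : ℕ → ℕ → ℕ
multichoose zero    k       = 1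
multichoose (suc e) zero    = 0
multichoose (suc e) (suc k) = multichoose e (suc k) ℕ.+ multichoose (suc e) k

multichoose-1 : ∀ e → multichoose e 1 ≡ 1
multichoose-1 zero = ≡.refl
multichoose-1 (suc e) = ≡.trans (ℕ.+-identityʳ _) (multichoose-1 e)

-- Both sides are binom(e+k, e) = binom(e+k, k): they obey the same Pascal recursion with the
-- arguments exchanged.
multichoose-sym : ∀ e k → multichoose e (suc k) ≡ multichoose k (suc e)
multichoose-sym zero    zero    = ≡.refl
multichoose-sym zero    (suc k) = ≡.sym (multichoose-1 (suc k))
multichoose-sym (suc e) zero    = multichoose-1 (suc e)
multichoose-sym (suc e) (suc k) = ≡.trans
  (≡.cong₂ ℕ._+_ (multichoose-sym e (suc k)) (multichoose-sym (suc e) k))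
  (ℕ.+-comm (multichoose (suc k) (suc e)) _)

multichoose≡C : ∀ e k → multichoose e (suc k) ≡ (e ℕ.+ k) C e
multichoose≡C zero    k       = ≡.refl
multichoose≡C (suc e) zero    = ≡.trans (multichoose-1 (suc e))
  (≡.trans (≡.sym (nCn≡1 (suc e))) (≡.cong (_C suc e) (≡.sym (ℕ.+-identityʳ (suc e)))))
multichoose≡C (suc e) (suc k) = ≡.trans
  (≡.cong₂ ℕ._+_ (multichoose≡C e (suc k))
     (≡.trans (multichoose≡C (suc e) k) (≡.cong (_C suc e) (≡.sym (ℕ.+-suc e k)))))
  (nCk+nC[k+1]≡[n+1]C[k+1] (e ℕ.+ suc k) e)

-- Finite sums over consecutive indices

module Summation {r ℓ} (R : CommutativeRing r ℓ) where
  open CommutativeRing R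
  open SemiringExp semiring using (_^_)
  open IntegerSolver R using (solve; _:=_; _:+_; _:*_; _:-_; 𝟙; 𝟘)
  open import Relation.Binary.Reasoning.Setoid setoid

  -- Recursion on start and count, as in `sumℚ` and `sumˢ`, so that those translate by a direct
  -- induction.
  ∑ : ℕ → ℕ → (ℕ → Carrier) → Carrier
  ∑ lo zero    f = 0#
  ∑ lo (suc n) f = f lo + ∑ (suc lo) n f

  ∑-cong : ∀ lo n {f g : ℕ → Carrier} → (∀ k → lo ≤ k → k < lo ℕ.+ n → f k ≈ g k) → ∑ lo n f ≈ ∑ lo n g
  ∑-cong lo zero    e = refl
  ∑-cong lo (suc n) e = +-cong (e lo ℕ.≤-refl (ℕ.m<m+n lo (s≤s z≤n)))
    (∑-cong (suc lo) n λ k l r → e k (ℕ.<⇒≤ l) (≡.subst (k <_) (≡.sym (ℕ.+-suc lo n)) r))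

  ∑-snoc : ∀ lo n f → ∑ lo (suc n) f ≈ ∑ lo n f + f (lo ℕ.+ n)
  ∑-snoc lo zero    f = trans (+-comm _ _) (+-congˡ (reflexive (≡.cong f (≡.sym (ℕ.+-identityʳ lo)))))
  ∑-snoc lo (suc n) f = begin
    f lo + ∑ (suc lo) (suc n) f                     ≈⟨ +-congˡ (∑-snoc (suc lo) n f) ⟩
    f lo + (∑ (suc lo) n f + f (suc lo ℕ.+ n))      ≈⟨ sym (+-assoc _ _ _) ⟩
    f lo + ∑ (suc lo) n f + f (suc lo ℕ.+ n)        ≡⟨ ≡.cong (λ k → f lo + ∑ (suc lo) n f + f k) (≡.sym (ℕ.+-suc lo n)) ⟩
    f lo + ∑ (suc lo) n f + f (lo ℕ.+ suc n)        ∎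

  ∑-shift : ∀ lo n f → ∑ (suc lo) n f ≈ ∑ lo n (λ k → f (suc k))
  ∑-shift lo zero    f = refl
  ∑-shift lo (suc n) f = +-congˡ (∑-shift (suc lo) n f)

  ∑-+ : ∀ lo n f g → ∑ lo n (λ k → f k + g k) ≈ ∑ lo n f + ∑ lo n g
  ∑-+ lo zero    f g = sym (+-identityˡ _)
  ∑-+ lo (suc n) f g = trans (+-congˡ (∑-+ (suc lo) n f g))
    (solve 4 (λ a b s t → (a :+ b) :+ (s :+ t) := (a :+ s) :+ (b :+ t)) refl _ _ _ _)

  ∑-*ˡ : ∀ lo n a f → ∑ lo n (λ k → a * f k) ≈ a * ∑ lo n f
  ∑-*ˡ lo zero    a f = sym (zeroʳ _)
  ∑-*ˡ lo (suc n) a f = trans (+-congˡ (∑-*ˡ (suc lo) n a f)) (sym (distribˡ _ _ _))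

  ∑-reverse : ∀ n f → ∑ 0 (suc n) f ≈ ∑ 0 (suc n) (λ e → f (n ∸ e))
  ∑-reverse zero    f = refl
  ∑-reverse (suc n) f = begin
    f 0 + ∑ 1 (suc n) f                               ≈⟨ +-congˡ (trans (∑-shift 0 (suc n) f) (∑-reverse n (λ e → f (suc e)))) ⟩
    f 0 + ∑ 0 (suc n) (λ e → f (suc (n ∸ e)))         ≈⟨ +-comm _ _ ⟩
    ∑ 0 (suc n) (λ e → f (suc (n ∸ e))) + f 0         ≈⟨ +-cong (∑-cong 0 (suc n) λ { k _ (s≤s k≤n) →
                                                             reflexive (≡.cong f (≡.sym (ℕ.+-∸-assoc 1 k≤n))) })
                                                           (reflexive (≡.cong f (≡.sym (ℕ.n∸n≡0 (suc n))))) ⟩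
    ∑ 0 (suc n) (λ e → f (suc n ∸ e)) + f (suc n ∸ suc n) ≈⟨ sym (∑-snoc 0 (suc n) (λ e → f (suc n ∸ e))) ⟩
    ∑ 0 (suc (suc n)) (λ e → f (suc n ∸ e))           ∎

  geometric-suc : ∀ n u → ∑ 0 (suc n) (u ^_) ≈ 1# + u * ∑ 0 n (u ^_)
  geometric-suc n u = +-congˡ (trans (∑-shift 0 n (u ^_)) (∑-*ˡ 0 n u (u ^_)))

  geometric : ∀ n u → (u - 1#) * ∑ 0 n (u ^_) ≈ u ^ n - 1#
  geometric zero    u = trans (zeroʳ _) (sym (-‿inverseʳ _))
  geometric (suc n) u = begin
    (u - 1#) * ∑ 0 (suc n) (u ^_)             ≈⟨ *-congˡ (geometric-suc n u) ⟩
    (u - 1#) * (1# + u * ∑ 0 n (u ^_))        ≈⟨ solve 2 (λ u g → (u :- 𝟙) :* (𝟙 :+ u :* g) := (u :- 𝟙) :+ u :* ((u :- 𝟙) :* g)) refl _ _ ⟩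
    (u - 1#) + u * ((u - 1#) * ∑ 0 n (u ^_))  ≈⟨ +-congˡ (*-congˡ (geometric n u)) ⟩
    (u - 1#) + u * (u ^ n - 1#)               ≈⟨ solve 2 (λ u w → (u :- 𝟙) :+ u :* (w :- 𝟙) := u :* w :- 𝟙) refl _ _ ⟩
    u ^ suc n - 1#                            ∎

-- The polynomials H_i and their recurrence in i

module Polynomials {r ℓ} (R : CommutativeRing r ℓ) (m : ℕ) where
  open CommutativeRing R
  open SemiringMult semiring using (_×_; ×-homo-+)
  open SemiringExp semiring using (_^_; ^-congˡ)
  open Summation R
  open IntegerSolver R using (solve; _:=_; _:+_; _:*_; _:-_; :-_; 𝟙; 𝟘)
  open import Relation.Binary.Reasoning.Setoid setoid

  ι : ℕ → Carrier
  ι n = n × 1#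

  ι-+ : ∀ a b → ι (a ℕ.+ b) ≈ ι a + ι b
  ι-+ = ×-homo-+ 1#

  ι-cong : ∀ {a b} → a ≡ b → ι a ≈ ι b
  ι-cong ≡.refl = refl

  ι-pascal : ∀ n k → ι (suc n C suc k) ≈ ι (n C k) + ι (n C suc k)
  ι-pascal n k = trans (ι-cong (≡.sym (nCk+nC[k+1]≡[n+1]C[k+1] n k))) (ι-+ (n C k) (n C suc k))

  1^n≈1 : ∀ n → 1# ^ n ≈ 1#
  1^n≈1 zero    = refl
  1^n≈1 (suc n) = trans (*-identityˡ _) (1^n≈1 n)

  -- The first inner sum of H_i, with N = m-i+1. New terms enter at the upper end, so raising i by
  -- one removes a single term.
  P : ℕ → ℕ → Carrier → Carrier
  P zero    k u = 0#
  P (suc N) k u = P N k u + ι (multichoose N k) * u ^ N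

  -- The second inner sum of H_i reindexed by j = e+k-1: the term binom(e+k, e) u^(m+1-k-e) becomes
  -- binom(j+1, k) u^(m-j). Terms with j+1 < k are zero, so the sum may start at j = 0, and raising
  -- i appends a single term.
  Q : ℕ → ℕ → Carrier → Carrier
  Q zero    k u = 0#
  Q (suc i) k u = Q i k u + ι (suc i C k) * u ^ (m ∸ i)

  P-zero : ∀ N u → P (suc N) 0 u ≈ 1#
  P-zero zero u = solve 0 (𝟘 :+ 𝟙 :* 𝟙 := 𝟙) refl
  P-zero (suc N) u = trans (+-cong (P-zero N u) (zeroˡ _)) (+-identityʳ _)

  -- Hockey-stick summation, one use of Pascal's rule per term; `Q-at-1` is the same for ordinary
  -- binomials.
  P-at-1 : ∀ N k → P (suc N) k 1# ≈ ι (multichoose N (suc k))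
  P-at-1 zero    k = trans (+-identityˡ _) (*-identityˡ _)
  P-at-1 (suc N) k = begin
    P (suc N) k 1# + ι (multichoose (suc N) k) * 1# ^ suc N
      ≈⟨ +-cong (P-at-1 N k) (trans (*-congˡ (1^n≈1 (suc N))) (*-identityʳ _)) ⟩
    ι (multichoose N (suc k)) + ι (multichoose (suc N) k)
      ≈⟨ sym (ι-+ (multichoose N (suc k)) (multichoose (suc N) k)) ⟩
    ι (multichoose (suc N) (suc k)) ∎

  Q-at-1 : ∀ i k → Q i (suc k) 1# ≈ ι (suc i C suc (suc k))
  Q-at-1 zero    k = ι-cong (≡.sym (k>n⇒nCk≡0 {1} {suc (suc k)} (s≤s (s≤s z≤n))))
  Q-at-1 (suc i) k = begin
    Q i (suc k) 1# + ι (suc i C suc k) * 1# ^ (m ∸ i)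
      ≈⟨ +-cong (Q-at-1 i k) (trans (*-congˡ (1^n≈1 (m ∸ i))) (*-identityʳ _)) ⟩
    ι (suc i C suc (suc k)) + ι (suc i C suc k)   ≈⟨ +-comm _ _ ⟩
    ι (suc i C suc k) + ι (suc i C suc (suc k))   ≈⟨ sym (ι-pascal (suc i) (suc k)) ⟩
    ι (suc (suc i) C suc (suc k))                 ∎

  -- Summation by parts: the factor u-1 replaces coefficients by their differences, and the
  -- differences of multichoose(e, k+1) in e are multichoose(e, k). The boundary coefficient is the
  -- value of `P (suc N) k` at 1.
  P-quotient : ∀ N k u →
    (u - 1#) * P N (suc k) u ≈ u ^ N * ι (multichoose N (suc k)) - P (suc N) k u
  P-quotient zero    k u = solve 1 (λ u →
    (u :- 𝟙) :* 𝟘 := 𝟙 :* 𝟙 :- (𝟘 :+ 𝟙 :* 𝟙)) refl u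
  P-quotient (suc N) k u = begin
    (u - 1#) * (p + b * w)                  ≈⟨ distribˡ _ _ _ ⟩
    (u - 1#) * p + (u - 1#) * (b * w)       ≈⟨ +-congʳ (P-quotient N k u) ⟩
    w * b - p′ + (u - 1#) * (b * w)
      ≈⟨ solve 5 (λ u w b b′ p′ → w :* b :- p′ :+ (u :- 𝟙) :* (b :* w)
           := (u :* w) :* (b :+ b′) :- (p′ :+ b′ :* (u :* w))) refl u w b b′ p′ ⟩
    u * w * (b + b′) - (p′ + b′ * (u * w))  ≈⟨ +-congʳ (*-congˡ (sym (ι-+ (multichoose N (suc k)) (multichoose (suc N) k)))) ⟩
    u ^ suc N * ι (multichoose (suc N) (suc k)) - P (suc (suc N)) k u ∎
    where
    p = P N (suc k) u
    p′ = P (suc N) k u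
    w = u ^ N
    b = ι (multichoose N (suc k))
    b′ = ι (multichoose (suc N) k)

  -- Summation by parts with descending exponents; `i ≤ m` keeps the truncated exponents from being
  -- clipped.
  Q-quotient : ∀ i k u → i ≤ m →
    (u - 1#) * Q (suc i) (suc (suc k)) u
      ≈ Q i (suc k) u - ι (suc i C suc (suc k)) * u ^ (m ∸ i)
  Q-quotient zero    k u _ = begin
    (u - 1#) * (0# + ι (1 C suc (suc k)) * u ^ m)   ≈⟨ *-congˡ (+-congˡ (*-congʳ z)) ⟩
    (u - 1#) * (0# + 0# * u ^ m)
      ≈⟨ solve 2 (λ u w → (u :- 𝟙) :* (𝟘 :+ 𝟘 :* w) := 𝟘 :- 𝟘 :* w) refl u (u ^ m) ⟩
    0# - 0# * u ^ m                                 ≈⟨ +-congˡ (-‿cong (*-congʳ (sym z))) ⟩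
    0# - ι (1 C suc (suc k)) * u ^ m                ∎
    where
    z : ι (1 C suc (suc k)) ≈ 0#
    z = ι-cong (k>n⇒nCk≡0 {1} {suc (suc k)} (s≤s (s≤s z≤n)))
  Q-quotient (suc i) k u i<m = begin
    (u - 1#) * (q + c₂ * w)                     ≈⟨ distribˡ _ _ _ ⟩
    (u - 1#) * q + (u - 1#) * (c₂ * w)          ≈⟨ +-cong (Q-quotient i k u (ℕ.<⇒≤ i<m)) (*-congˡ (*-congʳ pascal)) ⟩
    q′ - c₁ * u ^ (m ∸ i) + (u - 1#) * ((c₀ + c₁) * w)
      ≈⟨ +-congʳ (+-congˡ (-‿cong (*-congˡ uw))) ⟩
    q′ - c₁ * (u * w) + (u - 1#) * ((c₀ + c₁) * w)
      ≈⟨ solve 5 (λ u w q′ c₀ c₁ →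
           q′ :- c₁ :* (u :* w) :+ (u :- 𝟙) :* ((c₀ :+ c₁) :* w)
             := q′ :+ c₀ :* (u :* w) :- (c₀ :+ c₁) :* w) refl u w q′ c₀ c₁ ⟩
    q′ + c₀ * (u * w) - (c₀ + c₁) * w
      ≈⟨ +-cong (+-congˡ (*-congˡ (sym uw))) (-‿cong (*-congʳ (sym pascal))) ⟩
    Q (suc i) (suc k) u - c₂ * w ∎
    where
    w  = u ^ (m ∸ suc i)
    q  = Q (suc i) (suc (suc k)) u
    q′ = Q i (suc k) u
    c₀ = ι (suc i C suc k)
    c₁ = ι (suc i C suc (suc k))
    c₂ = ι (suc (suc i) C suc (suc k))
    pascal : c₂ ≈ c₀ + c₁
    pascal = ι-pascal (suc i) (suc k)
    uw : u ^ (m ∸ i) ≈ u * w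
    uw = reflexive (≡.cong (u ^_) (≡.sym (≡.trans (≡.sym (ℕ.+-∸-assoc 1 i<m)) ≡.refl)))

  -- The coefficient of (-z)^(k+1) in Hᵢ(z;u) / u^(i+1), which is h i z u below.
  A : ℕ → ℕ → Carrier → Carrier
  A i k u = ι (suc i C suc k) * P (suc m ∸ i) (suc k) u
          + ι (multichoose k (suc m ∸ i)) * Q i (suc k) u

  A-unfold : ∀ i k u → i ≤ m → A i k u ≈
    ι (suc i C suc k) * P (suc (m ∸ i)) (suc k) u
          + ι (multichoose k (suc (m ∸ i))) * Q i (suc k) u
  A-unfold i k u i≤m rewrite ℕ.+-∸-assoc 1 i≤m = refl

  -- Degree one in -z: the constant term of h_i is 1 both at u and at 1, whence the inhomogeneous
  -- part u^(m-i) - 1.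
  A-step-zero : ∀ i u → i ≤ m →
    (u - 1#) * A (suc i) 0 u ≈ (u - 1#) * A i 0 u + (u ^ (m ∸ i) - 1#)
  A-step-zero i u i≤m = begin
    (u - 1#) * (ι (suc (suc i) C 1) * p + 1# * (q + c * w))
      ≈⟨ *-congˡ (+-congʳ (*-congʳ (ι-pascal (suc i) 0))) ⟩
    (u - 1#) * ((1# + c) * p + 1# * (q + c * w))
      ≈⟨ solve 5 (λ u p q c w →
          (u :- 𝟙) :* ((𝟙 :+ c) :* p :+ 𝟙 :* (q :+ c :* w))
          := (u :- 𝟙) :* (c :* (p :+ 𝟙 :* w) :+ 𝟙 :* q) :+ (u :- 𝟙) :* p) refl u p q c w ⟩
    (u - 1#) * (c * (p + 1# * w) + 1# * q) + (u - 1#) * p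
      ≈⟨ +-cong (*-congˡ (+-congʳ (*-congˡ (+-congˡ (*-congʳ (sym m1))))))
                (trans (P-quotient (m ∸ i) 0 u)
                  (+-cong (trans (*-congˡ m1) (*-identityʳ _)) (-‿cong (P-zero (m ∸ i) u)))) ⟩
    (u - 1#) * (c * P (suc (m ∸ i)) 1 u + 1# * q) + (w - 1#)
      ≈⟨ +-congʳ (*-congˡ (sym (A-unfold i 0 u i≤m))) ⟩
    (u - 1#) * A i 0 u + (w - 1#) ∎
    where
    p = P (m ∸ i) 1 u
    q = Q i 1 u
    c = ι (suc i C 1)
    w = u ^ (m ∸ i)
    m1 : ι (multichoose (m ∸ i) 1) ≈ 1#
    m1 = ι-cong (multichoose-1 (m ∸ i))

  -- The recurrence of h at degree k+2 in -z. Pascal's rule in i removes one term from `P` and adds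
  -- one to `Q`; the corrections, multiplied by u-1, are what `P-quotient` and `Q-quotient`
  -- evaluate, and the boundary terms assemble to the value at u = 1.
  A-step : ∀ i k u → i ≤ m →
    (u - 1#) * A (suc i) (suc k) u
      ≈ (u - 1#) * A i (suc k) u + (u ^ (m ∸ i) * A i k 1# - A i k u)
  A-step i k u i≤m = begin
    (u - 1#) * (ι (suc (suc i) C suc (suc k)) * p + b₂ * (q + c₂ * w))
      ≈⟨ *-congˡ (+-congʳ (*-congʳ (ι-pascal (suc i) (suc k)))) ⟩
    (u - 1#) * ((c₁ + c₂) * p + b₂ * (q + c₂ * w))
      ≈⟨ solve 8 (λ u p q w c₁ c₂ b₁ b₂ →
           (u :- 𝟙) :* ((c₁ :+ c₂) :* p :+ b₂ :* (q :+ c₂ :* w))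
           := (u :- 𝟙) :* (c₂ :* (p :+ (b₁ :+ b₂) :* w) :+ (b₁ :+ b₂) :* q)
              :+ (c₁ :* ((u :- 𝟙) :* p) :- b₁ :* ((u :- 𝟙) :* (q :+ c₂ :* w))))
           refl u p q w c₁ c₂ b₁ b₂ ⟩
    (u - 1#) * (c₂ * (p + (b₁ + b₂) * w) + (b₁ + b₂) * q)
      + (c₁ * ((u - 1#) * p) - b₁ * ((u - 1#) * (q + c₂ * w)))
      ≈⟨ +-cong (*-congˡ (+-cong (*-congˡ (+-congˡ (*-congʳ (sym bsym)))) (*-congʳ (sym (ι-+ (multichoose k (suc N)) (multichoose (suc k) N))))))
                (+-cong (*-congˡ (P-quotient (m ∸ i) (suc k) u))
                        (-‿cong (*-congˡ (Q-quotient i k u i≤m)))) ⟩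
    (u - 1#) * (c₂ * P (suc N) (suc (suc k)) u + ι (multichoose (suc k) (suc N)) * q)
      + (c₁ * (w * p₁ - pk) - b₁ * (qk - c₂ * w))
      ≈⟨ +-cong (*-congˡ (sym (A-unfold i (suc k) u i≤m)))
           (solve 7 (λ w p₁ pk qk c₁ c₂ b₁ →
             c₁ :* (w :* p₁ :- pk) :- b₁ :* (qk :- c₂ :* w)
             := w :* (c₁ :* p₁ :+ b₁ :* c₂) :- (c₁ :* pk :+ b₁ :* qk))
             refl w p₁ pk qk c₁ c₂ b₁) ⟩
    (u - 1#) * A i (suc k) u + (w * (c₁ * p₁ + b₁ * c₂) - (c₁ * pk + b₁ * qk))
      ≈⟨ +-congˡ (+-cong (*-congˡ (sym (trans (A-unfold i k 1# i≤m)
            (+-cong (*-congˡ (P-at-1 N (suc k))) (*-congˡ (Q-at-1 i k))))))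
           (-‿cong (sym (A-unfold i k u i≤m)))) ⟩
    (u - 1#) * A i (suc k) u + (w * A i k 1# - A i k u) ∎
    where
    N = m ∸ i
    p = P N (suc (suc k)) u
    q = Q i (suc (suc k)) u
    pk = P (suc N) (suc k) u
    p₁ = ι (multichoose N (suc (suc k)))
    qk = Q i (suc k) u
    w = u ^ N
    c₁ = ι (suc i C suc k)
    c₂ = ι (suc i C suc (suc k))
    b₁ = ι (multichoose k (suc N))
    b₂ = ι (multichoose (suc k) N)
    -- The coefficient dropped from `P` is the sum of two weights of `Q`, those in `A i k` and in
    -- `A (suc i) (suc k)`. This couples the two halves of `A`.
    bsym : ι (multichoose N (suc (suc k))) ≈ b₁ + b₂
    bsym = trans (ι-cong (multichoose-sym N (suc k))) (ι-+ (multichoose k (suc N)) (multichoose (suc k) N))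

  Q-vanish : ∀ i k u → i ≤ k → Q i (suc k) u ≈ 0#
  Q-vanish zero    k u _   = refl
  Q-vanish (suc i) k u i<k = trans
    (+-cong (Q-vanish i k u (ℕ.<⇒≤ i<k)) (trans (*-congʳ (ι-cong (k>n⇒nCk≡0 (s≤s i<k)))) (zeroˡ _)))
    (+-identityˡ _)

  A-vanish : ∀ i k u → i < k → A i k u ≈ 0#
  A-vanish i k u i<k = trans
    (+-cong (trans (*-congʳ (ι-cong (k>n⇒nCk≡0 (s≤s i<k)))) (zeroˡ _))
            (trans (*-congˡ (Q-vanish i k u (ℕ.<⇒≤ i<k))) (zeroʳ _)))
    (+-identityˡ _)

  -- The truncation of h_i at degree K in z. The factor z in the recurrence costs one degree, so the
  -- recurrence is proved between truncations of different degree.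
  F : ℕ → ℕ → Carrier → Carrier → Carrier
  F i zero    z u = 1#
  F i (suc K) z u = F i K z u + (- z) ^ suc K * A i K u

  F-step : ∀ i K z u → i ≤ m →
    (u - 1#) * F (suc i) (suc K) z u
      ≈ (u - 1#) * F i (suc K) z u + - z * (u ^ (m ∸ i) * F i K z 1# - F i K z u)
  F-step i zero z u i≤m = begin
    (u - 1#) * (1# + y * a′)   ≈⟨ solve 3 (λ v y a′ → v :* (𝟙 :+ y :* a′) := v :+ y :* (v :* a′)) refl (u - 1#) y a′ ⟩
    (u - 1#) + y * ((u - 1#) * a′)  ≈⟨ +-congˡ (*-congˡ (A-step-zero i u i≤m)) ⟩
    (u - 1#) + y * ((u - 1#) * a + (w - 1#))
      ≈⟨ solve 5 (λ v y z a w → v :+ (:- z :* 𝟙) :* (v :* a :+ (w :- 𝟙))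
          := v :* (𝟙 :+ (:- z :* 𝟙) :* a) :+ :- z :* (w :* 𝟙 :- 𝟙)) refl (u - 1#) y z a w ⟩
    (u - 1#) * (1# + y * a) + - z * (w * 1# - 1#) ∎
    where
    y = (- z) ^ 1
    a = A i 0 u
    a′ = A (suc i) 0 u
    w = u ^ (m ∸ i)
  F-step i (suc K) z u i≤m = begin
    (u - 1#) * (f′ + Y * a′)               ≈⟨ solve 4 (λ v f Y a → v :* (f :+ Y :* a) := v :* f :+ Y :* (v :* a)) refl (u - 1#) f′ Y a′ ⟩
    (u - 1#) * f′ + Y * ((u - 1#) * a′)    ≈⟨ +-cong (F-step i K z u i≤m) (*-congˡ (A-step i K u i≤m)) ⟩
    (u - 1#) * f + - z * (w * f₁ - f₀) + (- z * y) * ((u - 1#) * a + (w * a₁ - a₀))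
      ≈⟨ solve 10 (λ v f z w f₁ f₀ y a a₁ a₀ →
           v :* f :+ :- z :* (w :* f₁ :- f₀) :+ (:- z :* y) :* (v :* a :+ (w :* a₁ :- a₀))
           := v :* (f :+ (:- z :* y) :* a) :+ :- z :* (w :* (f₁ :+ y :* a₁) :- (f₀ :+ y :* a₀)))
           refl (u - 1#) f z w f₁ f₀ y a a₁ a₀ ⟩
    (u - 1#) * (f + Y * a) + - z * (w * (f₁ + y * a₁) - (f₀ + y * a₀)) ∎
    where
    y = (- z) ^ suc K
    Y = (- z) ^ suc (suc K)
    f = F i (suc K) z u
    f′ = F (suc i) (suc K) z u
    f₁ = F i K z 1#
    f₀ = F i K z u
    a = A i (suc K) u
    a′ = A (suc i) (suc K) u
    a₁ = A i K 1#
    a₀ = A i K u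
    w = u ^ (m ∸ i)

  -- Coefficients vanish beyond degree i+1 in z, so m+2 is enough for every i ≤ m+1, and a common
  -- bound keeps the recurrence uniform in i.
  h : ℕ → Carrier → Carrier → Carrier
  h i = F i (suc (suc m))

  h-step : ∀ i z u → i ≤ m →
    (u - 1#) * h (suc i) z u
      ≈ (u - 1#) * h i z u - z * (u ^ (m ∸ i) * h i z 1# - h i z u)
  h-step i z u i≤m = begin
    (u - 1#) * h (suc i) z u ≈⟨ F-step i (suc m) z u i≤m ⟩
    (u - 1#) * h i z u + - z * (w * F i (suc m) z 1# - F i (suc m) z u)
      ≈⟨ +-congˡ (*-congˡ (+-cong (*-congˡ (drop 1#)) (-‿cong (drop u)))) ⟩
    (u - 1#) * h i z u + - z * (w * h i z 1# - h i z u)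
      ≈⟨ +-congˡ (solve 2 (λ z e → :- z :* e := :- (z :* e)) refl _ _) ⟩
    (u - 1#) * h i z u - z * (w * h i z 1# - h i z u) ∎
    where
    w = u ^ (m ∸ i)
    -- For i ≤ m there is no term of degree m+2, which makes up for the degree lost in `F-step`.
    drop : ∀ v → F i (suc m) z v ≈ h i z v
    drop v = sym (trans (+-congˡ (trans (*-congˡ (A-vanish i (suc m) v (s≤s i≤m))) (zeroʳ _))) (+-identityʳ _))

  weightedGeometric : ℕ → Carrier → Carrier
  weightedGeometric n u = ∑ 0 n (λ e → ι (n ∸ e) * u ^ e)

  weightedGeometric-quotient : ∀ n u →
    (u - 1#) * weightedGeometric n u ≈ u * ∑ 0 n (u ^_) - ι n
  weightedGeometric-quotient zero    u = solve 1 (λ u → (u :- 𝟙) :* 𝟘 := u :* 𝟘 :- 𝟘) refl u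
  weightedGeometric-quotient (suc n) u = begin
    (u - 1#) * (ι (suc n) * 1# + ∑ 1 n (λ e → ι (suc n ∸ e) * u ^ e))
      ≈⟨ *-congˡ (+-cong (*-congʳ (ι-+ 1 n)) (trans (∑-shift 0 n _) (trans
           (∑-cong 0 n (λ k _ _ → solve 3 (λ a u w → a :* (u :* w) := u :* (a :* w)) refl (ι (n ∸ k)) u (u ^ k))) (∑-*ˡ 0 n u _)))) ⟩
    (u - 1#) * ((1# + ι n) * 1# + u * weightedGeometric n u)
      ≈⟨ solve 3 (λ u i g → (u :- 𝟙) :* ((𝟙 :+ i) :* 𝟙 :+ u :* g) := (u :- 𝟙) :* (𝟙 :+ i) :+ u :* ((u :- 𝟙) :* g)) refl _ _ _ ⟩
    (u - 1#) * (1# + ι n) + u * ((u - 1#) * weightedGeometric n u)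
      ≈⟨ +-congˡ (*-congˡ (weightedGeometric-quotient n u)) ⟩
    (u - 1#) * (1# + ι n) + u * (u * ∑ 0 n (u ^_) - ι n)
      ≈⟨ solve 3 (λ u i g → (u :- 𝟙) :* (𝟙 :+ i) :+ u :* (u :* g :- i) := u :* (𝟙 :+ u :* g) :- (𝟙 :+ i)) refl _ _ _ ⟩
    u * (1# + u * ∑ 0 n (u ^_)) - (1# + ι n)
      ≈⟨ +-cong (*-congˡ (sym (geometric-suc n u))) (-‿cong (sym (ι-+ 1 n))) ⟩
    u * ∑ 0 (suc n) (u ^_) - ι (suc n) ∎

  P-sum : ∀ N k u → P N (suc k) u ≈ ∑ 0 N (λ e → ι ((e ℕ.+ suc k ∸ 1) C e) * u ^ e)
  P-sum zero    k u = refl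
  P-sum (suc N) k u = trans
    (+-cong (P-sum N k u) (*-congʳ (ι-cong (≡.trans (multichoose≡C N k)
      (≡.cong (λ n → (n ∸ 1) C N) (≡.sym (ℕ.+-suc N k)))))))
    (sym (∑-snoc 0 N _))

  -- The offset j stands for i = j+k+1, so the identically vanishing terms of `Q` are discarded
  -- once, in the base case.
  Q-sum-offset : ∀ j k u → Q (j ℕ.+ suc k) (suc k) u
    ≈ ∑ 0 (suc j) (λ e → ι ((e ℕ.+ suc k) C e) * u ^ (suc m ∸ suc k ∸ e))
  Q-sum-offset zero k u = trans
    (+-congʳ (Q-vanish k k u ℕ.≤-refl))
    (trans (+-comm _ _) (+-congʳ (*-congʳ (ι-cong (nCn≡1 (suc k))))))
  Q-sum-offset (suc j) k u = begin
    Q (j ℕ.+ suc k) (suc k) u + ι (suc (j ℕ.+ suc k) C suc k) * u ^ (m ∸ (j ℕ.+ suc k))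
      ≈⟨ +-cong (Q-sum-offset j k u) (*-cong (ι-cong binom) (reflexive (≡.cong (u ^_) expo))) ⟩
    ∑ 0 (suc j) g + g (suc j)  ≈⟨ sym (∑-snoc 0 (suc j) g) ⟩
    ∑ 0 (suc (suc j)) g ∎
    where
    g = λ e → ι ((e ℕ.+ suc k) C e) * u ^ (suc m ∸ suc k ∸ e)
    binom : suc (j ℕ.+ suc k) C suc k ≡ (suc j ℕ.+ suc k) C suc j
    binom = ≡.trans (nCk≡nC[n∸k] (ℕ.m≤n+m (suc k) (suc j)))
      (≡.cong ((suc j ℕ.+ suc k) C_) (ℕ.m+n∸n≡m (suc j) (suc k)))
    expo : m ∸ (j ℕ.+ suc k) ≡ suc m ∸ suc k ∸ suc j
    expo = ≡.trans (≡.cong (m ∸_) (≡.trans (ℕ.+-suc j k) (≡.trans (ℕ.+-comm (suc j) k) ≡.refl)))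
      (≡.sym (ℕ.∸-+-assoc m k (suc j)))

  Q-sum : ∀ i k u → suc k ≤ i → Q i (suc k) u
    ≈ ∑ 0 (suc (i ∸ suc k)) (λ e → ι ((e ℕ.+ suc k) C e) * u ^ (suc m ∸ suc k ∸ e))
  Q-sum i k u k<i = ≡.subst
    (λ j → Q j (suc k) u ≈ ∑ 0 (suc (i ∸ suc k)) (λ e → ι ((e ℕ.+ suc k) C e) * u ^ (suc m ∸ suc k ∸ e)))
    (ℕ.m∸n+n≡m k<i) (Q-sum-offset (i ∸ suc k) k u)

  Q-top : ∀ u → Q (suc m) 1 u ≈ weightedGeometric (suc m) u
  Q-top u = begin
    Q (suc m) 1 u   ≈⟨ Q-sum (suc m) 0 u (s≤s z≤n) ⟩
    ∑ 0 (suc m) (λ e → ι ((e ℕ.+ 1) C e) * u ^ (m ∸ e))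
      ≈⟨ ∑-cong 0 (suc m) (λ { e _ (s≤s e≤m) → *-congʳ (ι-cong (eq e e≤m)) }) ⟩
    ∑ 0 (suc m) (λ e → ι (suc m ∸ (m ∸ e)) * u ^ (m ∸ e))
      ≈⟨ sym (∑-reverse m (λ e → ι (suc m ∸ e) * u ^ e)) ⟩
    weightedGeometric (suc m) u ∎
    where
    eq : ∀ e → e ≤ m → (e ℕ.+ 1) C e ≡ suc m ∸ (m ∸ e)
    eq e e≤m = ≡.trans (≡.sym (≡.trans (multichoose-sym 1 e) (multichoose≡C e 1)))
      (≡.trans (multichoose≡C 1 e) (≡.trans (nC1≡n (suc e)) (≡.sym
        (≡.trans (ℕ.+-∸-assoc 1 (ℕ.m∸n≤m m e)) (≡.cong suc (ℕ.m∸[m∸n]≡n e≤m))))))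

  F-stable : ∀ i j z u → F i (j ℕ.+ suc i) z u ≈ F i (suc i) z u
  F-stable i zero    z u = refl
  F-stable i (suc j) z u = trans
    (+-congˡ (trans (*-congˡ (A-vanish i (j ℕ.+ suc i) u (ℕ.m≤n+m (suc i) j))) (zeroʳ _)))
    (trans (+-identityʳ _) (F-stable i j z u))

  h-truncate : ∀ i z u → i ≤ suc m → h i z u ≈ F i (suc i) z u
  h-truncate i z u i≤1+m = trans
    (reflexive (≡.cong (λ K → F i K z u) (≡.sym (ℕ.m∸n+n≡m (s≤s i≤1+m)))))
    (F-stable i (suc m ∸ i) z u)

  F-sum : ∀ i K z u → F i K z u ≈ 1# + ∑ 1 K (λ k → (- z) ^ k * A i (k ∸ 1) u)
  F-sum i zero    z u = sym (+-identityʳ _)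
  F-sum i (suc K) z u = trans (+-congʳ (F-sum i K z u))
    (trans (+-assoc _ _ _) (+-congˡ (sym (∑-snoc 1 K (λ k → (- z) ^ k * A i (k ∸ 1) u)))))

  h-explicit : ∀ i z u → i ≤ m → h i z u ≈
    1# + ∑ 1 (suc i) (λ k → (ι (suc i C k) * (- z) ^ k) *
           ∑ 0 (suc (m ∸ i)) (λ e → ι ((e ℕ.+ k ∸ 1) C e) * u ^ e))
       + ∑ 1 i (λ k → (ι ((m ℕ.+ k ∸ i ∸ 1) C (k ∸ 1)) * (- z) ^ k) *
           ∑ 0 (suc (i ∸ k)) (λ e → ι ((e ℕ.+ k) C e) * u ^ (suc m ∸ k ∸ e)))
  h-explicit i z u i≤m = begin
    h i z u            ≈⟨ h-truncate i z u (ℕ.m≤n⇒m≤1+n i≤m) ⟩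
    F i (suc i) z u    ≈⟨ F-sum i (suc i) z u ⟩
    1# + ∑ 1 (suc i) (λ k → (- z) ^ k * A i (k ∸ 1) u)
      ≈⟨ +-congˡ (trans (∑-cong 1 (suc i) split) (∑-+ 1 (suc i) f g)) ⟩
    1# + (∑ 1 (suc i) f + ∑ 1 (suc i) g)   ≈⟨ sym (+-assoc _ _ _) ⟩
    1# + ∑ 1 (suc i) f + ∑ 1 (suc i) g     ≈⟨ +-congˡ (trans (∑-snoc 1 i g) (trans (+-congˡ last) (+-identityʳ _))) ⟩
    1# + ∑ 1 (suc i) f + ∑ 1 i g           ≈⟨ +-congˡ (∑-cong 1 i second) ⟩
    1# + ∑ 1 (suc i) f + ∑ 1 i g′          ∎
    where
    f g g′ : ℕ → Carrier
    f k = (ι (suc i C k) * (- z) ^ k) * ∑ 0 (suc (m ∸ i)) (λ e → ι ((e ℕ.+ k ∸ 1) C e) * u ^ e)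
    g k = (ι (multichoose (k ∸ 1) (suc (m ∸ i))) * (- z) ^ k) * Q i k u
    g′ k = (ι ((m ℕ.+ k ∸ i ∸ 1) C (k ∸ 1)) * (- z) ^ k) *
           ∑ 0 (suc (i ∸ k)) (λ e → ι ((e ℕ.+ k) C e) * u ^ (suc m ∸ k ∸ e))
    split : ∀ k → 1 ≤ k → k < 1 ℕ.+ suc i → (- z) ^ k * A i (k ∸ 1) u ≈ f k + g k
    split (suc k) _ _ = trans (*-congˡ (A-unfold i k u i≤m))
      (trans (solve 5 (λ w a p b q → w :* (a :* p :+ b :* q) := (a :* w) :* p :+ (b :* w) :* q) refl _ _ _ _ _)
             (+-congʳ (*-congˡ (P-sum (suc (m ∸ i)) k u))))
    -- The second sum of H_i stops at k = i, one term before the first; the extra term contains only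
    -- vanishing binomials.
    last : g (suc i) ≈ 0#
    last = trans (*-congˡ (Q-vanish i i u ℕ.≤-refl)) (zeroʳ _)
    second : ∀ k → 1 ≤ k → k < 1 ℕ.+ i → g k ≈ g′ k
    second (suc k) _ (s≤s k<i) = *-cong (*-congʳ (ι-cong (≡.trans (multichoose≡C k (m ∸ i)) (≡.cong (_C k) eq)))) (Q-sum i k u k<i)
      where
      eq : k ℕ.+ (m ∸ i) ≡ m ℕ.+ suc k ∸ i ∸ 1
      eq = ≡.sym (≡.trans (≡.cong (_∸ 1) (≡.trans (≡.cong (_∸ i) (ℕ.+-comm m (suc k))) (ℕ.+-∸-assoc (suc k) i≤m))) ≡.refl)

  h-zero : ∀ z u → h 0 z u ≈ 1# - z * ∑ 0 (suc m) (u ^_)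
  h-zero z u = begin
    h 0 z u  ≈⟨ h-truncate 0 z u z≤n ⟩
    1# + (- z * 1#) * (1# * P (suc m) 1 u + 1# * 0#)
      ≈⟨ solve 2 (λ z p → 𝟙 :+ (:- z :* 𝟙) :* (𝟙 :* p :+ 𝟙 :* 𝟘) := 𝟙 :- z :* p) refl z (P (suc m) 1 u) ⟩
    1# - z * P (suc m) 1 u ≈⟨ +-congˡ (-‿cong (*-congˡ (P-geometric (suc m)))) ⟩
    1# - z * ∑ 0 (suc m) (u ^_) ∎
    where
    P-geometric : ∀ N → P N 1 u ≈ ∑ 0 N (u ^_)
    P-geometric zero    = refl
    P-geometric (suc N) = trans
      (+-cong (P-geometric N) (trans (*-congʳ (ι-cong (multichoose-1 N))) (*-identityˡ _)))
      (sym (∑-snoc 0 N (u ^_)))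

  -- At i = m+1 the sum `P` is empty and multichoose(k, 0) keeps only k = 0, so the general formula
  -- degenerates to the separate one for H_{m+1}.
  h-top-Q : ∀ z u → h (suc m) z u ≈ 1# - z * Q (suc m) 1 u
  h-top-Q z u = stable (suc m)
    where
    A-top : ∀ k → A (suc m) k u ≈ ι (multichoose k 0) * Q (suc m) (suc k) u
    A-top k rewrite ℕ.n∸n≡0 m = trans (+-congʳ (zeroʳ _)) (+-identityˡ _)
    stable : ∀ K → F (suc m) (suc K) z u ≈ 1# - z * Q (suc m) 1 u
    stable zero    = trans (+-congˡ (*-congˡ (A-top 0)))
      (solve 2 (λ z q → 𝟙 :+ (:- z :* 𝟙) :* (𝟙 :* q) := 𝟙 :- z :* q) refl z (Q (suc m) 1 u))
    stable (suc K) = trans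
      (+-cong (stable K) (trans (*-congˡ (trans (A-top (suc K)) (zeroˡ _))) (zeroʳ _)))
      (+-identityʳ _)

  h-top : ∀ z u → h (suc m) z u ≈ 1# - z * weightedGeometric (suc m) u
  h-top z u = trans (h-top-Q z u) (+-congˡ (-‿cong (*-congˡ (Q-top u))))

  -- The binomial is the sum 1 + 2 + ... + (m+1), evaluated by `Q-at-1`.
  h-top-at-1 : ∀ z → h (suc m) z 1# ≈ 1# - ι (suc (suc m) C 2) * z
  h-top-at-1 z = trans (h-top-Q z 1#) (+-congˡ (-‿cong (trans (*-congˡ (Q-at-1 (suc m) 0)) (*-comm _ _))))

  -- The bridge between h_{m+1} and h_0: at z = Z, u = U the equation defining U turns the right
  -- side into c(x-1). Both the second form of I and the passage from x = 1 to U = 1 rest on this.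
  h-top-quotient : ∀ z u →
    (u - 1#) * h (suc m) z u ≈ u * h 0 z u - (1# - ι (suc m) * z)
  h-top-quotient z u = begin
    (u - 1#) * h (suc m) z u            ≈⟨ *-congˡ (h-top z u) ⟩
    (u - 1#) * (1# - z * W)             ≈⟨ solve 3 (λ u z w → (u :- 𝟙) :* (𝟙 :- z :* w) := (u :- 𝟙) :- z :* ((u :- 𝟙) :* w)) refl _ _ _ ⟩
    (u - 1#) - z * ((u - 1#) * W)       ≈⟨ +-congˡ (-‿cong (*-congˡ (weightedGeometric-quotient (suc m) u))) ⟩
    (u - 1#) - z * (u * G - ι (suc m))  ≈⟨ solve 4 (λ u z g i → (u :- 𝟙) :- z :* (u :* g :- i) := u :* (𝟙 :- z :* g) :- (𝟙 :- i :* z)) refl u z G (ι (suc m)) ⟩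
    u * (1# - z * G) - (1# - ι (suc m) * z)  ≈⟨ +-congʳ (*-congˡ (sym (h-zero z u))) ⟩
    u * h 0 z u - (1# - ι (suc m) * z)  ∎
    where
    W = weightedGeometric (suc m) u
    G = ∑ 0 (suc m) (u ^_)

  h-zero-quotient : ∀ z u → (u - 1#) * h 0 z u ≈ (u - 1#) - z * (u ^ suc m - 1#)
  h-zero-quotient z u = begin
    (u - 1#) * h 0 z u           ≈⟨ *-congˡ (h-zero z u) ⟩
    (u - 1#) * (1# - z * G)      ≈⟨ solve 3 (λ u z w → (u :- 𝟙) :* (𝟙 :- z :* w) := (u :- 𝟙) :- z :* ((u :- 𝟙) :* w)) refl _ _ _ ⟩
    (u - 1#) - z * ((u - 1#) * G) ≈⟨ +-congˡ (-‿cong (*-congˡ (geometric (suc m) u))) ⟩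
    (u - 1#) - z * (u ^ suc m - 1#) ∎
    where G = ∑ 0 (suc m) (u ^_)

  -- Read off from `h-top-quotient` at u = 1, where the left side vanishes.
  h-zero-at-1 : ∀ z → h 0 z 1# ≈ 1# - ι (suc m) * z
  h-zero-at-1 z = begin
    h 0 z 1#
      ≈⟨ solve 2 (λ a c → a := (𝟙 :* a :- c) :+ c) refl (h 0 z 1#) (1# - ι (suc m) * z) ⟩
    (1# * h 0 z 1# - (1# - ι (suc m) * z)) + (1# - ι (suc m) * z)
      ≈⟨ +-congʳ (sym (h-top-quotient z 1#)) ⟩
    (1# - 1#) * h (suc m) z 1# + (1# - ι (suc m) * z)
      ≈⟨ solve 2 (λ a c → (𝟙 :- 𝟙) :* a :+ c := c) refl (h (suc m) z 1#) (1# - ι (suc m) * z) ⟩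
    1# - ι (suc m) * z ∎

  -- Any relation compatible with the ring operations is inherited by h. It is applied to
  -- specialisation at x = 1, and to polynomiality of rows seen as a relation.
  module Congruence {ℓ′} (_~_ : Rel Carrier ℓ′)
    (0~0 : 0# ~ 0#) (1~1 : 1# ~ 1#)
    (+~ : ∀ {a b a′ b′} → a ~ b → a′ ~ b′ → (a + a′) ~ (b + b′))
    (*~ : ∀ {a b a′ b′} → a ~ b → a′ ~ b′ → (a * a′) ~ (b * b′))
    (-~ : ∀ {a b} → a ~ b → (- a) ~ (- b)) where

    ι~ : ∀ n → ι n ~ ι n
    ι~ zero          = 0~0
    ι~ (suc zero)    = 1~1
    ι~ (suc (suc n)) = +~ (ι~ (suc n)) 1~1

    ^~ : ∀ {a b} n → a ~ b → (a ^ n) ~ (b ^ n)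
    ^~ zero    r = 1~1
    ^~ (suc n) r = *~ r (^~ n r)

    P~ : ∀ N k {u v} → u ~ v → P N k u ~ P N k v
    P~ zero    k r = 0~0
    P~ (suc N) k r = +~ (P~ N k r) (*~ (ι~ (multichoose N k)) (^~ N r))

    Q~ : ∀ i k {u v} → u ~ v → Q i k u ~ Q i k v
    Q~ zero    k r = 0~0
    Q~ (suc i) k r = +~ (Q~ i k r) (*~ (ι~ (suc i C k)) (^~ (m ∸ i) r))

    F~ : ∀ i n {y z u v} → y ~ z → u ~ v → F i n y u ~ F i n z v
    F~ i zero    s r = 1~1
    F~ i (suc n) s r = +~ (F~ i n s r) (*~ (^~ (suc n) (-~ s))
      (+~ (*~ (ι~ (suc i C suc n)) (P~ (suc m ∸ i) (suc n) r))
          (*~ (ι~ (multichoose n (suc m ∸ i))) (Q~ i (suc n) r))))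

    h~ : ∀ i {y z u v} → y ~ z → u ~ v → h i y u ~ h i z v
    h~ i = F~ i (suc (suc m))

-- The claimed series satisfy the functional equations

module Candidate {r ℓ} (R : CommutativeRing r ℓ) (m : ℕ) where
  open CommutativeRing R
  open SemiringExp semiring using (_^_; ^-congˡ; ^-homo-*)
  open Polynomials R m
  open CommutativeSemiringExp commutativeSemiring using (^-distrib-*)
  open IntegerSolver R using (solve; _:=_; _:+_; _:*_; _:-_; :-_; 𝟙)
  open import Relation.Binary.Reasoning.Setoid setoid

  -- `T` and `d` are the inverses of S = `h 0 Z U` and of c; with names for them the verification is
  -- a set of division-free identities.
  module Closed (Z U x t T d : Carrier)
    (t≈ : t ≈ Z * (1# - ι (suc m) * Z) ^ m)
    (xc≈ : x * (1# - ι (suc m) * Z) ≈ U * h 0 Z U)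
    (hT≈1 : h 0 Z U * T ≈ 1#)
    (cd≈1 : (1# - ι (suc m) * Z) * d ≈ 1#) where

    c : Carrier
    c = 1# - ι (suc m) * Z

    J K : ℕ → Carrier
    J i = t * x ^ m * T ^ suc i * h i Z U
    K i = t * d ^ suc i * h i Z 1#

    U≈ : U ≈ x * c * T
    U≈ = begin
      U                   ≈⟨ sym (*-identityʳ U) ⟩
      U * 1#              ≈⟨ *-congˡ (sym hT≈1) ⟩
      U * (h 0 Z U * T)   ≈⟨ sym (*-assoc _ _ _) ⟩
      U * h 0 Z U * T     ≈⟨ *-congʳ (sym xc≈) ⟩
      x * c * T           ∎

    -- This is x c = U S divided by c S: it exchanges powers of x/S for powers of U/c.
    xT≈ : x * T ≈ U * d
    xT≈ = begin
      x * T               ≈⟨ sym (*-identityʳ _) ⟩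
      x * T * 1#          ≈⟨ *-congˡ (sym cd≈1) ⟩
      x * T * (c * d)     ≈⟨ solve 4 (λ x t c d → x :* t :* (c :* d) := x :* c :* t :* d) refl x T c d ⟩
      x * c * T * d       ≈⟨ *-congʳ (sym U≈) ⟩
      U * d               ∎

    xT^ : ∀ n → x ^ n * T ^ n ≈ U ^ n * d ^ n
    xT^ n = begin
      x ^ n * T ^ n  ≈⟨ sym (^-distrib-* x T n) ⟩
      (x * T) ^ n    ≈⟨ ^-congˡ n xT≈ ⟩
      (U * d) ^ n    ≈⟨ ^-distrib-* U d n ⟩
      U ^ n * d ^ n  ∎

    cd^ : ∀ n → c ^ n * d ^ n ≈ 1#
    cd^ n = trans (sym (^-distrib-* c d n)) (trans (^-congˡ n cd≈1) (1^n≈1 n))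

    td^m : t * d ^ m ≈ Z
    td^m = trans (*-congʳ t≈) (trans (*-assoc _ _ _) (trans (*-congˡ (cd^ m)) (*-identityʳ Z)))

    U-1-quotient : (U - 1#) * h (suc m) Z U ≈ c * (x - 1#)
    U-1-quotient = begin
      (U - 1#) * h (suc m) Z U ≈⟨ h-top-quotient Z U ⟩
      U * h 0 Z U - c          ≈⟨ +-congʳ (sym xc≈) ⟩
      x * c - c                ≈⟨ solve 2 (λ x c → x :* c :- c := c :* (x :- 𝟙)) refl x c ⟩
      c * (x - 1#)             ∎

    x-1≈ : x - 1# ≈ (U - 1#) * h (suc m) Z U * d
    x-1≈ = begin
      x - 1#                         ≈⟨ sym (*-identityʳ _) ⟩
      (x - 1#) * 1#                  ≈⟨ *-congˡ (sym cd≈1) ⟩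
      (x - 1#) * (c * d)             ≈⟨ solve 3 (λ y c d → y :* (c :* d) := c :* y :* d) refl (x - 1#) c d ⟩
      c * (x - 1#) * d               ≈⟨ *-congʳ (sym U-1-quotient) ⟩
      (U - 1#) * h (suc m) Z U * d   ∎

    J-zero : J 0 ≈ t * x ^ m
    J-zero = begin
      t * x ^ m * (T * 1#) * h 0 Z U ≈⟨ solve 3 (λ a t h → a :* (t :* 𝟙) :* h := a :* (h :* t)) refl (t * x ^ m) T (h 0 Z U) ⟩
      t * x ^ m * (h 0 Z U * T)      ≈⟨ *-congˡ hT≈1 ⟩
      t * x ^ m * 1#                 ≈⟨ *-identityʳ _ ⟩
      t * x ^ m                      ∎

    -- Both sides equal `mid`. The factor h_{m+1} enters on the left through x-1 = (U-1) h_{m+1} / c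
    -- and on the right through J_{m+1}.
    J-step : ∀ i → i ≤ m →
      (x - 1#) * (J (suc i) - J i) ≈ J (suc m) * (x * J i - x ^ (m ∸ i) * K i)
    J-step i i≤m = trans left (sym right)
      where
      n = m ∸ i
      h₀ = h 0 Z U
      R′ = h (suc m) Z U
      hᵢ = h i Z U
      h′ = h (suc i) Z U
      h₁ = h i Z 1#
      W = U ^ n * (U ^ suc i * hᵢ - h₁)
      X = x ^ m
      mid = R′ * d * (t * X) * (T ^ suc (suc i)) * (Z * W)
      U^ : U ^ suc m ≈ U ^ n * U ^ suc i
      U^ = trans (reflexive (≡.cong (U ^_) (≡.trans (≡.cong suc (≡.sym (ℕ.m∸n+n≡m i≤m))) (≡.sym (ℕ.+-suc n i)))))
                 (^-homo-* U n (suc i))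
      -- The recurrence of h minus (U-1) S h_i: the terms (U-1) h_i and Z h_i cancel, and U^(m+1) is
      -- split as U^(m-i) U^(i+1).
      core : (U - 1#) * h′ - (U - 1#) * h₀ * hᵢ ≈ Z * W
      core = begin
        (U - 1#) * h′ - (U - 1#) * h₀ * hᵢ
          ≈⟨ +-cong (h-step i Z U i≤m) (-‿cong (*-congʳ (h-zero-quotient Z U))) ⟩
        (U - 1#) * hᵢ - Z * (U ^ n * h₁ - hᵢ) - ((U - 1#) - Z * (U ^ suc m - 1#)) * hᵢ
          ≈⟨ +-congˡ (-‿cong (*-congʳ (+-congˡ (-‿cong (*-congˡ (+-congʳ U^)))))) ⟩
        (U - 1#) * hᵢ - Z * (U ^ n * h₁ - hᵢ) - ((U - 1#) - Z * (U ^ n * U ^ suc i - 1#)) * hᵢ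
          ≈⟨ solve 6 (λ u z w h₁ hᵢ v →
               u :* hᵢ :- z :* (w :* h₁ :- hᵢ) :- (u :- z :* (w :* v :- 𝟙)) :* hᵢ
               := z :* (w :* (v :* hᵢ :- h₁))) refl (U - 1#) Z (U ^ n) h₁ hᵢ (U ^ suc i) ⟩
        Z * W ∎
      left : (x - 1#) * (J (suc i) - J i) ≈ mid
      left = begin
        (x - 1#) * (t * X * T ^ suc (suc i) * h′ - t * X * T ^ suc i * hᵢ)
          -- The factor S T = 1 is inserted to give both terms the power T^(i+2).
          ≈⟨ *-congˡ (+-congˡ (-‿cong (trans (sym (*-identityʳ _)) (*-congˡ (sym hT≈1))))) ⟩
        (x - 1#) * (t * X * (T * T ^ suc i) * h′ - t * X * T ^ suc i * hᵢ * (h₀ * T))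
          ≈⟨ *-congʳ x-1≈ ⟩
        (U - 1#) * R′ * d * (t * X * (T * T ^ suc i) * h′ - t * X * T ^ suc i * hᵢ * (h₀ * T))
          ≈⟨ solve 9 (λ u r d a τ q h′ hᵢ h₀ →
               u :* r :* d :* (a :* (τ :* q) :* h′ :- a :* q :* hᵢ :* (h₀ :* τ))
               := r :* d :* a :* (τ :* q) :* (u :* h′ :- u :* h₀ :* hᵢ))
               refl (U - 1#) R′ d (t * X) T (T ^ suc i) h′ hᵢ h₀ ⟩
        R′ * d * (t * X) * T ^ suc (suc i) * ((U - 1#) * h′ - (U - 1#) * h₀ * hᵢ)
          ≈⟨ *-congˡ core ⟩
        mid ∎
      x^ : x * X ≈ x ^ n * x ^ suc i
      x^ = trans (reflexive (≡.cong (x ^_) (≡.trans (≡.cong suc (≡.sym (ℕ.m∸n+n≡m i≤m))) (≡.sym (ℕ.+-suc n i)))))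
                 (^-homo-* x n (suc i))
      T^ : T ^ suc (suc m) ≈ T ^ n * T ^ suc (suc i)
      T^ = trans (reflexive (≡.cong (T ^_) (≡.trans (≡.cong (λ k → suc (suc k)) (≡.sym (ℕ.m∸n+n≡m i≤m)))
                   (≡.trans (≡.cong suc (≡.sym (ℕ.+-suc n i))) (≡.sym (ℕ.+-suc n (suc i)))))))
                 (^-homo-* T n (suc (suc i)))
      bracket : x * J i - x ^ n * K i ≈ x ^ n * (t * d ^ suc i) * (U ^ suc i * hᵢ - h₁)
      bracket = begin
        x * (t * X * T ^ suc i * hᵢ) - x ^ n * (t * d ^ suc i * h₁)
          ≈⟨ +-congʳ (solve 5 (λ x t X q h → x :* (t :* X :* q :* h) := (x :* X) :* q :* t :* h) refl x t X (T ^ suc i) hᵢ) ⟩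
        (x * X) * T ^ suc i * t * hᵢ - x ^ n * (t * d ^ suc i * h₁)
          ≈⟨ +-congʳ (*-congʳ (*-congʳ (trans (*-congʳ x^) (trans (*-assoc _ _ _) (*-congˡ (xT^ (suc i))))))) ⟩
        x ^ n * (U ^ suc i * d ^ suc i) * t * hᵢ - x ^ n * (t * d ^ suc i * h₁)
          ≈⟨ solve 6 (λ a u d t h h₁ → a :* (u :* d) :* t :* h :- a :* (t :* d :* h₁)
               := a :* (t :* d) :* (u :* h :- h₁)) refl (x ^ n) (U ^ suc i) (d ^ suc i) t hᵢ h₁ ⟩
        x ^ n * (t * d ^ suc i) * (U ^ suc i * hᵢ - h₁) ∎
      td : d ^ n * (t * d ^ suc i) ≈ d * Z
      td = begin
        d ^ n * (t * d ^ suc i)     ≈⟨ solve 4 (λ a t d b → a :* (t :* (d :* b)) := d :* (t :* (a :* b))) refl (d ^ n) t d (d ^ i) ⟩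
        d * (t * (d ^ n * d ^ i))   ≈⟨ *-congˡ (*-congˡ (trans (sym (^-homo-* d n i)) (reflexive (≡.cong (d ^_) (ℕ.m∸n+n≡m i≤m))))) ⟩
        d * (t * d ^ m)             ≈⟨ *-congˡ td^m ⟩
        d * Z                       ∎
      right : J (suc m) * (x * J i - x ^ n * K i) ≈ mid
      right = begin
        t * X * T ^ suc (suc m) * R′ * (x * J i - x ^ n * K i)
          ≈⟨ *-cong (*-congʳ (*-congˡ T^)) bracket ⟩
        t * X * (T ^ n * T ^ suc (suc i)) * R′ * (x ^ n * (t * d ^ suc i) * V)
          ≈⟨ solve 7 (λ a b q r y e v → a :* (b :* q) :* r :* (y :* e :* v)
               := a :* q :* r :* ((y :* b) :* e) :* v) refl (t * X) (T ^ n) (T ^ suc (suc i)) R′ (x ^ n) (t * d ^ suc i) V ⟩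
        t * X * T ^ suc (suc i) * R′ * ((x ^ n * T ^ n) * (t * d ^ suc i)) * V
          ≈⟨ *-congʳ (*-congˡ (trans (*-congʳ (xT^ n)) (trans (*-assoc _ _ _) (*-congˡ td)))) ⟩
        t * X * T ^ suc (suc i) * R′ * (U ^ n * (d * Z)) * V
          ≈⟨ solve 7 (λ a q r w d z v → a :* q :* r :* (w :* (d :* z)) :* v
               := r :* d :* a :* q :* (z :* (w :* v))) refl (t * X) (T ^ suc (suc i)) R′ (U ^ n) d Z V ⟩
        mid ∎
        where V = U ^ suc i * hᵢ - h₁

    -- The exponent m-i-1 can be negative; any `p` and `q` with q - p = m-i-1 clear the
    -- denominators.
    J-closed : ∀ p q i → p ℕ.+ m ≡ q ℕ.+ suc i →
      x ^ p * c ^ p * J i ≈ x ^ q * Z * c ^ q * (U ^ suc i * h i Z U)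
    J-closed p q i eq = begin
      x ^ p * c ^ p * (t * x ^ m * T ^ suc i * hᵢ)
        ≈⟨ *-congˡ (*-congʳ (*-congʳ (*-congʳ t≈))) ⟩
      x ^ p * c ^ p * (Z * c ^ m * x ^ m * T ^ suc i * hᵢ)
        ≈⟨ solve 7 (λ a b z c x τ h → a :* b :* (z :* c :* x :* τ :* h) := z :* τ :* h :* ((a :* x) :* (b :* c)))
             refl (x ^ p) (c ^ p) Z (c ^ m) (x ^ m) (T ^ suc i) hᵢ ⟩
      Z * T ^ suc i * hᵢ * ((x ^ p * x ^ m) * (c ^ p * c ^ m))
        ≈⟨ *-congˡ (*-cong (redistribute x) (redistribute c)) ⟩
      Z * T ^ suc i * hᵢ * ((x ^ q * x ^ suc i) * (c ^ q * c ^ suc i))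
        ≈⟨ solve 7 (λ z τ h a b e f → z :* τ :* h :* ((a :* b) :* (e :* f)) := a :* z :* e :* (b :* f :* τ :* h))
             refl Z (T ^ suc i) hᵢ (x ^ q) (x ^ suc i) (c ^ q) (c ^ suc i) ⟩
      x ^ q * Z * c ^ q * (x ^ suc i * c ^ suc i * T ^ suc i * hᵢ)
        ≈⟨ *-congˡ (*-congʳ (sym (trans (^-congˡ (suc i) U≈) (trans (^-distrib-* (x * c) T (suc i)) (*-congʳ (^-distrib-* x c (suc i))))))) ⟩
      x ^ q * Z * c ^ q * (U ^ suc i * hᵢ) ∎
      where
      hᵢ = h i Z U
      redistribute : ∀ y → y ^ p * y ^ m ≈ y ^ q * y ^ suc i
      redistribute y = trans (sym (^-homo-* y p m)) (trans (reflexive (≡.cong (y ^_) eq)) (^-homo-* y q (suc i)))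

    J-top : x ^ 2 * c ^ 2 * J (suc m) ≈ Z * (U ^ suc (suc m) * h (suc m) Z U)
    J-top = trans (J-closed 2 0 (suc m) ≡.refl)
      (*-congʳ (trans (*-identityʳ _) (*-identityˡ Z)))

    J-top-quotient : x ^ 2 * J (suc m) * c * (U - 1#) ≈ Z * U ^ suc (suc m) * (x - 1#)
    J-top-quotient = begin
      x ^ 2 * J (suc m) * c * (U - 1#)
        ≈⟨ trans (sym (*-identityʳ _)) (*-congˡ (sym cd≈1)) ⟩
      x ^ 2 * J (suc m) * c * (U - 1#) * (c * d)
        ≈⟨ solve 5 (λ a j c u d → a :* j :* c :* u :* (c :* d) := a :* (c :* (c :* 𝟙)) :* j :* (u :* d)) refl (x ^ 2) (J (suc m)) c (U - 1#) d ⟩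
      x ^ 2 * c ^ 2 * J (suc m) * ((U - 1#) * d)
        ≈⟨ *-congʳ J-top ⟩
      Z * (U ^ suc (suc m) * h (suc m) Z U) * ((U - 1#) * d)
        ≈⟨ solve 5 (λ z w r u d → z :* (w :* r) :* (u :* d) := z :* w :* (u :* r :* d)) refl Z (U ^ suc (suc m)) (h (suc m) Z U) (U - 1#) d ⟩
      Z * U ^ suc (suc m) * ((U - 1#) * h (suc m) Z U * d)
        ≈⟨ *-congˡ (sym x-1≈) ⟩
      Z * U ^ suc (suc m) * (x - 1#) ∎

    K-top : K (suc m) * c ^ 2 ≈ Z * (1# - ι (suc (suc m) C 2) * Z)
    K-top = begin
      t * (d * (d * d ^ m)) * h (suc m) Z 1# * (c * (c * 1#))
        ≈⟨ solve 5 (λ t d e h c → t :* (d :* (d :* e)) :* h :* (c :* (c :* 𝟙)) := (c :* d) :* (c :* d) :* (t :* e) :* h)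
             refl t d (d ^ m) (h (suc m) Z 1#) c ⟩
      (c * d) * (c * d) * (t * d ^ m) * h (suc m) Z 1#
        ≈⟨ *-cong (*-cong (*-cong cd≈1 cd≈1) td^m) (h-top-at-1 Z) ⟩
      1# * 1# * Z * (1# - ι (suc (suc m) C 2) * Z)
        ≈⟨ *-congʳ (trans (*-congʳ (*-identityˡ 1#)) (*-identityˡ Z)) ⟩
      Z * (1# - ι (suc (suc m) C 2) * Z) ∎

-- Formal power series over a commutative ring

module PowerSeries {r ℓ} (R : CommutativeRing r ℓ) where
  open CommutativeRing R
  open Summation R
  open IntegerSolver R using (solve; _:=_; _:+_; _:*_; 𝟘)
  open import Relation.Binary.Reasoning.Setoid setoid

  PS : Set r
  PS = ℕ → Carrier

  infix 4 _≈ₚ_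
  infixl 7 _⊛_

  _≈ₚ_ : PS → PS → Set ℓ
  f ≈ₚ g = ∀ n → f n ≈ g n

  _⊕_ _⊛_ : PS → PS → PS
  (f ⊕ g) n = f n + g n
  (f ⊛ g) n = ∑ 0 (suc n) (λ a → f a * g (n ∸ a))

  tail : PS → PS
  tail f n = f (suc n)

  1ₚ : PS
  1ₚ zero    = 1#
  1ₚ (suc n) = 0#

  ⊛-cong-≤ : ∀ {f f′ g g′} n → (∀ a → a ≤ n → f a ≈ f′ a) → (∀ a → a ≤ n → g a ≈ g′ a) →
             (f ⊛ g) n ≈ (f′ ⊛ g′) n
  ⊛-cong-≤ n e e′ = ∑-cong 0 (suc n) λ { a _ (s≤s a≤n) → *-cong (e a a≤n) (e′ (n ∸ a) (ℕ.m∸n≤m n a)) }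

  ⊛-cong : ∀ {f f′ g g′} → f ≈ₚ f′ → g ≈ₚ g′ → f ⊛ g ≈ₚ f′ ⊛ g′
  ⊛-cong e e′ n = ⊛-cong-≤ n (λ a _ → e a) (λ a _ → e′ a)

  -- The head-and-tail form of the Cauchy product; commutativity and associativity follow from it by
  -- induction, with no rearrangement of double sums.
  ⊛-suc : ∀ f g n → (f ⊛ g) (suc n) ≈ f 0 * g (suc n) + (tail f ⊛ g) n
  ⊛-suc f g n = +-congˡ (∑-shift 0 (suc n) _)

  ⊛-sucʳ : ∀ f g n → (f ⊛ g) (suc n) ≈ (f ⊛ tail g) n + f (suc n) * g 0
  ⊛-sucʳ f g n = trans (∑-snoc 0 (suc n) _) (+-cong
    (∑-cong 0 (suc n) λ { a _ (s≤s a≤n) → *-congˡ (reflexive (≡.cong g (ℕ.+-∸-assoc 1 a≤n))) })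
    (*-congˡ (reflexive (≡.cong g (ℕ.n∸n≡0 n)))))

  ⊛-comm : ∀ f g → f ⊛ g ≈ₚ g ⊛ f
  ⊛-comm f g zero    = +-congʳ (*-comm _ _)
  ⊛-comm f g (suc n) = begin
    (f ⊛ g) (suc n)                       ≈⟨ ⊛-suc f g n ⟩
    f 0 * g (suc n) + (tail f ⊛ g) n      ≈⟨ +-cong (*-comm _ _) (⊛-comm (tail f) g n) ⟩
    g (suc n) * f 0 + (g ⊛ tail f) n      ≈⟨ +-comm _ _ ⟩
    (g ⊛ tail f) n + g (suc n) * f 0      ≈⟨ sym (⊛-sucʳ g f n) ⟩
    (g ⊛ f) (suc n)                       ∎

  ⊛-distribˡ : ∀ f g h → f ⊛ (g ⊕ h) ≈ₚ (f ⊛ g) ⊕ (f ⊛ h)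
  ⊛-distribˡ f g h n = trans (∑-cong 0 (suc n) λ a _ _ → distribˡ _ _ _) (∑-+ 0 (suc n) _ _)

  ⊛-distribʳ : ∀ f g h → (g ⊕ h) ⊛ f ≈ₚ (g ⊛ f) ⊕ (h ⊛ f)
  ⊛-distribʳ f g h n = trans (∑-cong 0 (suc n) λ a _ _ → distribʳ _ _ _) (∑-+ 0 (suc n) _ _)

  ⊛-scale : ∀ a f g → (λ n → a * f n) ⊛ g ≈ₚ λ n → a * (f ⊛ g) n
  ⊛-scale a f g n = trans (∑-cong 0 (suc n) λ k _ _ → *-assoc _ _ _) (∑-*ˡ 0 (suc n) a _)

  ⊛-assoc : ∀ f g h → (f ⊛ g) ⊛ h ≈ₚ f ⊛ (g ⊛ h)
  ⊛-assoc f g h zero = solve 3 (λ a b c → (a :* b :+ 𝟘) :* c :+ 𝟘 := a :* (b :* c :+ 𝟘) :+ 𝟘) refl (f 0) (g 0) (h 0)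
  ⊛-assoc f g h (suc n) = begin
    ((f ⊛ g) ⊛ h) (suc n)
      ≈⟨ ⊛-suc (f ⊛ g) h n ⟩
    (f 0 * g 0 + 0#) * h (suc n) + (tail (f ⊛ g) ⊛ h) n
      ≈⟨ +-congˡ (trans (⊛-cong {g = h} {h} (⊛-suc f g) (λ _ → refl) n) (⊛-distribʳ h _ _ n)) ⟩
    (f 0 * g 0 + 0#) * h (suc n) + (((λ n → f 0 * tail g n) ⊛ h) n + ((tail f ⊛ g) ⊛ h) n)
      ≈⟨ +-congˡ (+-cong (⊛-scale (f 0) (tail g) h n) (⊛-assoc (tail f) g h n)) ⟩
    (f 0 * g 0 + 0#) * h (suc n) + (f 0 * (tail g ⊛ h) n + (tail f ⊛ (g ⊛ h)) n)
      ≈⟨ solve 5 (λ a b c p q → (a :* b :+ 𝟘) :* c :+ (a :* p :+ q) := a :* (b :* c :+ p) :+ q) refl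
           (f 0) (g 0) (h (suc n)) _ _ ⟩
    f 0 * (g 0 * h (suc n) + (tail g ⊛ h) n) + (tail f ⊛ (g ⊛ h)) n
      ≈⟨ +-congʳ (*-congˡ (sym (⊛-suc g h n))) ⟩
    f 0 * (g ⊛ h) (suc n) + (tail f ⊛ (g ⊛ h)) n
      ≈⟨ sym (⊛-suc f (g ⊛ h) n) ⟩
    (f ⊛ (g ⊛ h)) (suc n) ∎

  ⊛-zeroˡ : ∀ f g → (∀ n → f n ≈ 0#) → ∀ n → (f ⊛ g) n ≈ 0#
  ⊛-zeroˡ f g f≈0 n = trans (⊛-cong {g = g} {g} f≈0′ (λ _ → refl) n)
    (trans (⊛-scale 0# (λ _ → 0#) g n) (zeroˡ _))
    where
    f≈0′ : f ≈ₚ λ _ → 0# * 0#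
    f≈0′ k = trans (f≈0 k) (sym (zeroˡ _))

  ⊛-constˡ : ∀ f g → (∀ n → f (suc n) ≈ 0#) → ∀ n → (f ⊛ g) n ≈ f 0 * g n
  ⊛-constˡ f g f≈ zero    = +-identityʳ _
  ⊛-constˡ f g f≈ (suc n) = trans (⊛-suc f g n)
    (trans (+-congˡ (⊛-zeroˡ (tail f) g f≈ n)) (+-identityʳ _))

  ⊛-shiftˡ : ∀ f g → f 0 ≈ 0# → f 1 ≈ 1# → (∀ n → f (suc (suc n)) ≈ 0#) →
             ∀ n → (f ⊛ g) (suc n) ≈ g n
  ⊛-shiftˡ f g f0 f1 f≈ n = begin
    (f ⊛ g) (suc n)                      ≈⟨ ⊛-suc f g n ⟩
    f 0 * g (suc n) + (tail f ⊛ g) n     ≈⟨ +-cong (trans (*-congʳ f0) (zeroˡ _)) (⊛-constˡ (tail f) g f≈ n) ⟩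
    0# + f 1 * g n                       ≈⟨ trans (+-identityˡ _) (trans (*-congʳ f1) (*-identityˡ _)) ⟩
    g n                                  ∎

  ⊛-identityˡ : ∀ f → 1ₚ ⊛ f ≈ₚ f
  ⊛-identityˡ f n = trans (⊛-constˡ 1ₚ f (λ _ → refl) n) (*-identityˡ _)

  powerSeries : CommutativeRing r ℓ
  powerSeries = record
    { _*_ = _⊛_
    ; 1#  = 1ₚ
    ; isCommutativeRing = record
      { isRing = record
        { +-isAbelianGroup = Pointwise.isAbelianGroup ℕ +-isAbelianGroup
        ; *-cong           = ⊛-cong
        ; *-assoc          = ⊛-assoc
        ; *-identity       = ⊛-identityˡ , λ f n → trans (⊛-comm f 1ₚ n) (⊛-identityˡ f n)
        ; distrib          = ⊛-distribˡ , ⊛-distribʳ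
        }
      ; *-comm = ⊛-comm
      }
    }

  private
    module PR = CommutativeRing powerSeries
    module PSum = Summation powerSeries
  open SemiringExp PR.semiring using (_^_)

  ∑ₚ-eval : ∀ lo n F k → PSum.∑ lo n F k ≈ ∑ lo n (λ a → F a k)
  ∑ₚ-eval lo zero    F k = refl
  ∑ₚ-eval lo (suc n) F k = +-congˡ (∑ₚ-eval (suc lo) n F k)

  ⊛-lower-zero : ∀ f g n → f 0 ≈ 0# → (∀ k → k < n → g k ≈ 0#) → (f ⊛ g) n ≈ 0#
  ⊛-lower-zero f g zero    f0 g0 = trans (+-identityʳ _) (trans (*-congʳ f0) (zeroˡ _))
  ⊛-lower-zero f g (suc n) f0 g0 = trans (⊛-suc f g n) (trans
    (+-cong (trans (*-congʳ f0) (zeroˡ _))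
      (trans (⊛-cong-≤ {tail f} {tail f} {g} {λ _ → 0#} n (λ _ _ → refl) (λ k k≤n → g0 k (s≤s k≤n)))
             (trans (⊛-comm (tail f) _ n) (⊛-zeroˡ (λ _ → 0#) (tail f) (λ _ → refl) n))))
    (+-identityʳ _))

  ^-lower-zero : ∀ y → y 0 ≈ 0# → ∀ e n → n < e → (y ^ e) n ≈ 0#
  ^-lower-zero y y0 (suc e) n (s≤s n≤e) = ⊛-lower-zero y (y ^ e) n y0
    (λ k k<n → ^-lower-zero y y0 e k (ℕ.<-≤-trans k<n n≤e))

  -- The infinite sum of y^e, cut at e = n in coefficient n; when y has no constant term, higher
  -- powers do not reach that coefficient.
  geometricInverse : PS → PS
  geometricInverse y n = ∑ 0 (suc n) (λ e → (y ^ e) n)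

  geometricInverse-truncate : ∀ y → y 0 ≈ 0# → ∀ j n →
    geometricInverse y n ≈ ∑ 0 (j ℕ.+ suc n) (λ e → (y ^ e) n)
  geometricInverse-truncate y y0 zero    n = refl
  geometricInverse-truncate y y0 (suc j) n = sym (trans (∑-snoc 0 (j ℕ.+ suc n) _) (trans
    (+-cong (sym (geometricInverse-truncate y y0 j n))
      (^-lower-zero y y0 (j ℕ.+ suc n) n (ℕ.m≤n+m (suc n) j)))
    (+-identityʳ _)))

  geometricInverse-correct : ∀ y → y 0 ≈ 0# →
    (1ₚ PR.- y) ⊛ geometricInverse y ≈ₚ 1ₚ
  geometricInverse-correct y y0 n = begin
    ((1ₚ PR.- y) ⊛ geometricInverse y) n
      -- The cut varies with the coefficient, so all coefficients up to n are first replaced by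
      -- those of one finite geometric sum.
      ≈⟨ ⊛-cong-≤ {1ₚ PR.- y} {1ₚ PR.- y} {geometricInverse y} {G} n (λ _ _ → refl) (λ a a≤n → trans
           (geometricInverse-truncate y y0 (n ∸ a) a)
           (trans (reflexive (≡.cong (λ N → ∑ 0 N (λ e → (y ^ e) a))
                    (≡.trans (ℕ.+-suc (n ∸ a) a) (≡.cong suc (ℕ.m∸n+n≡m a≤n)))))
                  (sym (∑ₚ-eval 0 (suc n) (y ^_) a)))) ⟩
    ((1ₚ PR.- y) ⊛ G) n
      ≈⟨ neg n ⟩
    (1ₚ PR.- (y ^ suc n)) n
      ≈⟨ trans (+-congˡ (trans (-‿cong (^-lower-zero y y0 (suc n) n ℕ.≤-refl)) -0#≈0#)) (+-identityʳ _) ⟩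
    1ₚ n ∎
    where
    open RingProperties ring using (-0#≈0#)
    G = PSum.∑ 0 (suc n) (y ^_)
    neg : (1ₚ PR.- y) ⊛ G ≈ₚ 1ₚ PR.- (y ^ suc n)
    neg = PR.trans (IS.solve 2 (λ y g → (IS.𝟙 IS.:- y) IS.:* g IS.:= IS.:- ((y IS.:- IS.𝟙) IS.:* g)) PR.refl y G)
          (PR.trans (PR.-‿cong (PSum.geometric (suc n) y))
            (IS.solve 1 (λ w → IS.:- (w IS.:- IS.𝟙) IS.:= IS.𝟙 IS.:- w) PR.refl (y ^ suc n)))
      where module IS = IntegerSolver powerSeries

-- The ring of series in t and x

module BivariateSeries where
  open import Defs
  open import Data.Rational as ℚ using (ℚ; 1ℚ)
  import Data.Rational.Properties as ℚ
  import Data.Rational.Unnormalised as ℚᵘ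
  import Data.Rational.Unnormalised.Properties as ℚᵘ
  open import Level using (0ℓ)

  ℚ-ring : CommutativeRing 0ℓ 0ℓ
  ℚ-ring = ℚ.+-*-commutativeRing

  module ℚΣ = Summation ℚ-ring
  module X = PowerSeries ℚ-ring
  module T = PowerSeries X.powerSeries
  module TR = CommutativeRing T.powerSeries

  sumℚ≡∑ : ∀ lo n f → sumℚ lo n f ≡ ℚΣ.∑ lo n f
  sumℚ≡∑ lo zero    f = ≡.refl
  sumℚ≡∑ lo (suc n) f = ≡.cong (f lo ℚ.+_) (sumℚ≡∑ (suc lo) n f)

  sumℚ-cong : ∀ lo n {f g} → (∀ k → f k ≡ g k) → sumℚ lo n f ≡ sumℚ lo n g
  sumℚ-cong lo zero    e = ≡.refl
  sumℚ-cong lo (suc n) e = ≡.cong₂ ℚ._+_ (e lo) (sumℚ-cong (suc lo) n e)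

  -- The double convolution is a Cauchy product in t of Cauchy products in x, so the ring laws come
  -- from using the one-variable construction twice.
  *ˢ≈⊛ : ∀ f g → f *ˢ g ≈ˢ f T.⊛ g
  *ˢ≈⊛ f g n k = ≡.trans
    (sumℚ-cong 0 (suc n) {g = λ a → (f a X.⊛ g (n ∸ a)) k} (λ a → sumℚ≡∑ 0 (suc k) (λ b → f a b ℚ.* g (n ∸ a) (k ∸ b))))
    (≡.trans (sumℚ≡∑ 0 (suc n) (λ a → (f a X.⊛ g (n ∸ a)) k)) (≡.sym (X.∑ₚ-eval 0 (suc n) (λ a → f a X.⊛ g (n ∸ a)) k)))

  -- Opaque to unification, unlike the function type Ser.
  record Series : Set where
    no-eta-equality
    constructor series
    field coeff : Ser
  open Series public

  infix 4 _≋_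
  record _≋_ (f g : Series) : Set where
    constructor pointwise
    field at : coeff f ≈ˢ coeff g
  open _≋_ public

  infixl 6 _+_
  infixl 7 _*_
  _+_ _*_ : Series → Series → Series
  (f + g) .coeff = coeff f +ˢ coeff g
  (f * g) .coeff = coeff f *ˢ coeff g

  neg : Series → Series
  neg f .coeff n k = ℚ.- coeff f n k

  0# 1# : Series
  0# .coeff = 0ˢ
  1# .coeff = 1ˢ

  ≋-refl : ∀ {f} → f ≋ f
  ≋-refl .at n k = ≡.refl

  ≋-sym : ∀ {f g} → f ≋ g → g ≋ f
  ≋-sym e .at n k = ≡.sym (at e n k)

  ≋-trans : ∀ {f g h} → f ≋ g → g ≋ h → f ≋ h
  ≋-trans e e′ .at n k = ≡.trans (at e n k) (at e′ n k)

  infixl 7 _⊛_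
  _⊛_ : Series → Series → Series
  (f ⊛ g) .coeff = coeff f T.⊛ coeff g

  *≋⊛ : ∀ f g → f * g ≋ f ⊛ g
  *≋⊛ f g = pointwise (*ˢ≈⊛ (coeff f) (coeff g))

  ⊛-cong : ∀ {f f′ g g′} → f ≋ f′ → g ≋ g′ → f ⊛ g ≋ f′ ⊛ g′
  ⊛-cong {f} {f′} {g} {g′} e e′ = pointwise (T.⊛-cong {coeff f} {coeff f′} {coeff g} {coeff g′} (at e) (at e′))

  ⊛→* : ∀ {f g f′ g′} → f ⊛ g ≋ f′ ⊛ g′ → f * g ≋ f′ * g′
  ⊛→* {f} {g} {f′} {g′} e = ≋-trans (*≋⊛ f g) (≋-trans e (≋-sym (*≋⊛ f′ g′)))

  1≋1ₚ : 1# ≋ series T.1ₚ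
  1≋1ₚ .at zero    zero    = ≡.refl
  1≋1ₚ .at zero    (suc k) = ≡.refl
  1≋1ₚ .at (suc n) k       = ≡.refl

  *-assoc : ∀ f g h → (f * g) * h ≋ f * (g * h)
  *-assoc f g h = ≋-trans (*≋⊛ (f * g) h) (≋-trans (⊛-cong (*≋⊛ f g) ≋-refl)
    (≋-trans (pointwise (T.⊛-assoc (coeff f) (coeff g) (coeff h)))
             (≋-trans (⊛-cong ≋-refl (≋-sym (*≋⊛ g h))) (≋-sym (*≋⊛ f (g * h))))))

  *-comm : ∀ f g → f * g ≋ g * f
  *-comm f g = ⊛→* (pointwise (T.⊛-comm (coeff f) (coeff g)))

  *-identityˡ : ∀ f → 1# * f ≋ f
  *-identityˡ f = ≋-trans (*≋⊛ 1# f) (≋-trans (⊛-cong 1≋1ₚ ≋-refl) (pointwise (T.⊛-identityˡ (coeff f))))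

  *-distribˡ : ∀ f g h → f * (g + h) ≋ f * g + f * h
  *-distribˡ f g h .at n k = ≡.trans (at (*≋⊛ f (g + h)) n k) (≡.trans (T.⊛-distribˡ (coeff f) (coeff g) (coeff h) n k)
    (≡.sym (≡.cong₂ ℚ._+_ (at (*≋⊛ f g) n k) (at (*≋⊛ f h) n k))))

  *-distribʳ : ∀ f g h → (g + h) * f ≋ g * f + h * f
  *-distribʳ f g h .at n k = ≡.trans (at (*≋⊛ (g + h) f) n k) (≡.trans (T.⊛-distribʳ (coeff f) (coeff g) (coeff h) n k)
    (≡.sym (≡.cong₂ ℚ._+_ (at (*≋⊛ g f) n k) (at (*≋⊛ h f) n k))))

  Series-ring : CommutativeRing 0ℓ 0ℓ
  Series-ring = record
    { Carrier = Series
    ; _≈_ = _≋_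
    ; _+_ = _+_
    ; _*_ = _*_
    ; -_ = neg
    ; 0# = 0#
    ; 1# = 1#
    ; isCommutativeRing = record
      { isRing = record
        { +-isAbelianGroup = record
          { isGroup = record
            { isMonoid = record
              { isSemigroup = record
                { isMagma = record
                  { isEquivalence = record { refl = ≋-refl ; sym = ≋-sym ; trans = ≋-trans }
                  ; ∙-cong = λ e e′ → pointwise λ n k → ≡.cong₂ ℚ._+_ (at e n k) (at e′ n k)
                  }
                ; assoc = λ f g h → pointwise λ n k → ℚ.+-assoc (coeff f n k) (coeff g n k) (coeff h n k)
                }
              ; identity = (λ f → pointwise λ n k → ℚ.+-identityˡ (coeff f n k))
                         , (λ f → pointwise λ n k → ℚ.+-identityʳ (coeff f n k))
              }
            ; inverse = (λ f → pointwise λ n k → ℚ.+-inverseˡ (coeff f n k))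
                      , (λ f → pointwise λ n k → ℚ.+-inverseʳ (coeff f n k))
            ; ⁻¹-cong = λ e → pointwise λ n k → ≡.cong ℚ.-_ (at e n k)
            }
          ; comm = λ f g → pointwise λ n k → ℚ.+-comm (coeff f n k) (coeff g n k)
          }
        ; *-cong     = λ e e′ → ⊛→* (⊛-cong e e′)
        ; *-assoc    = *-assoc
        ; *-identity = *-identityˡ , λ f → ≋-trans (*-comm f 1#) (*-identityˡ f)
        ; distrib    = *-distribˡ , *-distribʳ
        }
      ; *-comm = *-comm
      }
    }

  module SR = CommutativeRing Series-ring
  module SS = Summation Series-ring
  module SE = SemiringExp SR.semiring
  open SE using (_^_)

  series-* : ∀ f g → series (f *ˢ g) ≋ series f * series g
  series-* f g = pointwise λ n k → ≡.refl

  series-+ : ∀ f g → series (f +ˢ g) ≋ series f + series g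
  series-+ f g = pointwise λ n k → ≡.refl

  series-- : ∀ f g → series (f -ˢ g) ≋ series f SR.- series g
  series-- f g = pointwise λ n k → ≡.refl

  series-^ : ∀ f n → series (f ^ˢ n) ≋ series f ^ n
  series-^ f zero    = pointwise λ n k → ≡.refl
  series-^ f (suc n) = ≋-trans (series-* f (f ^ˢ n)) (SR.*-congˡ {series f} (series-^ f n))

  series-∑ : ∀ lo n F → series (sumˢ lo n F) ≋ SS.∑ lo n (λ k → series (F k))
  series-∑ lo zero    F = pointwise λ n k → ≡.refl
  series-∑ lo (suc n) F = ≋-trans (series-+ (F lo) _) (SR.+-congˡ (series-∑ (suc lo) n F))

  const : ℚ → Series
  const c = series (constˢ c)

  series-· : ∀ c f → series (c ·ˢ f) ≋ const c * series f
  series-· c f .at n k = ≡.sym (≡.trans (*ˢ≈⊛ (constˢ c) f n k)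
    (≡.trans (T.⊛-constˡ (constˢ c) f (λ _ _ → ≡.refl) n k)
             (X.⊛-constˡ (constˢ c 0) (f n) (λ _ → ≡.refl) k)))

  -- Normalisation of fractions blocks computation at a variable n, so the equation is checked on
  -- unnormalised rationals.
  fromℕℚ-suc : ∀ n → fromℕℚ (suc n) ≡ 1ℚ ℚ.+ fromℕℚ n
  fromℕℚ-suc n = ℚ.toℚᵘ-injective (begin
    ℚ.toℚᵘ (fromℕℚ (suc n))                 ≈⟨ ℚ.toℚᵘ-fromℚᵘ (ℚᵘ.mkℚᵘ (+ suc n) 0) ⟩
    ℚᵘ.mkℚᵘ (+ suc n) 0                     ≈⟨ ℚᵘ.*≡* (≡.trans (ℤ.*-identityʳ (+ suc n)) (≡.sym (≡.trans (ℤ.*-identityʳ _) (≡.cong (λ j → + 1 ℤ.+ j) (ℤ.*-identityʳ (+ n)))))) ⟩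
    ℚᵘ.1ℚᵘ ℚᵘ.+ ℚᵘ.mkℚᵘ (+ n) 0             ≈⟨ ℚᵘ.+-congʳ ℚᵘ.1ℚᵘ (ℚᵘ.≃-sym (ℚ.toℚᵘ-fromℚᵘ (ℚᵘ.mkℚᵘ (+ n) 0))) ⟩
    ℚ.toℚᵘ 1ℚ ℚᵘ.+ ℚ.toℚᵘ (fromℕℚ n)        ≈⟨ ℚᵘ.≃-sym (ℚ.toℚᵘ-homo-+ 1ℚ (fromℕℚ n)) ⟩
    ℚ.toℚᵘ (1ℚ ℚ.+ fromℕℚ n)                ∎)
    where open ℚᵘ.≃-Reasoning

  const-ι : ∀ m n → const (fromℕℚ n) ≋ Polynomials.ι Series-ring m n
  const-ι m zero = pointwise λ { zero zero → ≡.refl ; zero (suc k) → ≡.refl ; (suc n) k → ≡.refl }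
  const-ι m (suc n) = ≋-trans
    (pointwise λ { zero zero → fromℕℚ-suc n ; zero (suc k) → ≡.refl ; (suc n) k → ≡.refl })
    (≋-trans (SR.+-congˡ {1#} (const-ι m n)) (≋-sym (Polynomials.ι-+ Series-ring m 1 n)))

-- Polynomial rows, specialisation at x = 1 and uniqueness

module FunctionalEquations where
  open BivariateSeries
  open import Defs using (Ser; tˢ; xˢ)
  import Algebra.Properties.Group as GroupProperties
  open import Data.Nat.Induction using (<-rec)
  open import Data.Rational as ℚ using (0ℚ)
  import Data.Rational.Properties as ℚ
  open import Data.Product using (_,_; ∃-syntax)
  open import Data.Sum using (inj₁; inj₂)

  private
    module QR = CommutativeRing ℚ-ring
    module QG = GroupProperties QR.+-group
    module XS = Summation X.powerSeries
    module TE = SemiringExp TR.semiring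

  -- A row is the coefficient of one power of t. The instances are polynomials and constants in x;
  -- closure passes to series because a row of a product is a finite sum of products of rows.
  record RowClosed (P : X.PS → Set) : Set where
    field
      P-resp : ∀ {p q} → p X.≈ₚ q → P p → P q
      P-0    : P (λ _ → 0ℚ)
      P-1    : P X.1ₚ
      P-+    : ∀ {p q} → P p → P q → P (p X.⊕ q)
      P-neg  : ∀ {p} → P p → P (λ k → ℚ.- p k)
      P-⊛    : ∀ {p q} → P p → P q → P (p X.⊛ q)

  module Rowwise {P : X.PS → Set} (closed : RowClosed P) where
    open RowClosed closed

    Rows : Ser → Set
    Rows f = ∀ n → P (f n)

    P-∑ : ∀ lo n F → (∀ k → P (F k)) → P (XS.∑ lo n F)
    P-∑ lo zero    F r = P-0
    P-∑ lo (suc n) F r = P-+ (r lo) (P-∑ (suc lo) n F r)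

    Rows-⊛ : ∀ {f g} → Rows f → Rows g → Rows (f T.⊛ g)
    Rows-⊛ r s n = P-∑ 0 (suc n) _ (λ a → P-⊛ (r a) (s (n ∸ a)))

    Rows-1ₚ : Rows T.1ₚ
    Rows-1ₚ zero    = P-1
    Rows-1ₚ (suc n) = P-0

    Rows-^ : ∀ {f} e → Rows f → Rows (f TE.^ e)
    Rows-^ zero    r = Rows-1ₚ
    Rows-^ (suc e) r = Rows-⊛ r (Rows-^ e r)

    Rows-resp : ∀ {f g} → f ≋ g → Rows (coeff f) → Rows (coeff g)
    Rows-resp e r n = P-resp (at e n) (r n)

    Rows-* : ∀ {f g} → Rows (coeff f) → Rows (coeff g) → Rows (coeff (f * g))
    Rows-* {f} {g} r s = Rows-resp (≋-sym (*≋⊛ f g)) (Rows-⊛ r s)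

    Rows-+ : ∀ {f g} → Rows (coeff f) → Rows (coeff g) → Rows (coeff (f + g))
    Rows-+ r s n = P-+ (r n) (s n)

    Rows-neg : ∀ {f} → Rows (coeff f) → Rows (coeff (neg f))
    Rows-neg r n = P-neg (r n)

    Rows-0 : Rows (coeff 0#)
    Rows-0 n = P-0

    Rows-1 : Rows (coeff 1#)
    Rows-1 = Rows-resp (≋-sym 1≋1ₚ) Rows-1ₚ

    Rows-geometricInverse : ∀ {y} → Rows y → Rows (T.geometricInverse y)
    Rows-geometricInverse r n = P-∑ 0 (suc n) _ (λ e → Rows-^ e r n)

  Finite : X.PS → Set
  Finite p = ∃[ K ] (∀ k → K < k → p k ≡ 0ℚ)

  ∑-zero : ∀ lo n {f} → (∀ k → lo ≤ k → k < lo ℕ.+ n → f k ≡ 0ℚ) → ℚΣ.∑ lo n f ≡ 0ℚ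
  ∑-zero lo n {f} z = ≡.trans (ℚΣ.∑-cong lo n {f} {λ _ → 0ℚ} z) (zeros lo n)
    where
    zeros : ∀ lo n → ℚΣ.∑ lo n (λ _ → 0ℚ) ≡ 0ℚ
    zeros lo zero    = ≡.refl
    zeros lo (suc n) = ≡.trans (ℚ.+-identityˡ _) (zeros (suc lo) n)

  finite-closed : RowClosed Finite
  finite-closed = record
    { P-resp = λ { e (K , z) → K , λ k K<k → ≡.trans (≡.sym (e k)) (z k K<k) }
    ; P-0    = 0 , λ _ _ → ≡.refl
    ; P-1    = 0 , λ { (suc k) _ → ≡.refl }
    ; P-+    = λ { (K , z) (L , w) → K ℕ.+ L , λ k l → ≡.trans
        (≡.cong₂ ℚ._+_ (z k (ℕ.≤-<-trans (ℕ.m≤m+n K L) l)) (w k (ℕ.≤-<-trans (ℕ.m≤n+m L K) l))) (ℚ.+-identityˡ 0ℚ) }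
    ; P-neg  = λ { (K , z) → K , λ k l → ≡.cong ℚ.-_ (z k l) }
    ; P-⊛    = λ { {p} {q} (K , z) (L , w) → K ℕ.+ L , λ k l → ∑-zero 0 (suc k) (term p q z w k l) }
    }
    where
    term : ∀ {K L} p q → (∀ k → K < k → p k ≡ 0ℚ) → (∀ k → L < k → q k ≡ 0ℚ) →
           ∀ k → K ℕ.+ L < k → ∀ b → 0 ≤ b → b < suc k → p b ℚ.* q (k ∸ b) ≡ 0ℚ
    term {K} {L} p q z w k l b _ (s≤s b≤k) with ℕ.<-≤-connex K b
    ... | inj₁ K<b = ≡.trans (≡.cong (ℚ._* q (k ∸ b)) (z b K<b)) (ℚ.*-zeroˡ (q (k ∸ b)))
    ... | inj₂ b≤K = ≡.trans (≡.cong (p b ℚ.*_) (w (k ∸ b)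
            (ℕ.+-cancelˡ-< b L (k ∸ b) (≡.subst (b ℕ.+ L <_) (≡.sym (ℕ.m+[n∸m]≡n b≤k))
              (ℕ.≤-<-trans (ℕ.+-monoˡ-≤ L b≤K) l))))) (ℚ.*-zeroʳ (p b))

  Constant : X.PS → Set
  Constant p = ∀ k → p (suc k) ≡ 0ℚ

  constant-closed : RowClosed Constant
  constant-closed = record
    { P-resp = λ e z k → ≡.trans (≡.sym (e (suc k))) (z k)
    ; P-0    = λ _ → ≡.refl
    ; P-1    = λ _ → ≡.refl
    ; P-+    = λ z w k → ≡.trans (≡.cong₂ ℚ._+_ (z k) (w k)) (ℚ.+-identityˡ 0ℚ)
    ; P-neg  = λ z k → ≡.cong ℚ.-_ (z k)
    ; P-⊛    = λ {p} {q} z w k → ≡.trans (X.⊛-constˡ p q z (suc k))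
                 (≡.trans (≡.cong (p 0 ℚ.*_) (w k)) (ℚ.*-zeroʳ (p 0)))
    }

  module Fin = Rowwise finite-closed
  module Con = Rowwise constant-closed

  RowFinite XFree : Series → Set
  RowFinite f = Fin.Rows (coeff f)
  XFree f = Con.Rows (coeff f)

  constant⇒finite : ∀ {p} → Constant p → Finite p
  constant⇒finite z = 0 , λ { (suc k) _ → z k }

  one-minus : ∀ f → f ≋ 1# SR.- (1# SR.- f)
  one-minus f = solve 1 (λ f → f := 𝟙 :- (𝟙 :- f)) ≋-refl f
    where open IntegerSolver Series-ring

  inverse : Series → Series
  inverse f = series (T.geometricInverse (coeff (1# SR.- f)))

  inverse-correct : ∀ f → (∀ k → coeff f 0 k ≡ coeff 1# 0 k) → f * inverse f ≋ 1#
  inverse-correct f f0 = ≋-trans (*≋⊛ f (inverse f))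
    (≋-trans (⊛-cong {g = inverse f} step ≋-refl)
    (≋-trans (pointwise (T.geometricInverse-correct (coeff y) y0)) (≋-sym 1≋1ₚ)))
    where
    y = 1# SR.- f
    y0 : ∀ k → coeff y 0 k ≡ 0ℚ
    y0 k = ≡.trans (≡.cong (λ a → coeff 1# 0 k ℚ.- a) (f0 k)) (ℚ.+-inverseʳ (coeff 1# 0 k))
    step : f ≋ series (T.1ₚ TR.- coeff y)
    step = ≋-trans (one-minus f) (pointwise λ n k → ≡.cong (ℚ._- coeff y n k) (at 1≋1ₚ n k))

  -- A row of the geometric inverse is a finite sum of rows of powers, so polynomial rows survive
  -- division.
  inverse-finite : ∀ {f} → RowFinite f → RowFinite (inverse f)
  inverse-finite {f} r = Fin.Rows-geometricInverse (Fin.Rows-+ {1#} {neg f} Fin.Rows-1 (Fin.Rows-neg {f} r))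

  inverse-xfree : ∀ {f} → XFree f → XFree (inverse f)
  inverse-xfree {f} r = Con.Rows-geometricInverse (Con.Rows-+ {1#} {neg f} Con.Rows-1 (Con.Rows-neg {f} r))

  x t x-1 : Series
  x = series xˢ
  t = series tˢ
  x-1 = x SR.- 1#

  x*-row : ∀ f n k → coeff (x * f) n k ≡ (xˢ 0 X.⊛ coeff f n) k
  x*-row f n k = ≡.trans (at (*≋⊛ x f) n k) (T.⊛-constˡ xˢ (coeff f) (λ _ _ → ≡.refl) n k)

  x*-zero : ∀ f n → coeff (x * f) n 0 ≡ 0ℚ
  x*-zero f n = ≡.trans (x*-row f n 0) (≡.trans (ℚ.+-identityʳ (0ℚ ℚ.* coeff f n 0)) (ℚ.*-zeroˡ (coeff f n 0)))

  x*-suc : ∀ f n k → coeff (x * f) n (suc k) ≡ coeff f n k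
  x*-suc f n k = ≡.trans (x*-row f n (suc k)) (X.⊛-shiftˡ (xˢ 0) (coeff f n) ≡.refl ≡.refl (λ _ → ≡.refl) k)

  x-1* : ∀ f → x-1 * f ≋ x * f SR.- f
  x-1* f = solve 2 (λ x f → (x :- 𝟙) :* f := x :* f :- f) ≋-refl x f
    where open IntegerSolver Series-ring

  x-1*-zero : ∀ f n → coeff (x-1 * f) n 0 ≡ ℚ.- coeff f n 0
  x-1*-zero f n = ≡.trans (at (x-1* f) n 0) (≡.trans (≡.cong (ℚ._- coeff f n 0) (x*-zero f n)) (ℚ.+-identityˡ _))

  x-1*-suc : ∀ f n k → coeff (x-1 * f) n (suc k) ≡ coeff f n k ℚ.- coeff f n (suc k)
  x-1*-suc f n k = ≡.trans (at (x-1* f) n (suc k)) (≡.cong (ℚ._- coeff f n (suc k)) (x*-suc f n k))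

  Row≡ : ℕ → Series → Series → Set
  Row≡ n f g = ∀ k → coeff f n k ≡ coeff g n k

  minus-injective : ∀ {a b p q} → a ≡ b → a ℚ.- p ≡ b ℚ.- q → p ≡ q
  minus-injective {a} ≡.refl e = ℚ.neg-injective (QG.∙-cancelˡ a _ _ e)

  -- The constant term of x-1 is -1, so the coefficients of f are recovered from those of (x-1)f one
  -- after another, within a single row.
  x-1-cancel : ∀ f g n → Row≡ n (x-1 * f) (x-1 * g) → Row≡ n f g
  x-1-cancel f g n e zero = ℚ.neg-injective (≡.trans (≡.sym (x-1*-zero f n)) (≡.trans (e 0) (x-1*-zero g n)))
  x-1-cancel f g n e (suc k) = minus-injective (x-1-cancel f g n e k)
    (≡.trans (≡.sym (x-1*-suc f n k)) (≡.trans (e (suc k)) (x-1*-suc g n k)))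

  infix 4 _~_
  -- `g` is the value of `f` at x = 1. Divisibility by x-1 with a polynomial quotient replaces
  -- summing the coefficients of a row.
  record _~_ (f g : Series) : Set where
    field
      finite          : RowFinite f
      xfree           : XFree g
      quotient        : Series
      quotient-finite : RowFinite quotient
      difference      : f SR.- g ≋ x-1 * quotient
  open _~_ public

  xfree⇒finite : ∀ {f} → XFree f → RowFinite f
  xfree⇒finite z n = constant⇒finite (z n)

  module _ where
    open IntegerSolver Series-ring

    xfree⇒~ : ∀ {f} → XFree f → f ~ f
    xfree⇒~ {f} z = record
      { finite = xfree⇒finite {f} z ; xfree = z ; quotient = 0# ; quotient-finite = Fin.Rows-0
      ; difference = solve 2 (λ f v → f :- f := v :* 𝟘) ≋-refl f x-1 }

    +~ : ∀ {f g f′ g′} → f ~ g → f′ ~ g′ → f + f′ ~ g + g′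
    +~ {f} {g} {f′} {g′} r s = record
      { finite = Fin.Rows-+ {f} {f′} (finite r) (finite s)
      ; xfree = Con.Rows-+ {g} {g′} (xfree r) (xfree s)
      ; quotient = quotient r + quotient s
      ; quotient-finite = Fin.Rows-+ {quotient r} {quotient s} (quotient-finite r) (quotient-finite s)
      ; difference = ≋-trans (solve 4 (λ f g f′ g′ → (f :+ f′) :- (g :+ g′) := (f :- g) :+ (f′ :- g′)) ≋-refl f g f′ g′)
          (≋-trans (SR.+-cong (difference r) (difference s)) (≋-sym (SR.distribˡ x-1 (quotient r) (quotient s)))) }

    neg~ : ∀ {f g} → f ~ g → neg f ~ neg g
    neg~ {f} {g} r = record
      { finite = Fin.Rows-neg {f} (finite r)
      ; xfree = Con.Rows-neg {g} (xfree r)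
      ; quotient = neg (quotient r)
      ; quotient-finite = Fin.Rows-neg {quotient r} (quotient-finite r)
      ; difference = ≋-trans (solve 2 (λ f g → :- f :- :- g := :- (f :- g)) ≋-refl f g)
          (≋-trans (SR.-‿cong (difference r)) (solve 2 (λ v q → :- (v :* q) := v :* :- q) ≋-refl x-1 (quotient r))) }

    *~ : ∀ {f g f′ g′} → f ~ g → f′ ~ g′ → f * f′ ~ g * g′
    *~ {f} {g} {f′} {g′} r s = record
      { finite = Fin.Rows-* {f} {f′} (finite r) (finite s)
      ; xfree = Con.Rows-* {g} {g′} (xfree r) (xfree s)
      ; quotient = quotient r * f′ + g * quotient s
      ; quotient-finite = Fin.Rows-+ {quotient r * f′} {g * quotient s}
          (Fin.Rows-* {quotient r} {f′} (quotient-finite r) (finite s))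
          (Fin.Rows-* {g} {quotient s} (xfree⇒finite {g} (xfree r)) (quotient-finite s))
      ; difference = ≋-trans (solve 4 (λ f g f′ g′ → f :* f′ :- g :* g′ := (f :- g) :* f′ :+ g :* (f′ :- g′)) ≋-refl f g f′ g′)
          (≋-trans (SR.+-cong (SR.*-congʳ (difference r)) (SR.*-congˡ (difference s)))
            (solve 5 (λ v q f g q′ → v :* q :* f :+ g :* (v :* q′) := v :* (q :* f :+ g :* q′)) ≋-refl x-1 (quotient r) f′ g (quotient s))) }

    ~-resp : ∀ {f g g′} → g ≋ g′ → f ~ g → f ~ g′
    ~-resp e r = record
      { finite = finite r ; xfree = Con.Rows-resp e (xfree r)
      ; quotient = quotient r ; quotient-finite = quotient-finite r
      ; difference = ≋-trans (SR.+-congˡ (SR.-‿cong (≋-sym e))) (difference r) }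

  0~0 : 0# ~ 0#
  0~0 = xfree⇒~ {0#} Con.Rows-0

  1~1 : 1# ~ 1#
  1~1 = xfree⇒~ {1#} Con.Rows-1

  finite-stationary : ∀ {p} → Finite p → (∀ k → p k ≡ p (suc k)) → p 0 ≡ 0ℚ
  finite-stationary {p} (K , z) s = ≡.trans (go (suc K)) (z (suc K) ℕ.≤-refl)
    where
    go : ∀ k → p 0 ≡ p k
    go zero    = ≡.refl
    go (suc k) = ≡.trans (go k) (s k)

  private
    module QS = IntegerSolver ℚ-ring

  -- The difference D of the quotients satisfies (x-1)D = g′ - g in row n, a constant. So all
  -- coefficients of that row of D are equal, and being eventually zero they vanish. One row at a
  -- time, because the induction knows agreement only up to a given power of t.
  ~-unique : ∀ {f g f′ g′} n → f ~ g → f′ ~ g′ → Row≡ n f f′ → Row≡ n g g′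
  ~-unique {f} {g} {f′} {g′} n r s e (suc k) = ≡.trans (xfree r n k) (≡.sym (xfree s n k))
  ~-unique {f} {g} {f′} {g′} n r s e zero = ≡.trans
    (QS.solve 3 (λ f g g′ → g QS.:= g′ QS.:+ ((f QS.:- g′) QS.:- (f QS.:- g))) ≡.refl (coeff f n 0) (coeff g n 0) (coeff g′ n 0))
    (≡.trans (≡.cong (coeff g′ n 0 ℚ.+_) gap) (ℚ.+-identityʳ _))
    where
    h = quotient r
    h′ = quotient s
    D : Series
    D = h SR.- h′
    D-finite : RowFinite D
    D-finite = Fin.Rows-+ {h} {neg h′} (quotient-finite r) (Fin.Rows-neg {h′} (quotient-finite s))
    dif : ∀ k → coeff (x-1 * D) n k ≡ coeff g′ n k ℚ.- coeff g n k
    dif k = ≡.trans (at (solve 3 (λ v h h′ → v :* (h :- h′) := v :* h :- v :* h′) ≋-refl x-1 h h′) n k)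
      (≡.trans (≡.cong₂ ℚ._-_ (≡.sym (at (difference r) n k)) (≡.sym (at (difference s) n k)))
      (≡.trans (≡.cong (λ a → (a ℚ.- coeff g n k) ℚ.- (coeff f′ n k ℚ.- coeff g′ n k)) (e k))
        (QS.solve 3 (λ f g g′ → (f QS.:- g) QS.:- (f QS.:- g′) QS.:= g′ QS.:- g) ≡.refl (coeff f′ n k) (coeff g n k) (coeff g′ n k))))
      where open IntegerSolver Series-ring
    stationary : ∀ k → coeff D n k ≡ coeff D n (suc k)
    stationary k = QG.x∙y⁻¹≈ε⇒x≈y _ _ (≡.trans (≡.sym (x-1*-suc D n k)) (≡.trans (dif (suc k))
      (≡.cong₂ ℚ._-_ (xfree s n k) (xfree r n k))))
    D0 : coeff D n 0 ≡ 0ℚ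
    D0 = finite-stationary (D-finite n) stationary
    gap : (coeff f n 0 ℚ.- coeff g′ n 0) ℚ.- (coeff f n 0 ℚ.- coeff g n 0) ≡ 0ℚ
    gap = ≡.trans (QS.solve 3 (λ f g g′ → (f QS.:- g′) QS.:- (f QS.:- g) QS.:= QS.:- (g′ QS.:- g)) ≡.refl (coeff f n 0) (coeff g n 0) (coeff g′ n 0))
      (≡.cong ℚ.-_ (≡.trans (≡.sym (dif 0)) (≡.trans (x-1*-zero D n) (≡.cong ℚ.-_ D0))))

  row-*-local : ∀ f g g′ n → (∀ a → a ≤ n → Row≡ a g g′) → Row≡ n (f * g) (f * g′)
  row-*-local f g g′ n e k = ≡.trans (at (*≋⊛ f g) n k)
    (≡.trans (T.⊛-cong-≤ {coeff f} {coeff f} {coeff g} {coeff g′} n (λ _ _ _ → ≡.refl) e k)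
             (≡.sym (at (*≋⊛ f g′) n k)))

  Order₁ : Series → Set
  Order₁ f = ∀ k → coeff f 0 k ≡ 0ℚ

  Order₁-*ˡ : ∀ f g → Order₁ f → Order₁ (f * g)
  Order₁-*ˡ f g z k = ≡.trans (at (*≋⊛ f g) 0 k)
    (≡.trans (ℚ.+-identityʳ _) (X.⊛-zeroˡ (coeff f 0) (coeff g 0) z k))

  Order₁-*ʳ : ∀ f g → Order₁ g → Order₁ (f * g)
  Order₁-*ʳ f g z k = ≡.trans (at (*-comm f g) 0 k) (Order₁-*ˡ g f z k)

  -- When row 0 of every factor is zero, the two extreme terms of the convolution drop out. Hence
  -- the functional equation determines each row from strictly earlier ones.
  row-*-earlier : ∀ f f′ g g′ n → Order₁ f → Order₁ f′ → Order₁ g → Order₁ g′ →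
    (∀ a → a < n → Row≡ a f f′) → (∀ a → a < n → Row≡ a g g′) → Row≡ n (f * g) (f′ * g′)
  row-*-earlier f f′ g g′ n f0 f′0 g0 g′0 ef eg k = ≡.trans (at (*≋⊛ f g) n k)
    (≡.trans (XS.∑-cong 0 (suc n) {λ a → coeff f a X.⊛ coeff g (n ∸ a)} {λ a → coeff f′ a X.⊛ coeff g′ (n ∸ a)} term k)
             (≡.sym (at (*≋⊛ f′ g′) n k)))
    where
    term : ∀ a → 0 ≤ a → a < suc n → ∀ k → (coeff f a X.⊛ coeff g (n ∸ a)) k ≡ (coeff f′ a X.⊛ coeff g′ (n ∸ a)) k
    term zero    _ _ k = ≡.trans (X.⊛-zeroˡ (coeff f 0) (coeff g n) f0 k) (≡.sym (X.⊛-zeroˡ (coeff f′ 0) (coeff g′ n) f′0 k))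
    term (suc a) _ (s≤s a<n) k with ℕ.m≤n⇒m<n∨m≡n a<n
    ... | inj₁ 1+a<n = X.⊛-cong {coeff f (suc a)} {coeff f′ (suc a)} {coeff g (n ∸ suc a)} {coeff g′ (n ∸ suc a)}
            (ef (suc a) 1+a<n) (eg (n ∸ suc a) (ℕ.∸-monoʳ-< (s≤s z≤n) a<n)) k
    ... | inj₂ ≡.refl rewrite ℕ.n∸n≡0 a = ≡.trans (X.⊛-comm (coeff f (suc a)) (coeff g 0) k)
            (≡.trans (X.⊛-zeroˡ (coeff g 0) (coeff f (suc a)) g0 k)
            (≡.sym (≡.trans (X.⊛-comm (coeff f′ (suc a)) (coeff g′ 0) k) (X.⊛-zeroˡ (coeff g′ 0) (coeff f′ (suc a)) g′0 k))))

  module Uniqueness (m : ℕ) where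

    W : (J K : ℕ → Series) → ℕ → Series
    W J K i = x * J i SR.- x SE.^ (m ∸ i) * K i

    record System (J K : ℕ → Series) : Set where
      field
        special : ∀ i → i ≤ suc m → J i ~ K i
        order   : ∀ i → i ≤ suc m → Order₁ (J i)
        initial : J 0 ≋ t * x SE.^ m
        step    : ∀ i → i ≤ m → x-1 * (J (suc i) SR.- J i) ≋ J (suc m) * W J K i

    open System

    module _ {J K J′ K′ : ℕ → Series} (S : System J K) (S′ : System J′ K′) where

      -- Row 0 of K_i vanishes because the value at 1 of a zero row is zero.
      W-order : ∀ {J K} → System J K → ∀ i → i ≤ m → Order₁ (W J K i)
      W-order {J} {K} S i i≤m k = ≡.cong₂ ℚ._-_
        (Order₁-*ʳ x (J i) (order S i (ℕ.m≤n⇒m≤1+n i≤m)) k)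
        (Order₁-*ʳ (x SE.^ (m ∸ i)) (K i)
          (~-unique 0 (special S i (ℕ.m≤n⇒m≤1+n i≤m)) 0~0 (order S i (ℕ.m≤n⇒m≤1+n i≤m))) k)

      -- Strong induction on n, and inside it induction on i: row n of J_{i+1} - J_i depends only on
      -- rows below n.
      J-row : ∀ n i → i ≤ suc m → Row≡ n (J i) (J′ i)
      J-row = <-rec _ λ n rec → row n (λ {a} → rec {a})
        where
        row : ∀ n → (∀ {a} → a < n → ∀ i → i ≤ suc m → Row≡ a (J i) (J′ i)) → ∀ i → i ≤ suc m → Row≡ n (J i) (J′ i)
        row n rec zero    _         k = ≡.trans (at (initial S) n k) (≡.sym (at (initial S′) n k))
        row n rec (suc i) (s≤s i≤m) k = ≡.trans (split (J (suc i)) (J i) k)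
          (≡.trans (≡.cong₂ ℚ._+_ (row n rec i (ℕ.m≤n⇒m≤1+n i≤m) k) (increment k)) (≡.sym (split (J′ (suc i)) (J′ i) k)))
          where
          split : ∀ f g k → coeff f n k ≡ coeff g n k ℚ.+ coeff (f SR.- g) n k
          split f g k = QS.solve 2 (λ f g → f QS.:= g QS.:+ (f QS.:- g)) ≡.refl (coeff f n k) (coeff g n k)
          W-row : ∀ a → a < n → Row≡ a (W J K i) (W J′ K′ i)
          W-row a a<n k = ≡.cong₂ ℚ._-_
            (row-*-local x (J i) (J′ i) a (λ b b≤a → rec (ℕ.≤-<-trans b≤a a<n) i (ℕ.m≤n⇒m≤1+n i≤m)) k)
            (row-*-local (x SE.^ (m ∸ i)) (K i) (K′ i) a (λ b b≤a →
              ~-unique b (special S i (ℕ.m≤n⇒m≤1+n i≤m)) (special S′ i (ℕ.m≤n⇒m≤1+n i≤m)) (rec (ℕ.≤-<-trans b≤a a<n) i (ℕ.m≤n⇒m≤1+n i≤m))) k)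
          increment : Row≡ n (J (suc i) SR.- J i) (J′ (suc i) SR.- J′ i)
          increment = x-1-cancel (J (suc i) SR.- J i) (J′ (suc i) SR.- J′ i) n λ k → ≡.trans (at (step S i i≤m) n k)
            (≡.trans (row-*-earlier (J (suc m)) (J′ (suc m)) (W J K i) (W J′ K′ i) n
                (order S (suc m) ℕ.≤-refl) (order S′ (suc m) ℕ.≤-refl) (W-order S i i≤m) (W-order S′ i i≤m)
                (λ a a<n → rec a<n (suc m) ℕ.≤-refl) W-row k)
              (≡.sym (at (step S′ i i≤m) n k)))

      J-unique : ∀ i → i ≤ suc m → J i ≋ J′ i
      J-unique i i≤ .at n = J-row n i i≤

      K-unique : ∀ i → i ≤ suc m → K i ≋ K′ i
      K-unique i i≤ .at n = ~-unique n (special S i i≤) (special S′ i i≤) (J-row n i i≤)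

-- Dyck words, greedy covers and insertion of a factor

module DyckWords where
  open import Defs
  open import Data.Bool using (true; false)
  open import Data.List using (List; []; _∷_; _++_; length; replicate; [_])
  import Data.List.Properties as List
  open import Data.Product using (_,_; _×_; ∃-syntax; proj₁; proj₂)
  open import Data.Sum using (_⊎_; inj₁; inj₂)
  open import Data.Empty using (⊥; ⊥-elim)
  open import Data.Unit using (⊤; tt)
  open import Relation.Nullary using (¬_)
  open import Relation.Binary.PropositionalEquality hiding ([_])
  open import Relation.Binary.Construct.Closure.ReflexiveTransitive using (Star; ε; _◅_; _◅◅_; gmap)
  open import Algebra.Properties.CommutativeSemigroup ℕ.+-commutativeSemigroup using (x∙yz≈y∙xz)

  -- Compares two cuts of one word; every case analysis on the position of a cover rests on it. The
  -- overhang in the second alternative is nonempty, so the alternatives are disjoint.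
  ++-split : ∀ {A : Set} (a : List A) {b} c {d} → a ++ b ≡ c ++ d →
    (∃[ e ] (c ≡ a ++ e × b ≡ e ++ d)) ⊎ (∃[ x ] ∃[ e ] (a ≡ c ++ x ∷ e × d ≡ x ∷ e ++ b))
  ++-split []      c       eq = inj₁ (c , refl , eq)
  ++-split (x ∷ a) []      eq = inj₂ (x , a , refl , sym eq)
  ++-split (x ∷ a) (y ∷ c) eq with List.∷-injective eq
  ... | refl , eq′ with ++-split a c eq′
  ... | inj₁ (e , p , q)     = inj₁ (e , cong (x ∷_) p , q)
  ... | inj₂ (z , e , p , q) = inj₂ (z , e , cong (x ∷_) p , q)

  0^ : ℕ → Word
  0^ j = replicate j false

  0^-+ : ∀ i k → 0^ i ++ 0^ k ≡ 0^ (i ℕ.+ k)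
  0^-+ zero    k = refl
  0^-+ (suc i) k = cong (false ∷_) (0^-+ i k)

  0^-∷ : ∀ k → 0^ k ++ [ false ] ≡ 0^ (suc k)
  0^-∷ k = trans (0^-+ k 1) (cong 0^ (ℕ.+-comm k 1))

  0^-split : ∀ j e {s} → 0^ j ≡ e ++ s → ∃[ i ] ∃[ k ] (e ≡ 0^ i × s ≡ 0^ k × i ℕ.+ k ≡ j)
  0^-split j       []      eq = 0 , j , refl , sym eq , refl
  0^-split (suc j) (x ∷ e) eq with List.∷-injective eq
  ... | refl , eq′ with 0^-split j e eq′
  ... | i , k , refl , s≡ , refl = suc i , k , refl , s≡ , refl

  NoUp : Word → Set
  NoUp (true ∷ _) = ⊥
  NoUp _          = ⊤

  NoUp-0^ : ∀ k → NoUp (0^ k)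
  NoUp-0^ zero    = tt
  NoUp-0^ (suc k) = tt

  NoUp-++ˡ : ∀ s {t} → NoUp (s ++ t) → NoUp s
  NoUp-++ˡ []          _ = tt
  NoUp-++ˡ (false ∷ s) _ = tt

  NoUp-++-0^ : ∀ s k → NoUp s → NoUp (s ++ 0^ k)
  NoUp-++-0^ []          k _ = NoUp-0^ k
  NoUp-++-0^ (false ∷ s) k _ = tt

  ones-++ : ∀ p q → ones (p ++ q) ≡ ones p ℕ.+ ones q
  ones-++ []          q = refl
  ones-++ (true ∷ p)  q = cong suc (ones-++ p q)
  ones-++ (false ∷ p) q = ones-++ p q

  ones-0^ : ∀ i → ones (0^ i) ≡ 0
  ones-0^ zero    = refl
  ones-0^ (suc i) = ones-0^ i

  module Greedy (m : ℕ) where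

    -- The letters lead from the first height to the second without going below 0. The index `suc h`
    -- in `down` is the nonnegativity, so prefix inequalities turn into pattern matching.
    data Walk : ℕ → Word → ℕ → Set where
      []   : ∀ {h} → Walk h [] h
      up   : ∀ {h w h′} → Walk (m ℕ.+ h) w h′ → Walk h (true ∷ w) h′
      down : ∀ {h w h′} → Walk h w h′ → Walk (suc h) (false ∷ w) h′

    Dyck : Word → Set
    Dyck w = Walk 0 w 0

    walk-++ : ∀ {a b c p q} → Walk a p b → Walk b q c → Walk a (p ++ q) c
    walk-++ []       v = v
    walk-++ (up w)   v = up (walk-++ w v)
    walk-++ (down w) v = down (walk-++ w v)

    walk-split : ∀ {a c} p {q} → Walk a (p ++ q) c → ∃[ b ] (Walk a p b × Walk b q c)
    walk-split []          w        = _ , [] , w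
    walk-split (true ∷ p)  (up w)   with walk-split p w
    ... | b , u , v = b , up u , v
    walk-split (false ∷ p) (down w) with walk-split p w
    ... | b , u , v = b , down u , v

    walk-det : ∀ {a w b c} → Walk a w b → Walk a w c → b ≡ c
    walk-det []       []       = refl
    walk-det (up u)   (up v)   = walk-det u v
    walk-det (down u) (down v) = walk-det u v

    walk-lift : ∀ {a w b} c → Walk a w b → Walk (c ℕ.+ a) w (c ℕ.+ b)
    walk-lift c []                 = []
    walk-lift {a} c (up {w = w} {h′} u) = up (subst (λ h → Walk h w (c ℕ.+ h′)) (x∙yz≈y∙xz c m a) (walk-lift c u))
    walk-lift c (down {h} {w} {h′} u) = subst (λ a → Walk a (false ∷ w) (c ℕ.+ h′)) (sym (ℕ.+-suc c h)) (down (walk-lift c u))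

    dyck-lift : ∀ {w} c → Dyck w → Walk c w c
    dyck-lift {w} c d = subst (λ a → Walk a w a) (ℕ.+-identityʳ c) (walk-lift c d)

    -- The height gained by a word does not depend on the start. Most contradictions below arise
    -- from a sum of this kind being 0.
    walk-from-0 : ∀ {a w b c} → Walk 0 w b → Walk a w c → a ℕ.+ b ≡ c
    walk-from-0 {a} {w} {b} u v = walk-det (subst (λ h → Walk h w (a ℕ.+ b)) (ℕ.+-identityʳ a) (walk-lift a u)) v

    walk-0^ : ∀ i {a} → Walk (i ℕ.+ a) (0^ i) a
    walk-0^ zero    = []
    walk-0^ (suc i) = down (walk-0^ i)

    walk-0^-height : ∀ i {a b} → Walk a (0^ i) b → a ≡ i ℕ.+ b
    walk-0^-height zero    []       = refl
    walk-0^-height (suc i) (down w) = cong suc (walk-0^-height i w)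

    walk-pad : ∀ {A j} → Walk 0 A j → Dyck (A ++ 0^ j)
    walk-pad {A} {j} w = walk-++ w (subst (λ a → Walk a (0^ j) 0) (ℕ.+-identityʳ j) (walk-0^ j))

    walk-count : ∀ {a w b} → Walk a w b → b ℕ.+ zeros w ≡ a ℕ.+ m ℕ.* ones w
    walk-count {a} [] = cong (a ℕ.+_) (sym (ℕ.*-zeroʳ m))
    walk-count {a} (up {w = w} {b} u) = trans (walk-count u) (trans (ℕ.+-assoc m a _)
      (trans (x∙yz≈y∙xz m a (m ℕ.* ones w)) (cong (a ℕ.+_) (sym (ℕ.*-suc m (ones w))))))
    walk-count (down {h} {w} {b} u) = trans (ℕ.+-suc b (zeros w)) (cong suc (walk-count u))

    walk-prefix : ∀ {a w b} → Walk a w b → ∀ p s → w ≡ p ++ s → zeros p ≤ a ℕ.+ m ℕ.* ones p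
    walk-prefix w p s refl with walk-split p w
    ... | b , u , _ = subst (zeros p ≤_) (walk-count u) (ℕ.m≤n+m (zeros p) b)

    walk-exists : ∀ a w → (∀ p s → w ≡ p ++ s → zeros p ≤ a ℕ.+ m ℕ.* ones p) → ∃[ b ] Walk a w b
    walk-exists a [] _ = a , []
    walk-exists a (true ∷ w) c with walk-exists (m ℕ.+ a) w (λ p s eq → subst (zeros p ≤_)
        (trans (cong (a ℕ.+_) (ℕ.*-suc m (ones p))) (trans (x∙yz≈y∙xz a m _) (sym (ℕ.+-assoc m a _))))
        (c (true ∷ p) s (cong (true ∷_) eq)))
    ... | b , u = b , up u
    walk-exists zero (false ∷ w) c = ⊥-elim (ℕ.n≮0 (subst (1 ≤_) (ℕ.*-zeroʳ m) (c [ false ] w refl)))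
    walk-exists (suc a) (false ∷ w) c with walk-exists a w (λ p s eq → ℕ.s≤s⁻¹ (c (false ∷ p) s (cong (false ∷_) eq)))
    ... | b , u = b , down u

    IsDyck⇒Dyck : ∀ {n w} → IsDyck m n w → Dyck w
    IsDyck⇒Dyck {n} {w} (o , z , pre) with walk-exists 0 w pre
    ... | b , u = subst (Walk 0 w) (ℕ.+-cancelʳ-≡ (zeros w) b 0 (trans (walk-count u) (trans (cong (m ℕ.*_) o) (sym z)))) u

    Dyck⇒IsDyck : ∀ {w} → Dyck w → IsDyck m (ones w) w
    Dyck⇒IsDyck d = refl , walk-count d , walk-prefix d

    dyck-head : ∀ {w} → Dyck w → w ≢ [] → ∃[ w′ ] w ≡ true ∷ w′
    dyck-head []     w≢[] = ⊥-elim (w≢[] refl)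
    dyck-head (up _) _    = _ , refl

    dyck-not-0^ : ∀ {w} i → Dyck w → w ≢ [] → w ≢ 0^ i
    dyck-not-0^ i d w≢[] e with dyck-head d w≢[]
    dyck-not-0^ zero    d w≢[] ()   | _ , refl
    dyck-not-0^ (suc i) d w≢[] ()   | _ , refl

    dyck-ones : ∀ {w} → Dyck w → w ≢ [] → 1 ≤ ones w
    dyck-ones d w≢[] with dyck-head d w≢[]
    ... | _ , refl = s≤s z≤n

    ones⇒≢[] : ∀ {w} → 1 ≤ ones w → w ≢ []
    ones⇒≢[] () refl

    -- In a Dyck path, a Dyck factor is the longest at its place exactly when no up step follows: a
    -- following up step opens a further Dyck factor, and a following down step goes below the base.
    -- `NoUp` thus replaces the quantifier over competing factors in `Cover`.
    record Cov (w w′ : Word) : Set where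
      constructor cov
      field
        p u s  : Word
        u-dyck : Dyck u
        u≢[]   : u ≢ []
        noUp   : NoUp s
        source : w ≡ p ++ false ∷ u ++ s
        target : w′ ≡ p ++ u ++ false ∷ s

    infix 4 _⟶_ _⟶*_
    _⟶_ _⟶*_ : Word → Word → Set
    _⟶_ = Cov
    _⟶*_ = Star Cov

    -- After the swap u is read one level higher, and the heights at both ends of the swapped part
    -- are unchanged.
    swap-walk : ∀ {a c} p {u s} → Dyck u → Walk a (p ++ false ∷ u ++ s) c → Walk a (p ++ u ++ false ∷ s) c
    swap-walk p {u} d w with walk-split p w
    ... | _ , wp , down w′ with walk-split u w′
    ... | _ , wu , ws with walk-from-0 d wu
    ... | refl = walk-++ wp (walk-++ (dyck-lift _ d) (down (subst (λ h → Walk h _ _) (ℕ.+-identityʳ _) ws)))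

    cov-dyck : ∀ {w w′} → w ⟶ w′ → Dyck w → Dyck w′
    cov-dyck (cov p u s du _ _ refl refl) d = swap-walk p du d

    star-dyck : ∀ {w w′} → w ⟶* w′ → Dyck w → Dyck w′
    star-dyck ε       d = d
    star-dyck (c ◅ s) d = star-dyck s (cov-dyck c d)

    cov-ones : ∀ {w w′} → w ⟶ w′ → ones w ≡ ones w′
    cov-ones (cov p u s _ _ _ refl refl) = trans (ones-++ p _) (trans
      (cong (ones p ℕ.+_) (trans (ones-++ u s) (sym (ones-++ u (false ∷ s))))) (sym (ones-++ p _)))

    star-ones : ∀ {w w′} → w ⟶* w′ → ones w ≡ ones w′
    star-ones ε       = refl
    star-ones (c ◅ s) = trans (cov-ones c) (star-ones s)

    -- Cuts at the first visit to level h; `first-passage` also isolates the down step that leads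
    -- there.
    descend : ∀ l {h y} → Walk (l ℕ.+ h) y 0 → ∃[ d ] ∃[ y′ ] (y ≡ d ++ y′ × Walk l d 0 × Walk h y′ 0)
    descend zero {y = y} w = [] , y , refl , [] , w
    descend (suc l) (down w) with descend l w
    ... | d , y′ , refl , u , v = false ∷ d , y′ , refl , down u , v
    descend (suc l) {h} (up {w = y} w) with descend (m ℕ.+ suc l) (subst (λ a → Walk a y 0) (sym (ℕ.+-assoc m (suc l) h)) w)
    ... | d , y′ , refl , u , v = true ∷ d , y′ , refl , up u , v

    first-passage : ∀ l {h y} → Walk (l ℕ.+ suc h) y 0 → ∃[ d ] ∃[ y′ ] (y ≡ d ++ false ∷ y′ × Walk l d 0 × Walk h y′ 0)
    first-passage zero (down {w = y} w) = [] , y , refl , [] , w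
    first-passage (suc l) (down w) with first-passage l w
    ... | d , y′ , refl , u , v = false ∷ d , y′ , refl , down u , v
    first-passage l {h} (up {w = y} w) with first-passage (m ℕ.+ l) (subst (λ a → Walk a y 0) (sym (ℕ.+-assoc m l (suc h))) w)
    ... | d , y′ , refl , u , v = true ∷ d , y′ , refl , up u , v

    cover⇒cov : ∀ {w w′} → Dyck w → Cover m w w′ → w ⟶ w′
    cover⇒cov dw (p , s , u , s′ , refl , eq , (_ , du′) , longest , w′≡) = cov p u s′ du u≢[] (noUp s′ refl)
      (cong (λ r → p ++ false ∷ r) eq) w′≡
      where
      du : Dyck u
      du = IsDyck⇒Dyck du′
      suffix : ∃[ h ] Walk h s′ 0
      suffix with walk-split p dw
      ... | suc a , _ , down w₁ with walk-split u (subst (λ r → Walk a r 0) eq w₁)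
      ... | h , _ , w₂ = h , w₂
      noUp : ∀ t → t ≡ s′ → NoUp t
      noUp []          _ = tt
      noUp (false ∷ _) _ = tt
      -- The up step together with the walk back to its starting level would lengthen u.
      noUp (true ∷ t) refl with suffix
      ... | h , up w₂ with descend m w₂
      ... | d , t′ , refl , wd , _ = ℕ.<⇒≱ (ℕ.≤-trans (ℕ.m<m+n (length u) (s≤s z≤n)) (ℕ.≤-reflexive (sym (List.length-++ u))))
        (longest (u ++ true ∷ d) t′ (trans eq (sym (List.++-assoc u (true ∷ d) t′)))
          (_ , Dyck⇒IsDyck (walk-++ du (up (subst (λ a → Walk a d 0) (sym (ℕ.+-identityʳ m)) wd)))))
      u≢[] : u ≢ []
      u≢[] refl = subst NoUp (sym eq) (noUp s′ refl)

    cov⇒cover : ∀ {w w′} → w ⟶ w′ → Cover m w w′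
    cov⇒cover (cov p u s du u≢[] ns src tgt) with dyck-head du u≢[]
    ... | u′ , refl = p , u′ ++ s , u , s , src , refl , (_ , Dyck⇒IsDyck du) , longest , tgt
      where
      longest : ∀ u₁ s₁ → true ∷ u′ ++ s ≡ u₁ ++ s₁ → IsDyckAny m u₁ → length u₁ ≤ length u
      longest u₁ s₁ eq (_ , du₁) with ++-split u u₁ eq
      ... | inj₂ (x , e , u≡ , _) = ℕ.≤-trans (ℕ.m≤m+n (length u₁) (length (x ∷ e)))
        (ℕ.≤-reflexive (sym (trans (cong length u≡) (List.length-++ u₁))))
      ... | inj₁ ([] , refl , _) = ℕ.≤-reflexive (cong length (List.++-identityʳ u))
      ... | inj₁ (true ∷ e , refl , refl) = ⊥-elim ns
      -- After u the height is 0, so a Dyck factor cannot go on with a down step.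
      ... | inj₁ (false ∷ e , refl , refl) with walk-split u (IsDyck⇒Dyck du₁)
      ... | _ , wu , w₂ with walk-det du wu
      longest _ s₁ eq (_ , du₁) | inj₁ (false ∷ e , refl , refl) | _ , wu , () | refl

    ≤G⇒star : ∀ {v w} → Dyck v → v ≤G[ m ] w → v ⟶* w
    ≤G⇒star d ε       = ε
    ≤G⇒star d (c ◅ s) = let c′ = cover⇒cov d c in c′ ◅ ≤G⇒star (cov-dyck c′ d) s

    star⇒≤G : ∀ {v w} → v ⟶* w → v ≤G[ m ] w
    star⇒≤G = gmap (λ w → w) cov⇒cover

    -- `A′ ++ 0^ j′` is the path with the inner factor deleted, and that factor sits before its last
    -- j′ letters; j′ alone records how far it has moved.
    record Inserted (A b : Word) (j : ℕ) (w : Word) : Set where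
      constructor inserted
      field
        {A′ b′}  : Word
        {j′}     : ℕ
        outer    : A ++ 0^ j ⟶* A′ ++ 0^ j′
        inner    : b ⟶* b′
        walk     : Walk 0 A′ j′
        grows    : j ≤ j′
        shape    : w ≡ A′ ++ b′ ++ 0^ j′

    -- The swapped Dyck factor r b 0^i contains all of b. Deleting b leaves the factor r 0^i, and
    -- the displaced down step lands behind b, whence the exponent i+k+1.
    push : ∀ p r {b} i k → Walk 0 (p ++ false ∷ r) (i ℕ.+ k) → Dyck b → Dyck (r ++ b ++ 0^ i) →
      Inserted (p ++ false ∷ r) b (i ℕ.+ k) (p ++ (r ++ b ++ 0^ i) ++ false ∷ 0^ k)
    push p r {b} i k wA db du with walk-split r du | walk-split p wA
    ... | g , wr , w₁ | suc a , wp , down wr′ with walk-split b w₁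
    ... | g′ , wb , w₂ = inserted outer ε (walk-++ wp (walk-lift 1 wr′)) (ℕ.n≤1+n j) shape
      where
      j = i ℕ.+ k
      g≡i : g ≡ i
      g≡i = trans (sym (ℕ.+-identityʳ g)) (trans (walk-from-0 db wb) (trans (walk-0^-height i w₂) (ℕ.+-identityʳ i)))
      0^-insert : 0^ i ++ false ∷ 0^ k ≡ 0^ (suc j)
      0^-insert = trans (0^-+ i (suc k)) (cong 0^ (ℕ.+-suc i k))
      dr : Dyck (r ++ 0^ i)
      dr = walk-pad (subst (Walk 0 r) g≡i wr)
      outer-target : p ++ (r ++ 0^ i) ++ false ∷ 0^ k ≡ (p ++ r) ++ 0^ (suc j)
      outer-target = trans (cong (p ++_) (trans (List.++-assoc r _ _) (cong (r ++_) 0^-insert))) (sym (List.++-assoc p r _))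
      outer-source : (p ++ false ∷ r) ++ 0^ j ≡ p ++ false ∷ (r ++ 0^ i) ++ 0^ k
      outer-source = trans (List.++-assoc p _ _) (cong (λ z → p ++ false ∷ z)
        (trans (cong (r ++_) (sym (0^-+ i k))) (sym (List.++-assoc r _ _))))
      outer : (p ++ false ∷ r) ++ 0^ j ⟶* (p ++ r) ++ 0^ (suc j)
      outer with r ++ 0^ i in r0≡ | dr
      -- If r 0^i is empty, the cover merely moves b across a down step and the outer path does not
      -- change.
      ... | [] | _ = subst ((p ++ false ∷ r) ++ 0^ j ⟶*_) (trans outer-source (trans (cong (λ z → p ++ false ∷ z ++ 0^ k) r0≡)
              (trans (cong (λ z → p ++ z ++ false ∷ 0^ k) (sym r0≡)) outer-target))) ε
      ... | z ∷ r0 | d = cov p (z ∷ r0) (0^ k) d (λ ()) (NoUp-0^ k)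
              (trans outer-source (cong (λ z → p ++ false ∷ z ++ 0^ k) r0≡))
              (trans (sym outer-target) (cong (λ z → p ++ z ++ false ∷ 0^ k) r0≡)) ◅ ε
      shape : p ++ (r ++ b ++ 0^ i) ++ false ∷ 0^ k ≡ (p ++ r) ++ b ++ 0^ (suc j)
      shape = trans (cong (p ++_) (trans (List.++-assoc r _ _) (cong (r ++_)
        (trans (List.++-assoc b _ _) (cong (b ++_) 0^-insert))))) (sym (List.++-assoc p r _))

    -- A cover inside b 0^j acts on b; any other cover acts on the path without b, and it pushes one
    -- more down step past b exactly when its Dyck factor contains the place where b is inserted.
    cov-inserted : ∀ {A b j w} → Walk 0 A j → Dyck b → b ≢ [] → A ++ b ++ 0^ j ⟶ w → Inserted A b j w
    cov-inserted {A} {b} {j} wA db b≢[] (cov p u s du u≢[] ns src refl) with ++-split A p src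
    cov-inserted {A} {b} {j} wA db b≢[] (cov p u s du u≢[] ns src refl) | inj₁ (q , refl , eq) with ++-split b q eq
    ... | inj₁ (e , _ , eq′) with 0^-split j e eq′
    ... | _ , suc k , _ , eq″ , _ with 0^-split k u (sym (List.∷-injectiveʳ eq″))
    ... | i , _ , u≡ , _ , _ = ⊥-elim (dyck-not-0^ i du u≢[] u≡)
    cov-inserted {A} {b} {j} wA db b≢[] (cov p u s du u≢[] ns src refl) | inj₁ (q , refl , eq) | inj₂ (x , e , refl , eq′)
      with List.∷-injective eq′
    ... | refl , eq″ with ++-split u e eq″
    ... | inj₁ (s₁ , refl , refl) = inserted ε (cov q u s₁ du u≢[] (NoUp-++ˡ s₁ ns) refl refl ◅ ε) wA ℕ.≤-refl
      (trans (List.++-assoc A q _) (cong (A ++_) (sym (trans (List.++-assoc q _ (0^ j)) (cong (q ++_) (List.++-assoc u _ (0^ j)))))))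
    -- The factor cannot run past b: at the end of b its own height is 0, and only down steps
    -- follow.
    ... | inj₂ (y , f , refl , eq‴) with 0^-split j (y ∷ f) eq‴ | walk-split q db | walk-split e du
    ... | suc i , k , refl , _ , _ | suc a , _ , down we | h , wu , wz with walk-from-0 wu we
    ... | a+h≡0 with ℕ.m+n≡0⇒n≡0 a a+h≡0 | walk-0^-height (suc i) wz
    ... | refl | ()
    cov-inserted {A} {b} {j} wA db b≢[] (cov p u s du u≢[] ns src refl) | inj₂ (x , r , refl , eq)
      with List.∷-injective eq
    ... | refl , eq₁ with ++-split u r eq₁
    ... | inj₁ ([] , refl , refl) = ⊥-elim (start b ns (dyck-head db b≢[]))
      where
      start : ∀ b → NoUp (b ++ 0^ j) → ∃[ b′ ] b ≡ true ∷ b′ → ⊥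
      start _ () (_ , refl)
    ... | inj₁ (true ∷ r′ , refl , refl) = ⊥-elim ns
    ... | inj₁ (false ∷ r′ , refl , refl) = inserted
      (cov p u (false ∷ r′ ++ 0^ j) du u≢[] tt
        (trans (List.++-assoc p _ (0^ j)) (cong (λ z → p ++ false ∷ z) (List.++-assoc u _ (0^ j)))) refl ◅ ε
        ◅◅ subst (p ++ u ++ false ∷ false ∷ r′ ++ 0^ j ⟶*_)
             (sym (trans (List.++-assoc p _ (0^ j)) (cong (p ++_) (List.++-assoc u _ (0^ j))))) ε)
      ε (swap-walk p du wA) ℕ.≤-refl
      (sym (trans (List.++-assoc p _ _) (cong (p ++_) (List.++-assoc u _ _))))
    ... | inj₂ (y , c , refl , eq₂) with ++-split b (y ∷ c) eq₂
    ... | inj₁ (e , c≡ , eq₃) with 0^-split j e eq₃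
    ... | i , k , refl , refl , refl = subst (λ z → Inserted (p ++ false ∷ r) b (i ℕ.+ k) (p ++ (r ++ z) ++ false ∷ 0^ k)) (sym c≡)
      (push p r i k wA db (subst (λ z → Dyck (r ++ z)) c≡ du))
    cov-inserted {A} {b} {j} wA db b≢[] (cov p u s du u≢[] ns src refl) | inj₂ (x , r , refl , eq) | refl , eq₁
      | inj₂ (y , c , refl , eq₂) | inj₂ (true , q , refl , refl) = ⊥-elim ns
    -- The factor cannot end inside b before a down step: b is above its starting level there, while
    -- the factor has returned to its base, which is no higher than that level.
    cov-inserted {A} {b} {j} wA db b≢[] (cov p u s du u≢[] ns src refl) | inj₂ (x , r , refl , eq) | refl , eq₁
      | inj₂ (y , c , refl , eq₂) | inj₂ (false , q , refl , refl) with walk-split r du | walk-split (y ∷ c) db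
    ... | g , _ , wc | suc g′ , wc′ , _ with ℕ.m+n≡0⇒n≡0 g (walk-from-0 wc′ wc)
    ... | ()

    star-inserted : ∀ {A b j w} → Walk 0 A j → Dyck b → b ≢ [] → A ++ b ++ 0^ j ⟶* w → Inserted A b j w
    star-inserted wA db b≢[] steps = go wA db b≢[] refl steps
      where
      go : ∀ {A b j v w} → Walk 0 A j → Dyck b → b ≢ [] → v ≡ A ++ b ++ 0^ j → v ⟶* w → Inserted A b j w
      go wA db b≢[] refl ε = inserted ε ε wA ℕ.≤-refl refl
      go wA db b≢[] refl (c ◅ steps) with cov-inserted wA db b≢[] c
      ... | inserted out inn wA′ j≤j′ sh with go wA′ (star-dyck inn db)
              (ones⇒≢[] (subst (1 ≤_) (star-ones inn) (dyck-ones db b≢[]))) sh steps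
      ... | inserted out′ inn′ wA″ j′≤j″ sh′ = inserted (out ◅◅ out′) (inn ◅◅ inn′) wA″ (ℕ.≤-trans j≤j′ j′≤j″) sh′

    cov-context : ∀ {b b′} A j → b ⟶ b′ → A ++ b ++ 0^ j ⟶ A ++ b′ ++ 0^ j
    cov-context A j (cov p u s du u≢[] ns refl refl) = cov (A ++ p) u (s ++ 0^ j) du u≢[] (NoUp-++-0^ s j ns)
      (trans (cong (A ++_) (trans (List.++-assoc p _ _) (cong (λ z → p ++ false ∷ z) (List.++-assoc u s _)))) (sym (List.++-assoc A p _)))
      (trans (cong (A ++_) (trans (List.++-assoc p _ _) (cong (p ++_) (List.++-assoc u _ _)))) (sym (List.++-assoc A p _)))

    -- Only zeros follow b, so b is itself the longest Dyck factor after the down step before it and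
    -- moves left past one zero at a time.
    slide : ∀ A {b} l j → Dyck b → b ≢ [] → (A ++ 0^ l) ++ b ++ 0^ j ⟶* A ++ b ++ 0^ (l ℕ.+ j)
    slide A {b} zero    j db b≢[] = subst (_⟶* A ++ b ++ 0^ j) (cong (_++ b ++ 0^ j) (sym (List.++-identityʳ A))) ε
    slide A {b} (suc l) j db b≢[] = cov (A ++ 0^ l) b (0^ j) db b≢[] (NoUp-0^ j)
        (trans (cong (_++ b ++ 0^ j) (trans (cong (A ++_) (sym (0^-∷ l))) (sym (List.++-assoc A (0^ l) _)))) (List.++-assoc (A ++ 0^ l) _ _))
        refl
      ◅ subst ((A ++ 0^ l) ++ b ++ 0^ (suc j) ⟶*_) (cong (λ z → A ++ b ++ 0^ z) (ℕ.+-suc l j)) (slide A l (suc j) db b≢[])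

    -- After any down step but a final one, the rest of A goes below the level reached. So no Dyck
    -- factor following a down step of A reaches the end of A, and none can swallow a path inserted
    -- there.
    Tight : Word → Set
    Tight A = ∀ p q g → A ≡ p ++ false ∷ q → q ≢ [] → ¬ Walk 0 q g

    ++-≢[] : ∀ p {q : Word} → q ≢ [] → p ++ q ≢ []
    ++-≢[] []      q≢[] = q≢[]
    ++-≢[] (_ ∷ _) _ ()

    record Lifted (A : Word) (j : ℕ) (a : Word) : Set where
      constructor lifted
      field
        {A′}   : Word
        shape  : a ≡ A′ ++ 0^ j
        tight  : Tight A′
        walk   : Walk 0 A′ j
        lift   : ∀ {b} → Dyck b → b ≢ [] → A ++ b ++ 0^ j ⟶ A′ ++ b ++ 0^ j

    -- Consider a suffix after a down step. Starting no earlier than r, it is a suffix of the old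
    -- word; starting within u or right behind it, it drops below once u is over; starting before u,
    -- it may read u one level lower, since two down steps follow u.
    tight-swap : ∀ p {u} r → Dyck u → Tight (p ++ false ∷ u ++ false ∷ r) → Tight (p ++ u ++ false ∷ false ∷ r)
    tight-swap p {u} r du tA p₁ q g eq q≢[] wq with ++-split p p₁ eq
    ... | inj₁ (e , refl , eq₁) with ++-split u e eq₁
    tight-swap p {u} r du tA p₁ q g eq q≢[] wq | inj₁ (e , refl , eq₁) | inj₁ ([] , _ , eq₂) with List.∷-injectiveʳ eq₂ | wq
    ... | refl | ()
    tight-swap p {u} r du tA p₁ q g eq q≢[] wq | inj₁ (e , refl , eq₁) | inj₁ (x ∷ f , _ , eq₂) = tA (p ++ false ∷ u ++ f) q g
      (trans (cong (λ z → p ++ false ∷ u ++ z) (List.∷-injectiveʳ eq₂))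
        (trans (cong (λ z → p ++ false ∷ z) (sym (List.++-assoc u f _))) (sym (List.++-assoc p _ _)))) q≢[] wq
    tight-swap p {u} r du tA p₁ q g eq q≢[] wq | inj₁ (e , refl , eq₁) | inj₂ (x , f , refl , eq₂) with List.∷-injective eq₂
    ... | refl , refl with walk-split e du | walk-split f wq
    ... | suc g₀ , _ , down wf′ | suc h , wf , _ with ℕ.m+n≡0⇒n≡0 g₀ (walk-from-0 wf wf′)
    ... | ()
    tight-swap p {u} r du tA p₁ q g eq q≢[] wq | inj₂ (x , e , refl , eq₁) with List.∷-injective eq₁
    ... | refl , refl = tA p₁ (e ++ false ∷ u ++ false ∷ r) g (List.++-assoc p₁ _ _) (++-≢[] e (λ ())) (unswap e wq)
      where
      unswap : ∀ e {a c} → Walk a (e ++ u ++ false ∷ false ∷ r) c → Walk a (e ++ false ∷ u ++ false ∷ r) c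
      unswap e w with walk-split e w
      ... | h , we , w₁ with walk-split u w₁
      ... | h′ , wu , w₂ with trans (sym (ℕ.+-identityʳ h)) (walk-from-0 du wu)
      unswap e w | suc h , we , w₁ | _ , wu , down w₂ | refl = walk-++ we (down (walk-++ (dyck-lift h du) w₂))

    -- By tightness the Dyck factor ends before a down step of A. Hence the last j letters are
    -- untouched, and the cover remains one when b is put in behind A.
    cov-lifted : ∀ {A j a} → Tight A → Walk 0 A j → A ++ 0^ j ⟶ a → Lifted A j a
    cov-lifted {A} {j} tA wA (cov p u s du u≢[] ns src refl) with ++-split A p src
    ... | inj₁ (q , _ , eq) with 0^-split j q eq
    ... | _ , suc k , _ , eq′ , _ with 0^-split k u (sym (List.∷-injectiveʳ eq′))
    ... | i , _ , u≡ , _ , _ = ⊥-elim (dyck-not-0^ i du u≢[] u≡)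
    cov-lifted {A} {j} tA wA (cov p u s du u≢[] ns src refl) | inj₂ (x , r , refl , eq) with List.∷-injective eq
    ... | refl , eq₁ with ++-split u r eq₁
    ... | inj₁ ([] , refl , _) = ⊥-elim (tA p (u ++ []) 0 refl (λ e → u≢[] (trans (sym (List.++-identityʳ u)) e))
            (subst Dyck (sym (List.++-identityʳ u)) du))
    ... | inj₁ (true ∷ r′ , refl , refl) = ⊥-elim ns
    ... | inj₁ (false ∷ r′ , refl , refl) = lifted
      (sym (trans (List.++-assoc p _ _) (cong (p ++_) (List.++-assoc u _ _))))
      (tight-swap p r′ du tA)
      (swap-walk p du wA)
      (λ {b} _ _ → cov p u (false ∷ r′ ++ b ++ 0^ j) du u≢[] tt
        (trans (List.++-assoc p _ _) (cong (λ z → p ++ false ∷ z) (List.++-assoc u _ _)))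
        (trans (List.++-assoc p _ _) (cong (p ++_) (List.++-assoc u _ _))))
    cov-lifted {A} {j} tA wA (cov p u s du u≢[] ns src refl) | inj₂ (x , r , refl , eq) | refl , eq₁
      | inj₂ (y , e , refl , eq₂) with 0^-split j (y ∷ e) eq₂
    cov-lifted {A} {j} tA wA (cov p u s du u≢[] ns src refl) | inj₂ (x , [] , refl , eq) | refl , eq₁
      | inj₂ (y , e , refl , eq₂) | i , _ , u≡ , _ , _ = ⊥-elim (dyck-not-0^ i du u≢[] u≡)
    cov-lifted {A} {j} tA wA (cov p u s du u≢[] ns src refl) | inj₂ (x , r@(_ ∷ _) , refl , eq) | refl , eq₁
      | inj₂ (y , e , refl , eq₂) | i , _ , _ , _ , _ with walk-split r du
    ... | g , wr , _ = ⊥-elim (tA p r g refl (λ ()) wr)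

    star-lifted : ∀ {A j a} → Tight A → Walk 0 A j → A ++ 0^ j ⟶* a →
      ∃[ A′ ] (a ≡ A′ ++ 0^ j × (∀ {b} → Dyck b → b ≢ [] → A ++ b ++ 0^ j ⟶* A′ ++ b ++ 0^ j))
    star-lifted tA wA steps = go tA wA refl steps
      where
      go : ∀ {A j v a} → Tight A → Walk 0 A j → v ≡ A ++ 0^ j → v ⟶* a →
        ∃[ A′ ] (a ≡ A′ ++ 0^ j × (∀ {b} → Dyck b → b ≢ [] → A ++ b ++ 0^ j ⟶* A′ ++ b ++ 0^ j))
      go tA wA refl ε = _ , refl , λ _ _ → ε
      go tA wA refl (c ◅ steps) with cov-lifted tA wA c
      ... | lifted sh tA′ wA′ l with go tA′ wA′ sh steps
      ... | A″ , sh″ , l″ = A″ , sh″ , λ db b≢[] → l db b≢[] ◅ l″ db b≢[]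

    -- Three stages: the outer moves are lifted with b in its original place, reaching A″ b 0^j with
    -- A″ = A′ 0^(j′-j); then b is moved to b′; then b′ slides left across the surplus zeros.
    inserted-star : ∀ {A A′ b b′ j j′} → Tight A → Walk 0 A j → Dyck b → b ≢ [] → j ≤ j′ →
      A ++ 0^ j ⟶* A′ ++ 0^ j′ → b ⟶* b′ → A ++ b ++ 0^ j ⟶* A′ ++ b′ ++ 0^ j′
    inserted-star {A} {A′} {b} {b′} {j} {j′} tA wA db b≢[] j≤j′ out inn with star-lifted tA wA out
    ... | A″ , sh , l = l db b≢[] ◅◅ gmap (λ z → A″ ++ z ++ 0^ j) (cov-context A″ j) inn ◅◅
        subst₂ (λ y z → y ++ b′ ++ 0^ j ⟶* A′ ++ b′ ++ 0^ z) (sym A″≡) (ℕ.m∸n+n≡m j≤j′)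
          (slide A′ (j′ ∸ j) j (star-dyck inn db) (ones⇒≢[] (subst (1 ≤_) (star-ones inn) (dyck-ones db b≢[]))))
      where
      A″≡ : A″ ≡ A′ ++ 0^ (j′ ∸ j)
      A″≡ = List.++-cancelʳ (0^ j) _ _ (trans (sym sh) (trans (cong (λ z → A′ ++ 0^ z) (sym (ℕ.m∸n+n≡m j≤j′)))
        (trans (cong (A′ ++_) (sym (0^-+ (j′ ∸ j) j))) (sym (List.++-assoc A′ _ _)))))

    -- Frame i A: A = 1 v₁ 0 v₂ 0 ⋯ vᵢ 0, the part of D(v₁, …, vᵢ, b, ∅, …, ∅) preceding b.
    data Frame : ℕ → Word → Set where
      base : Frame 0 [ true ]
      snoc : ∀ {i A b} → Frame i A → Dyck b → Frame (suc i) (A ++ b ++ [ false ])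

    -- The closing 0 of a frame goes below every earlier down step whose continuation has not done
    -- so already.
    frame-tight : ∀ {i A} → Frame i A → Tight A
    frame-tight base [] q g () _ _
    frame-tight base (_ ∷ []) q g () _ _
    frame-tight base (_ ∷ _ ∷ _) q g () _ _
    frame-tight (snoc {A = A} {b} f db) p q g eq q≢[] wq with ++-split A p eq
    frame-tight (snoc {A = A} {b} f db) p q g eq q≢[] wq | inj₁ (e , refl , eq₁) with ++-split b e eq₁
    ... | inj₁ ([] , _ , eq₂) = q≢[] (sym (List.∷-injectiveʳ eq₂))
    ... | inj₁ (_ ∷ [] , _ , ())
    ... | inj₁ (_ ∷ _ ∷ _ , _ , ())
    ... | inj₂ (x , z , refl , eq₂) with List.∷-injective eq₂
    ... | refl , refl with walk-split e db | walk-split z wq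
    ... | suc a , _ , down wz′ | suc h , wz , _ with ℕ.m+n≡0⇒n≡0 a (walk-from-0 wz wz′)
    ... | ()
    frame-tight (snoc {A = A} {b} f db) p q g eq q≢[] wq | inj₂ (x , e , refl , eq₁) with List.∷-injective eq₁
    ... | refl , refl with walk-split e wq
    ... | h , we , w₁ with walk-split b w₁
    ... | h′ , wb , w₂ with trans (sym (ℕ.+-identityʳ h)) (walk-from-0 db wb)
    frame-tight (snoc f db) p q g eq q≢[] wq | inj₂ (x , [] , refl , eq₁) | refl , refl | _ , [] , w₁ | _ , wb , () | refl
    frame-tight (snoc f db) p q g eq q≢[] wq | inj₂ (x , e@(_ ∷ _) , refl , eq₁) | refl , refl | h , we , w₁ | h′ , wb , w₂ | refl =
      frame-tight f p e h refl (λ ()) we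

    frame-walk : ∀ {i A} → Frame i A → i ≤ m → Walk 0 A (m ∸ i)
    frame-walk base _ = up (subst (λ a → Walk a [] m) (sym (ℕ.+-identityʳ m)) [])
    frame-walk {suc i} (snoc f db) i<m = walk-++ (frame-walk f (ℕ.<⇒≤ i<m))
      (walk-++ (dyck-lift _ db) (subst (λ a → Walk a [ false ] (m ∸ suc i)) (sym m∸i) (down [])))
      where
      m∸i : m ∸ i ≡ suc (m ∸ suc i)
      m∸i = ℕ.+-∸-assoc 1 i<m

    frame-ones : ∀ {i A} → Frame i A → 1 ≤ ones A
    frame-ones base = s≤s z≤n
    frame-ones (snoc {A = A} {b} f _) = ℕ.≤-trans (frame-ones f) (subst (ones A ≤_) (sym (ones-++ A _)) (ℕ.m≤m+n _ _))

    -- For positive i the shorter frame ends with a down step, so a nonempty y would violate the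
    -- tightness of the longer one.
    frame-maximal : ∀ {i A y g} → Frame i A → Frame i (A ++ y) → Walk 0 y g → y ≡ []
    frame-maximal {y = []} _ _ _ = refl
    frame-maximal {y = x ∷ y} f f′ w = ⊥-elim (go f f′ refl w)
      where
      go : ∀ {i A A′ g} → Frame i A → Frame i A′ → A′ ≡ A ++ x ∷ y → ¬ Walk 0 (x ∷ y) g
      go base base () w
      go (snoc {A = A} {b} f db) f′@(snoc _ _) eq w = frame-tight f′ (A ++ b) (x ∷ y) _
        (trans eq (trans (List.++-assoc A _ _) (trans (cong (A ++_) (List.++-assoc b _ _)) (sym (List.++-assoc A b _))))) (λ ()) w

    -- If the cuts differed, the letters between them would begin a Dyck path and extend one frame
    -- to another with the same i.
    frame-unique : ∀ {i A₁ A₂ b₁ b₂} → Frame i A₁ → Frame i A₂ → Dyck b₁ → Dyck b₂ → A₁ ++ b₁ ≡ A₂ ++ b₂ → A₁ ≡ A₂ × b₁ ≡ b₂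
    frame-unique {A₁ = A₁} {A₂} {b₁} {b₂} f₁ f₂ d₁ d₂ eq with ++-split A₁ A₂ eq
    ... | inj₁ (e , refl , refl) with frame-maximal {y = e} f₁ f₂ (proj₁ (proj₂ (walk-split e d₁)))
    ... | refl = sym (List.++-identityʳ A₁) , refl
    frame-unique {A₁ = A₁} {A₂} {b₁} {b₂} f₁ f₂ d₁ d₂ eq | inj₂ (x , e , refl , refl)
      with frame-maximal {y = x ∷ e} f₂ f₁ (proj₁ (proj₂ (walk-split (x ∷ e) d₂)))
    ... | ()

    -- V i v: the path v is D(v₁, …, vᵢ, ∅, …, ∅) for some Dyck paths v₁, …, vᵢ.
    V : ℕ → Word → Set
    V zero    v = v ≡ true ∷ 0^ m
    V (suc i) v = ∃[ A ] ∃[ b ] (Frame i A × Dyck b × v ≡ A ++ b ++ 0^ (m ∸ i))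

    V⇒frame : ∀ {i v} → i ≤ m → V i v → ∃[ A ] (Frame i A × v ≡ A ++ 0^ (m ∸ i))
    V⇒frame {zero}  _   refl = [ true ] , base , refl
    V⇒frame {suc i} i<m (A , b , f , db , refl) = A ++ b ++ [ false ] , snoc f db ,
      trans (cong (λ z → A ++ b ++ 0^ z) (ℕ.+-∸-assoc 1 i<m))
        (sym (trans (List.++-assoc A _ _) (cong (A ++_) (List.++-assoc b _ _))))

    frame⇒V : ∀ {i A} → i ≤ m → Frame i A → V i (A ++ 0^ (m ∸ i))
    frame⇒V _ base = refl
    frame⇒V {suc i} i<m (snoc {A = A} {b} f db) = A , b , f , db ,
      sym (trans (cong (λ z → A ++ b ++ 0^ z) (ℕ.+-∸-assoc 1 i<m))
        (sym (trans (List.++-assoc A _ _) (cong (A ++_) (List.++-assoc b _ _)))))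

    V-dyck : ∀ {i v} → i ≤ suc m → V i v → Dyck v
    V-dyck {zero} _ refl = walk-pad (frame-walk base z≤n)
    V-dyck {suc i} (s≤s i≤m) (A , b , f , db , refl) = walk-++ (frame-walk f i≤m)
      (walk-++ (dyck-lift _ db) (subst (λ a → Walk a (0^ (m ∸ i)) 0) (ℕ.+-identityʳ _) (walk-0^ (m ∸ i))))

    -- After its first up step the path descends from height m; cutting at the first passage below
    -- each of the levels m, ..., 1 yields the m+1 arguments of D.
    V-total : ∀ {v} → Dyck v → v ≢ [] → V (suc m) v
    V-total {v} dv v≢[] with dyck-head dv v≢[]
    V-total (up {w = y} w) _ | _ , refl = go m base refl (subst (λ a → Walk a y 0) (ℕ.+-identityʳ m) w)
      where
      go : ∀ l {i A y} → Frame i A → i ℕ.+ l ≡ m → Walk l y 0 → V (suc m) (A ++ y)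
      go zero {i} {A} {y} f eq w with trans (sym (ℕ.+-identityʳ i)) eq
      ... | refl = A , y , f , w , cong (A ++_) (sym (trans (cong (λ z → y ++ 0^ z) (ℕ.n∸n≡0 m)) (List.++-identityʳ y)))
      go (suc l) {i} {A} f eq w with first-passage 0 w
      ... | d , y′ , refl , wd , w′ = subst (V (suc m)) (trans (List.++-assoc A _ _) (cong (A ++_) (List.++-assoc d _ _)))
        (go l (snoc f wd) (trans (sym (ℕ.+-suc i l)) eq) w′)

-- Final descents, arguments of D and unique factorisation

module Decompositions where
  open DyckWords
  open import Defs
  open import Data.Bool using (true; false)
  open import Data.List using (List; []; _∷_; _++_; length; reverse; concat; map; replicate; [_]; take)
  import Data.List.Properties as List
  open import Data.List.Relation.Unary.All as All using (All; []; _∷_)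
  import Data.List.Relation.Unary.All.Properties as All
  open import Data.Product using (_,_; _×_; ∃-syntax)
  open import Data.Sum using (inj₁; inj₂)
  open import Data.Empty using (⊥-elim)
  open import Relation.Binary.PropositionalEquality hiding ([_])

  finalDescent-∷ʳ : ∀ w → finalDescent (w ++ [ false ]) ≡ suc (finalDescent w)
  finalDescent-∷ʳ w = cong lead0 (List.reverse-++ w [ false ])

  finalDescent-pad : ∀ w j → finalDescent (w ++ 0^ j) ≡ j ℕ.+ finalDescent w
  finalDescent-pad w zero    = cong finalDescent (List.++-identityʳ w)
  finalDescent-pad w (suc j) = trans (cong finalDescent (trans (cong (w ++_) (sym (0^-∷ j))) (sym (List.++-assoc w _ _))))
    (trans (finalDescent-∷ʳ (w ++ 0^ j)) (cong suc (finalDescent-pad w j)))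

  ones-reverse : ∀ w → ones (reverse w) ≡ ones w
  ones-reverse []      = refl
  ones-reverse (x ∷ w) = trans (cong ones (List.unfold-reverse x w)) (trans (ones-++ (reverse w) [ x ])
    (trans (ℕ.+-comm _ (ones [ x ])) (trans (cong (ones [ x ] ℕ.+_) (ones-reverse w)) (sym (ones-++ [ x ] w)))))

  lead0-++ : ∀ y z → 1 ≤ ones y → lead0 (y ++ z) ≡ lead0 y
  lead0-++ (true ∷ y)  z _ = refl
  lead0-++ (false ∷ y) z o = cong suc (lead0-++ y z o)

  finalDescent-++ : ∀ A b → 1 ≤ ones b → finalDescent (A ++ b) ≡ finalDescent b
  finalDescent-++ A b o = trans (cong lead0 (List.reverse-++ A b))
    (lead0-++ (reverse b) (reverse A) (subst (1 ≤_) (sym (ones-reverse b)) o))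

  finalDescent-inserted : ∀ A b j → 1 ≤ ones b → finalDescent (A ++ b ++ 0^ j) ≡ finalDescent b ℕ.+ j
  finalDescent-inserted A b j o = trans (cong finalDescent (sym (List.++-assoc A b _)))
    (trans (finalDescent-pad (A ++ b) j) (trans (cong (j ℕ.+_) (finalDescent-++ A b o)) (ℕ.+-comm j _)))

  lead0-take : ∀ j y → j ≤ lead0 y → ∃[ z ] y ≡ 0^ j ++ z
  lead0-take zero    y           _       = y , refl
  lead0-take (suc j) (false ∷ y) (s≤s l) with lead0-take j y l
  ... | z , refl = z , refl

  reverse-0^ : ∀ j → reverse (0^ j) ≡ 0^ j
  reverse-0^ zero    = refl
  reverse-0^ (suc j) = trans (List.unfold-reverse false (0^ j)) (trans (cong (_++ [ false ]) (reverse-0^ j)) (0^-∷ j))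

  finalDescent-take : ∀ j w → j ≤ finalDescent w → ∃[ A ] w ≡ A ++ 0^ j
  finalDescent-take j w l with lead0-take j (reverse w) l
  ... | z , eq = reverse z , trans (sym (List.reverse-involutive w)) (trans (cong reverse eq)
    (trans (List.reverse-++ (0^ j) z) (cong (reverse z ++_) (reverse-0^ j))))

  strip : ℕ → Word → Word
  strip j w = take (length w ∸ j) w

  take-length : ∀ (A B : Word) → take (length A) (A ++ B) ≡ A
  take-length []      B = refl
  take-length (x ∷ A) B = cong (x ∷_) (take-length A B)

  strip-pad : ∀ A j → strip j (A ++ 0^ j) ≡ A
  strip-pad A j = trans (cong (λ n → take n (A ++ 0^ j)) (trans (cong (_∸ j)
    (trans (List.length-++ A) (cong (length A ℕ.+_) (List.length-replicate j)))) (ℕ.m+n∸n≡m (length A) j))) (take-length A _)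

  -- Here A is represented by the whole path A 0^j, so extensions can be recorded by intervals.
  insert : ℕ → Word → Word → Word
  insert j a b = strip j a ++ b ++ 0^ j

  insert-pad : ∀ A b j → insert j (A ++ 0^ j) b ≡ A ++ b ++ 0^ j
  insert-pad A b j = cong (_++ b ++ 0^ j) (strip-pad A j)

  tails : List Word → Word
  tails ws = concat (map (false ∷_) ws)

  tails-empty : ∀ r → tails (replicate r []) ≡ 0^ r
  tails-empty zero    = refl
  tails-empty (suc r) = cong (false ∷_) (tails-empty r)

  module Arguments (m : ℕ) where
    open Greedy m

    -- The arguments are absorbed into the frame one by one; the r trailing empty ones become the
    -- block of zeros.
    frame-tails⇒V : ∀ {i A b} ws r → Frame i A → Dyck b → All (IsDyckAny m) ws → i ℕ.+ (length ws ℕ.+ r) ≡ m →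
      V (suc (i ℕ.+ length ws)) (A ++ b ++ tails (ws ++ replicate r []))
    frame-tails⇒V {i} {A} {b} [] r f db [] refl = subst (λ k → V (suc k) (A ++ b ++ tails (replicate r []))) (sym (ℕ.+-identityʳ i))
      (A , b , f , db , cong (λ z → A ++ b ++ z) (trans (tails-empty r) (cong 0^ (sym (ℕ.m+n∸m≡n i r)))))
    frame-tails⇒V {i} {A} {b} (w ∷ ws) r f db ((_ , dw) ∷ dws) eq = subst₂ V (cong suc (sym (ℕ.+-suc i (length ws))))
      (trans (List.++-assoc A _ _) (cong (A ++_) (trans (List.++-assoc b _ _) refl)))
      (frame-tails⇒V ws r (snoc f db) (IsDyck⇒Dyck dw) dws (trans (sym (ℕ.+-suc i _)) eq))

    Arguments : ℕ → Word → Set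
    Arguments i v = ∃[ vs ] (length vs ≡ i × All (IsDyckAny m) vs × v ≡ D (vs ++ replicate (suc m ∸ i) []))

    arguments⇒V : ∀ {i v} → i ≤ suc m → Arguments i v → V i v
    arguments⇒V _         ([] , refl , [] , refl) = cong (true ∷_) (tails-empty m)
    arguments⇒V (s≤s i≤m) (w ∷ ws , refl , (_ , dw) ∷ dws , refl) =
      frame-tails⇒V ws (m ∸ length ws) base (IsDyck⇒Dyck dw) dws (ℕ.m+[n∸m]≡n i≤m)

    frame⇒D : ∀ {i A} → Frame i A → ∃[ vs ] (length vs ≡ i × All (IsDyckAny m) vs × (∀ b ws → A ++ b ++ tails ws ≡ D (vs ++ b ∷ ws)))
    frame⇒D base = [] , refl , [] , λ b ws → refl
    frame⇒D (snoc {A = A} {b₀} f db) with frame⇒D f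
    ... | vs , len , all , eq = vs ++ [ b₀ ] , trans (List.length-++ vs) (trans (ℕ.+-comm _ 1) (cong suc len)) ,
      All.++⁺ all ((_ , Dyck⇒IsDyck db) ∷ []) , λ b ws → trans (List.++-assoc A _ _) (trans (cong (A ++_) (List.++-assoc b₀ _ _))
        (trans (eq b₀ (b ∷ ws)) (cong D (sym (List.++-assoc vs _ _)))))

    V⇒arguments : ∀ {i v} → V i v → Arguments i v
    V⇒arguments {zero} refl = [] , refl , [] , cong (true ∷_) (sym (tails-empty m))
    V⇒arguments {suc i} (A , b , f , db , refl) with frame⇒D f
    ... | vs , len , all , eq = vs ++ [ b ] , trans (List.length-++ vs) (trans (ℕ.+-comm _ 1) (cong suc len)) ,
      All.++⁺ all ((_ , Dyck⇒IsDyck db) ∷ []) ,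
      trans (cong (λ z → A ++ b ++ z) (sym (tails-empty (m ∸ i)))) (trans (eq b _) (cong D (sym (List.++-assoc vs _ _))))

    V-≢[] : ∀ {i v} → V i v → 1 ≤ ones v
    V-≢[] {zero} refl = s≤s z≤n
    V-≢[] {suc i} (A , b , f , _ , refl) = ℕ.≤-trans (frame-ones f) (subst (ones A ≤_) (sym (ones-++ A _)) (ℕ.m≤m+n _ _))

    dyck-length : ∀ {w} → Dyck w → length w ≡ ones w ℕ.+ m ℕ.* ones w
    dyck-length {w} d = trans (length-letters w) (cong (ones w ℕ.+_) (walk-count d))
      where
      length-letters : ∀ w → length w ≡ ones w ℕ.+ zeros w
      length-letters []          = refl
      length-letters (true ∷ w)  = cong suc (length-letters w)
      length-letters (false ∷ w) = trans (cong suc (length-letters w)) (sym (ℕ.+-suc _ _))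

    -- If the two Dyck factors were displaced, their overlap would lead from 0 to h in one and from
    -- g to 0 in the other. So g + h = 0, which forces l = 0, and then the lengths disagree.
    suffix-unique-≤ : ∀ {A₁ A₂ b₁ b₂} l → Dyck b₁ → Dyck b₂ → 1 ≤ ones b₁ → length b₁ ≡ length b₂ →
      A₁ ++ b₁ ≡ A₂ ++ b₂ ++ 0^ l → A₁ ≡ A₂ × b₁ ≡ b₂ × l ≡ 0
    suffix-unique-≤ {A₁} {A₂} {b₁} {b₂} l d₁ d₂ o₁ len eq with ++-split A₁ A₂ eq
    ... | inj₁ (e , refl , refl) with len-e | len-l
      where
      len′ : (length e ℕ.+ l) ℕ.+ length b₂ ≡ 0 ℕ.+ length b₂
      len′ = trans (ℕ.+-assoc (length e) l _) (trans (cong (length e ℕ.+_) (ℕ.+-comm l _))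
        (trans (sym (trans (List.length-++ e) (cong (length e ℕ.+_) (trans (List.length-++ b₂) (cong (length b₂ ℕ.+_) (List.length-replicate l)))))) len))
      sum≡0 : length e ℕ.+ l ≡ 0
      sum≡0 = ℕ.+-cancelʳ-≡ (length b₂) _ 0 len′
      len-e : length e ≡ 0
      len-e = ℕ.m+n≡0⇒m≡0 (length e) sum≡0
      len-l : l ≡ 0
      len-l = ℕ.m+n≡0⇒n≡0 (length e) sum≡0
    suffix-unique-≤ {A₁} {A₂} {b₁} {b₂} l d₁ d₂ o₁ len eq | inj₁ ([] , refl , refl) | _ | refl =
      sym (List.++-identityʳ A₁) , List.++-identityʳ b₂ , refl
    suffix-unique-≤ {A₁} {A₂} {b₁} {b₂} l d₁ d₂ o₁ len eq | inj₂ (x , e , refl , eq₁) with ++-split b₂ (x ∷ e) eq₁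
    ... | inj₁ (f , _ , eq₂) with 0^-split l f eq₂
    ... | _ , k , _ , refl , _ = ⊥-elim (ones⇒≢[] o₁ (zero-ones k o₁))
      where
      zero-ones : ∀ k → 1 ≤ ones (0^ k) → 0^ k ≡ []
      zero-ones (suc k) o = ⊥-elim (ℕ.<⇒≢ o (sym (ones-0^ k)))
    suffix-unique-≤ {A₁} {A₂} {b₁} {b₂} l d₁ d₂ o₁ len eq | inj₂ (x , e , refl , eq₁) | inj₂ (z , f , refl , refl)
      with walk-split (x ∷ e) d₂ | walk-split (z ∷ f) d₁
    ... | g , _ , wf | h , wf′ , w0 with trans (ℕ.+-comm h g) (walk-from-0 wf′ wf)
    ... | h+g≡0 with ℕ.m+n≡0⇒m≡0 h h+g≡0
    ... | refl with ℕ.m+n≡0⇒m≡0 l (sym (walk-0^-height l w0))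
    ... | refl = ⊥-elim (ℕ.m≢1+n+m (length (z ∷ f)) (trans (sym (cong length (List.++-identityʳ (z ∷ f)))) (trans len (List.length-++ (x ∷ e)))))

    suffix-unique-ordered : ∀ {A₁ A₂ b₁ b₂ j₁ j₂} → j₁ ≤ j₂ → Dyck b₁ → Dyck b₂ → 1 ≤ ones b₁ → ones b₁ ≡ ones b₂ →
      A₁ ++ b₁ ++ 0^ j₁ ≡ A₂ ++ b₂ ++ 0^ j₂ → A₁ ≡ A₂ × b₁ ≡ b₂ × j₁ ≡ j₂
    suffix-unique-ordered {A₁} {A₂} {b₁} {b₂} {j₁} {j₂} j₁≤j₂ d₁ d₂ o₁ oeq eq =
      let A≡ , b≡ , l≡0 = suffix-unique-≤ {A₁} {A₂} {b₁} {b₂} (j₂ ∸ j₁) d₁ d₂ o₁ len cancel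
      in A≡ , b≡ , ℕ.≤-antisym j₁≤j₂ (ℕ.m∸n≡0⇒m≤n l≡0)
      where
      len : length b₁ ≡ length b₂
      len = trans (dyck-length d₁) (trans (cong (λ n → n ℕ.+ m ℕ.* n) oeq) (sym (dyck-length d₂)))
      cancel : A₁ ++ b₁ ≡ A₂ ++ b₂ ++ 0^ (j₂ ∸ j₁)
      cancel = List.++-cancelʳ (0^ j₁) _ _ (trans (List.++-assoc A₁ b₁ _) (trans eq
        (trans (cong (λ z → A₂ ++ b₂ ++ z) (trans (cong 0^ (sym (ℕ.m∸n+n≡m j₁≤j₂))) (sym (0^-+ (j₂ ∸ j₁) j₁))))
          (sym (trans (List.++-assoc A₂ _ _) (cong (A₂ ++_) (List.++-assoc b₂ _ _)))))))

    suffix-unique : ∀ {A₁ A₂ b₁ b₂ j₁ j₂} → Dyck b₁ → Dyck b₂ → 1 ≤ ones b₁ → ones b₁ ≡ ones b₂ →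
      A₁ ++ b₁ ++ 0^ j₁ ≡ A₂ ++ b₂ ++ 0^ j₂ → A₁ ≡ A₂ × b₁ ≡ b₂ × j₁ ≡ j₂
    suffix-unique {j₁ = j₁} {j₂} d₁ d₂ o₁ oeq eq with ℕ.≤-total j₁ j₂
    ... | inj₁ j₁≤j₂ = suffix-unique-ordered j₁≤j₂ d₁ d₂ o₁ oeq eq
    ... | inj₂ j₂≤j₁ = let A≡ , b≡ , j≡ = suffix-unique-ordered j₂≤j₁ d₂ d₁ (subst (1 ≤_) oeq o₁) (sym oeq) (sym eq)
                       in sym A≡ , sym b≡ , sym j≡

-- Lists enumerating the intervals

module IntervalEnumeration where
  open DyckWords
  open Decompositions
  open import Defs
  open import Data.Bool using (true)
  open import Data.List using (List; []; _∷_; _++_; length; map; filter; [_])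
  import Data.List.Properties as List
  open import Data.List.Membership.Propositional using (_∈_)
  open import Data.List.Membership.Propositional.Properties
  open import Data.List.Relation.Unary.Any using (here; there)
  open import Data.List.Relation.Unary.All as All using ([]; _∷_)
  import Data.List.Relation.Unary.All.Properties as All
  open import Data.List.Relation.Unary.AllPairs using ([]; _∷_)
  open import Data.List.Relation.Unary.Unique.Propositional using (Unique)
  import Data.List.Relation.Unary.Unique.Propositional.Properties as Unique
  open import Data.Product using (_,_; _×_; ∃-syntax; proj₁; proj₂)
  import Data.Product.Properties as Product
  open import Data.Sum using (_⊎_; inj₁; inj₂)
  open import Data.Empty using (⊥; ⊥-elim)
  open import Relation.Nullary using (¬_)
  open import Relation.Binary.PropositionalEquality hiding ([_])
  open import Relation.Binary.Construct.Closure.ReflexiveTransitive using (ε; _◅_)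

  map-unique : ∀ {A B : Set} {f : A → B} {xs} → (∀ {x y} → x ∈ xs → y ∈ xs → f x ≡ f y → x ≡ y) →
    Unique xs → Unique (map f xs)
  map-unique inj []           = []
  map-unique inj (x∉xs ∷ uxs) =
    All.map⁺ (All.tabulate λ y∈xs fx≡fy → All.lookup x∉xs y∈xs (inj (here refl) (there y∈xs) fx≡fy))
    ∷ map-unique (λ p q → inj (there p) (there q)) uxs

  unique-⊆-length : ∀ {A : Set} {xs ys : List A} → Unique xs → (∀ {x} → x ∈ xs → x ∈ ys) → length xs ≤ length ys
  unique-⊆-length []           _   = z≤n
  unique-⊆-length {xs = x ∷ xs} (x∉xs ∷ uxs) sub with ∈-∃++ (sub (here refl))
  ... | ys , zs , refl = subst (suc (length xs) ≤_)
      (trans (cong suc (List.length-++ ys)) (trans (sym (ℕ.+-suc (length ys) (length zs))) (sym (List.length-++ ys))))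
      (s≤s (unique-⊆-length uxs sub′))
    where
    sub′ : ∀ {y} → y ∈ xs → y ∈ ys ++ zs
    sub′ y∈xs with ∈-++⁻ ys (sub (there y∈xs))
    ... | inj₁ y∈ys         = ∈-++⁺ˡ y∈ys
    ... | inj₂ (here refl)  = ⊥-elim (All.lookup x∉xs y∈xs refl)
    ... | inj₂ (there y∈zs) = ∈-++⁺ʳ ys y∈zs

  record Enumerates {A : Set} (xs : List A) (P : A → Set) : Set where
    field
      unique   : Unique xs
      sound    : ∀ {x} → x ∈ xs → P x
      complete : ∀ {x} → P x → x ∈ xs
  open Enumerates public

  -- Mutual inclusion of duplicate-free lists: counts do not depend on the list, so a given
  -- `HasCard` witness can be compared with the recursive lists.
  enumerates-length : ∀ {A : Set} {xs ys : List A} {P} → Enumerates xs P → Enumerates ys P → length xs ≡ length ys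
  enumerates-length e e′ = ℕ.≤-antisym
    (unique-⊆-length (unique e) (λ x∈ → complete e′ (sound e x∈)))
    (unique-⊆-length (unique e′) (λ x∈ → complete e (sound e′ x∈)))

  enumerates-filter : ∀ {A : Set} {xs : List A} {P} (f : A → ℕ) k → Enumerates xs P →
    Enumerates (filter (λ x → f x ℕ.≟ k) xs) (λ x → P x × f x ≡ k)
  enumerates-filter {xs = xs} f k e = record
    { unique   = Unique.filter⁺ (λ x → f x ℕ.≟ k) (unique e)
    ; sound    = λ x∈ → let x∈xs , fx = ∈-filter⁻ (λ x → f x ℕ.≟ k) {xs = xs} x∈ in sound e x∈xs , fx
    ; complete = λ { (p , fx) → ∈-filter⁺ (λ x → f x ℕ.≟ k) (complete e p) fx }
    }

  enumerates-resp : ∀ {A : Set} {xs : List A} {P Q} → (∀ {x} → P x → Q x) → (∀ {x} → Q x → P x) →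
    Enumerates xs P → Enumerates xs Q
  enumerates-resp f g e = record { unique = unique e ; sound = λ x∈ → f (sound e x∈) ; complete = λ q → complete e (g q) }

  sigmaList : ∀ {A B : Set} → List A → (A → List B) → List (A × B)
  sigmaList []       f = []
  sigmaList (x ∷ xs) f = map (x ,_) (f x) ++ sigmaList xs f

  ∈-sigmaList⁻ : ∀ {A B : Set} {f : A → List B} xs {x y} → (x , y) ∈ sigmaList xs f → x ∈ xs × y ∈ f x
  ∈-sigmaList⁻ {f = f} (x ∷ xs) p with ∈-++⁻ (map (x ,_) (f x)) p
  ... | inj₁ q with ∈-map⁻ (x ,_) q
  ... | _ , y∈ , refl = here refl , y∈
  ∈-sigmaList⁻ {f = f} (x ∷ xs) p | inj₂ q with ∈-sigmaList⁻ xs q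
  ... | x∈ , y∈ = there x∈ , y∈

  ∈-sigmaList⁺ : ∀ {A B : Set} {f : A → List B} {xs x y} → x ∈ xs → y ∈ f x → (x , y) ∈ sigmaList xs f
  ∈-sigmaList⁺ (here refl) y∈ = ∈-++⁺ˡ (∈-map⁺ _ y∈)
  ∈-sigmaList⁺ {f = f} {x′ ∷ _} (there x∈) y∈ = ∈-++⁺ʳ (map (x′ ,_) (f x′)) (∈-sigmaList⁺ x∈ y∈)

  sigmaList-unique : ∀ {A B : Set} {f : A → List B} {xs} → Unique xs → (∀ {x} → x ∈ xs → Unique (f x)) → Unique (sigmaList xs f)
  sigmaList-unique [] _ = []
  sigmaList-unique {f = f} {x ∷ xs} (x∉xs ∷ uxs) uf = Unique.++⁺
    (Unique.map⁺ Product.,-injectiveʳ (uf (here refl)))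
    (sigmaList-unique uxs (λ p → uf (there p)))
    λ { (p , q) → disjoint p q }
    where
    disjoint : ∀ {z} → z ∈ map (x ,_) (f x) → z ∈ sigmaList xs f → ⊥
    disjoint p q with ∈-map⁻ (x ,_) p
    ... | _ , _ , refl = All.lookup x∉xs (proj₁ (∈-sigmaList⁻ xs q)) refl

  range : ℕ → ℕ → List ℕ
  range lo zero    = []
  range lo (suc n) = lo ∷ range (suc lo) n

  ∈-range⁻ : ∀ lo n {k} → k ∈ range lo n → lo ≤ k × k < lo ℕ.+ n
  ∈-range⁻ lo (suc n) (here refl) = ℕ.≤-refl , ℕ.m<m+n lo (s≤s z≤n)
  ∈-range⁻ lo (suc n) {k} (there p) with ∈-range⁻ (suc lo) n p
  ... | l , r = ℕ.<⇒≤ l , subst (k <_) (sym (ℕ.+-suc lo n)) r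

  ∈-range⁺ : ∀ lo n {k} → lo ≤ k → k < lo ℕ.+ n → k ∈ range lo n
  ∈-range⁺ lo zero {k} l r = ⊥-elim (ℕ.<⇒≱ (subst (k <_) (ℕ.+-identityʳ lo) r) l)
  ∈-range⁺ lo (suc n) {k} l r with ℕ.m≤n⇒m<n∨m≡n l
  ... | inj₁ lo<k = there (∈-range⁺ (suc lo) n lo<k (subst (k <_) (ℕ.+-suc lo n) r))
  ... | inj₂ refl = here refl

  range-unique : ∀ lo n → Unique (range lo n)
  range-unique lo zero    = []
  range-unique lo (suc n) = All.tabulate (λ k∈ → ℕ.<⇒≢ (proj₁ (∈-range⁻ (suc lo) n k∈))) ∷ range-unique (suc lo) n

  Interval : Set
  Interval = Word × Word

  descent : Interval → ℕ
  descent q = finalDescent (proj₂ q)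

  module Enumeration (m : ℕ) where
    open Greedy m
    open Arguments m

    JInt : ℕ → ℕ → Interval → Set
    JInt i n (v , w) = V i v × ones v ≡ n × v ⟶* w

    -- The size of b, then (b, b′), (a, a′) and j. The size is explicit because it fixes what is
    -- left of n for a.
    Extension : Set
    Extension = ℕ × (Interval × (Interval × ℕ))

    -- All j with j₀ ≤ j ≤ d(a′), both ends included.
    shifts : ℕ → List Interval → List (Interval × ℕ)
    shifts j₀ L = sigmaList L (λ p → range j₀ (suc (descent p) ∸ j₀))

    extensions : ℕ → ℕ → (I J : ℕ → List Interval) → List Extension
    extensions j₀ n I J = sigmaList (range 0 n) (λ a → sigmaList (I a) (λ _ → shifts j₀ (J (n ∸ a))))

    extend : ℕ → Extension → Interval
    extend j₀ (_ , (b , b′) , (a , a′) , j) = insert j₀ a b , insert j a′ b′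

    record IsExtension (i n : ℕ) (e : Extension) : Set where
      constructor isExtension
      field
        A A′ b b′ : Word
        j         : ℕ
        frame     : Frame i A
        b-dyck    : Dyck b
        b-ones    : 1 ≤ ones b
        size      : ones A ℕ.+ ones b ≡ n
        j₀≤j      : m ∸ i ≤ j
        outer     : A ++ 0^ (m ∸ i) ⟶* A′ ++ 0^ j
        inner     : b ⟶* b′
        is        : e ≡ (ones b , (b , b′) , (A ++ 0^ (m ∸ i) , A′ ++ 0^ j) , j)

    ones-pad : ∀ A j → ones (A ++ 0^ j) ≡ ones A
    ones-pad A j = trans (ones-++ A (0^ j)) (trans (cong (ones A ℕ.+_) (ones-0^ j)) (ℕ.+-identityʳ _))

    ones-inserted : ∀ A b j → ones (A ++ b ++ 0^ j) ≡ ones A ℕ.+ ones b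
    ones-inserted A b j = trans (ones-++ A _) (cong (ones A ℕ.+_) (ones-pad b j))

    extend-is : ∀ i A A′ b b′ j a → extend (m ∸ i) (a , (b , b′) , (A ++ 0^ (m ∸ i) , A′ ++ 0^ j) , j)
      ≡ (A ++ b ++ 0^ (m ∸ i) , A′ ++ b′ ++ 0^ j)
    extend-is i A A′ b b′ j a = cong₂ _,_ (insert-pad A b (m ∸ i)) (insert-pad A′ b′ j)

    -- Sizes of b below n suffice because A contains the first up step; this makes the enumeration
    -- well-founded.
    module Step {i n : ℕ} (i≤m : i ≤ m) {I J : ℕ → List Interval}
      (I-enum : ∀ {a} → a < n → Enumerates (I a) (JInt (suc m) a))
      (J-enum : ∀ {a} → a ≤ n → Enumerates (J a) (JInt i a)) where

      private
        j₀ = m ∸ i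
        E = extensions j₀ n I J

      E-unique : Unique E
      E-unique = sigmaList-unique (range-unique 0 n) λ {a} a∈ →
        sigmaList-unique (unique (I-enum (proj₂ (∈-range⁻ 0 n a∈)))) λ _ →
        sigmaList-unique (unique (J-enum (ℕ.m∸n≤m n a))) λ {p} _ → range-unique j₀ (suc (descent p) ∸ j₀)

      E-sound : ∀ {e} → e ∈ E → IsExtension i n e
      E-sound {a , (b , b′) , (a₀ , a′) , j} e∈ with ∈-sigmaList⁻ (range 0 n) e∈
      ... | a∈ , e∈₁ with ∈-sigmaList⁻ (I a) e∈₁
      ... | q∈ , e∈₂ with ∈-sigmaList⁻ (J (n ∸ a)) e∈₂
      ... | p∈ , j∈ with ∈-range⁻ j₀ (suc (finalDescent a′) ∸ j₀) j∈ | sound (I-enum (proj₂ (∈-range⁻ 0 n a∈))) q∈ | sound (J-enum (ℕ.m∸n≤m n a)) p∈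
      ... | j₀≤j , j< | Vb , refl , inn | Va , oa , out with V⇒frame i≤m Va | finalDescent-take j a′ (ℕ.s≤s⁻¹ j<1+d)
        where
        -- If j₀ exceeded d(a′)+1, the truncated difference would leave an empty range.
        j<1+d : j < suc (finalDescent a′)
        j<1+d with ℕ.≤-total j₀ (suc (finalDescent a′))
        ... | inj₁ l = subst (j <_) (ℕ.m+[n∸m]≡n l) j<
        ... | inj₂ g = ⊥-elim (ℕ.<⇒≱ (subst (j <_) (trans (cong (j₀ ℕ.+_) (ℕ.m≤n⇒m∸n≡0 g)) (ℕ.+-identityʳ j₀)) j<) j₀≤j)
      ... | A , f , refl | A′ , refl = isExtension A A′ b b′ j f (V-dyck ℕ.≤-refl Vb) (V-≢[] Vb)
        (trans (cong (ℕ._+ ones b) (trans (sym (ones-pad A j₀)) oa)) (ℕ.m∸n+n≡m (ℕ.<⇒≤ (proj₂ (∈-range⁻ 0 n a∈)))))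
        j₀≤j out inn refl

      E-complete : ∀ {e} → IsExtension i n e → e ∈ E
      E-complete (isExtension A A′ b b′ j f db ob size j₀≤j out inn refl) =
        ∈-sigmaList⁺ (∈-range⁺ 0 n z≤n ob<n)
          (∈-sigmaList⁺ (complete (I-enum ob<n) (V-total db (ones⇒≢[] ob) , refl , inn))
            (∈-sigmaList⁺ (complete (J-enum (ℕ.m∸n≤m n (ones b))) (frame⇒V i≤m f , trans (ones-pad A j₀) oA , out))
              (∈-range⁺ j₀ _ j₀≤j (subst (j <_) (sym (ℕ.m+[n∸m]≡n (ℕ.m≤n⇒m≤1+n (ℕ.≤-trans j₀≤j j≤d)))) (s≤s j≤d)))))
        where
        ob<n : ones b < n
        ob<n = subst (ones b <_) size (ℕ.m<n+m (ones b) (frame-ones f))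
        oA : ones A ≡ n ∸ ones b
        oA = sym (trans (cong (_∸ ones b) (sym size)) (ℕ.m+n∸n≡m (ones A) (ones b)))
        j≤d : j ≤ finalDescent (A′ ++ 0^ j)
        j≤d = subst (j ≤_) (sym (finalDescent-pad A′ j)) (ℕ.m≤m+n j _)

      -- The minimal elements determine the frame and b. The two upper factors then have equal size,
      -- which lets `suffix-unique` split the maximal elements.
      extend-injective : ∀ {e e′} → IsExtension i n e → IsExtension i n e′ → extend j₀ e ≡ extend j₀ e′ → e ≡ e′
      extend-injective (isExtension A A′ b b′ j f db ob _ _ _ inn refl) (isExtension B B′ c c′ k g dc oc _ _ _ inn′ refl) eq
        with Product.,-injective (trans (sym (extend-is i A A′ b b′ j (ones b))) (trans eq (extend-is i B B′ c c′ k (ones c))))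
      ... | eqv , eqw with frame-unique f g db dc (List.++-cancelʳ (0^ j₀) _ _ (trans (List.++-assoc A b _) (trans eqv (sym (List.++-assoc B c _)))))
      ... | refl , refl with suffix-unique {A′} {B′} {b′} {c′} {j} {k} (star-dyck inn db) (star-dyck inn′ db) (subst (1 ≤_) (star-ones inn) ob)
              (trans (sym (star-ones inn)) (star-ones inn′)) eqw
      ... | refl , refl , refl = refl

      extend-sound : ∀ {e} → IsExtension i n e → JInt (suc i) n (extend j₀ e)
      extend-sound (isExtension A A′ b b′ j f db ob size j₀≤j out inn refl) = subst (JInt (suc i) n) (sym (extend-is i A A′ b b′ j (ones b)))
        ((A , b , f , db , refl) , trans (ones-inserted A b j₀) size ,
         inserted-star (frame-tight f) (frame-walk f i≤m) db (ones⇒≢[] ob) j₀≤j out inn)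

      step-complete : ∀ {v w} → JInt (suc i) n (v , w) → JInt i n (v , w) ⊎ (∃[ e ] (IsExtension i n e × (v , w) ≡ extend j₀ e))
      step-complete ((A , [] , f , _ , refl) , o , s) = inj₁ (frame⇒V i≤m f , o , s)
      step-complete ((A , b@(_ ∷ _) , f , db , refl) , o , s) with star-inserted (frame-walk f i≤m) db (λ ()) s
      ... | inserted {A′} {b′} {j} out inn _ j₀≤j refl = inj₂ (_ ,
        isExtension A A′ b b′ j f db (dyck-ones db (λ ())) (trans (sym (ones-inserted A b j₀)) o) j₀≤j out inn refl ,
        sym (extend-is i A A′ b b′ j (ones b)))

      disjoint : ∀ {q e} → JInt i n q → IsExtension i n e → q ≢ extend j₀ e
      disjoint {v , w} (Vv , _) (isExtension A A′ b b′ j f db ob _ _ _ _ refl) eq with V⇒frame i≤m Vv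
      ... | B , g , refl with frame-unique g f [] db (List.++-cancelʳ (0^ j₀) _ _
              (trans (cong (_++ 0^ j₀) (List.++-identityʳ B)) (trans (Product.,-injectiveˡ (trans eq (extend-is i A A′ b b′ j (ones b)))) (sym (List.++-assoc A b _)))))
      ... | _ , refl with ob
      ... | ()

      step-enumerates : Enumerates (J n ++ map (extend j₀) E) (JInt (suc i) n)
      step-enumerates = record
        { unique = Unique.++⁺ (unique (J-enum ℕ.≤-refl))
            (map-unique (λ p q → extend-injective (E-sound p) (E-sound q)) E-unique)
            (λ { (p , q) → dis p q })
        ; sound = snd
        ; complete = cmp
        }
        where
        dis : ∀ {q} → q ∈ J n → q ∈ map (extend j₀) E → ⊥
        dis p q with ∈-map⁻ (extend j₀) q
        ... | e , e∈ , eq = disjoint (sound (J-enum ℕ.≤-refl) p) (E-sound e∈) eq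
        snd : ∀ {q} → q ∈ J n ++ map (extend j₀) E → JInt (suc i) n q
        snd q∈ with ∈-++⁻ (J n) q∈
        ... | inj₁ p with sound (J-enum ℕ.≤-refl) p
        ... | Vv , o , s with V⇒frame i≤m Vv
        ... | A , f , refl = (A , [] , f , [] , refl) , o , s
        snd q∈ | inj₂ p with ∈-map⁻ (extend j₀) p
        ... | e , e∈ , refl = extend-sound (E-sound e∈)
        cmp : ∀ {q} → JInt (suc i) n q → q ∈ J n ++ map (extend j₀) E
        cmp r with step-complete r
        ... | inj₁ p = ∈-++⁺ˡ (complete (J-enum ℕ.≤-refl) p)
        ... | inj₂ (e , ie , refl) = ∈-++⁺ʳ (J n) (∈-map⁺ (extend j₀) (E-complete ie))

    minimal : Word
    minimal = true ∷ 0^ m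

    minimal-⟶ : ∀ {w} → ¬ (minimal ⟶ w)
    minimal-⟶ (cov [] u s du u≢[] _ () _)
    minimal-⟶ (cov (x ∷ p) u s du u≢[] _ src _) with 0^-split m p (List.∷-injectiveʳ src)
    ... | _ , suc k , _ , eq , _ with 0^-split k u (sym (List.∷-injectiveʳ eq))
    ... | i , _ , u≡ , _ , _ = dyck-not-0^ i du u≢[] u≡

    enumeration-zero : ℕ → List Interval
    enumeration-zero 1 = [ minimal , minimal ]
    enumeration-zero _ = []

    enumeration-zero-correct : ∀ n → Enumerates (enumeration-zero n) (JInt 0 n)
    enumeration-zero-correct n = record { unique = uniq n ; sound = snd n ; complete = cmp n }
      where
      uniq : ∀ n → Unique (enumeration-zero n)
      uniq zero = []
      uniq (suc zero) = [] ∷ []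
      uniq (suc (suc n)) = []
      snd : ∀ n {q} → q ∈ enumeration-zero n → JInt 0 n q
      snd (suc zero) (here refl) = refl , cong suc (ones-0^ m) , ε
      cmp : ∀ n {q} → JInt 0 n q → q ∈ enumeration-zero n
      cmp n (refl , o , c ◅ _) = ⊥-elim (minimal-⟶ c)
      cmp n (refl , o , ε) with trans (sym (cong suc (ones-0^ m))) o
      ... | refl = here refl

    -- The first argument is fuel exceeding the size: the call for i = m+1 lowers it, the call for
    -- the previous i keeps it. The empty list at fuel 0 is a default outside the condition n < N.
    enumeration : ℕ → ℕ → ℕ → List Interval
    enumeration zero    i       n = []
    enumeration (suc N) zero    n = enumeration-zero n
    enumeration (suc N) (suc i) n = enumeration (suc N) i n ++
      map (extend (m ∸ i)) (extensions (m ∸ i) n (enumeration N (suc m)) (enumeration (suc N) i))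

    enumeration-correct : ∀ N i n → i ≤ suc m → n < N → Enumerates (enumeration N i n) (JInt i n)
    enumeration-correct (suc N) zero    n _         n<N = enumeration-zero-correct n
    enumeration-correct (suc N) (suc i) n (s≤s i≤m) n<N = Step.step-enumerates i≤m
      (λ {a} a<n → enumeration-correct N (suc m) a ℕ.≤-refl (ℕ.<-≤-trans a<n (ℕ.s≤s⁻¹ n<N)))
      (λ {a} a≤n → enumeration-correct (suc N) i a (ℕ.m≤n⇒m≤1+n i≤m) (ℕ.≤-<-trans a≤n n<N))

    intervals : ℕ → ℕ → List Interval
    intervals i n = enumeration (suc n) i n

    intervals-correct : ∀ i n → i ≤ suc m → Enumerates (intervals i n) (JInt i n)
    intervals-correct i n i≤ = enumeration-correct (suc n) i n i≤ ℕ.≤-refl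

    -- The fuel in `intervals` varies with the size, so its lists need not satisfy the recursion
    -- literally; enumerating the same set is all that generating functions require.
    intervals-step : ∀ i n → i ≤ m → Enumerates
      (intervals i n ++ map (extend (m ∸ i)) (extensions (m ∸ i) n (intervals (suc m)) (intervals i))) (JInt (suc i) n)
    intervals-step i n i≤m = Step.step-enumerates i≤m
      (λ {a} _ → intervals-correct (suc m) a ℕ.≤-refl) (λ {a} _ → intervals-correct i a (ℕ.m≤n⇒m≤1+n i≤m))

    GInterval⇒JInt : ∀ {n q} → GInterval m n q → JInt (suc m) n q
    GInterval⇒JInt (1≤n , dv@(refl , _) , _ , le) = V-total (IsDyck⇒Dyck dv) (ones⇒≢[] 1≤n) , refl , ≤G⇒star (IsDyck⇒Dyck dv) le

    JInt⇒GInterval : ∀ {i n q} → i ≤ suc m → JInt i n q → GInterval m n q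
    JInt⇒GInterval {q = v , w} i≤ (Vv , refl , s) = V-≢[] Vv , Dyck⇒IsDyck (V-dyck i≤ Vv) ,
      subst (λ n → IsDyck m n w) (sym (star-ones s)) (Dyck⇒IsDyck (star-dyck s (V-dyck i≤ Vv))) , star⇒≤G s

    intervals-GInterval : ∀ n → Enumerates (intervals (suc m) n) (GInterval m n)
    intervals-GInterval n = enumerates-resp (JInt⇒GInterval ℕ.≤-refl) GInterval⇒JInt (intervals-correct (suc m) n ℕ.≤-refl)

    JInterval-enumerated : ∀ i n k → i ≤ suc m → Enumerates (filter (λ q → descent q ℕ.≟ k) (intervals i n)) (JInterval m i n k)
    JInterval-enumerated i n k i≤ = enumerates-resp
      (λ { (j@(Vv , _) , d) → (JInt⇒GInterval i≤ j , d) , V⇒arguments Vv })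
      (λ { ((g , d) , args) → let _ , o , s = GInterval⇒JInt g in (arguments⇒V i≤ args , o , s) , d })
      (enumerates-filter descent k (intervals-correct i n i≤))

    GIntervalD-enumerated : ∀ n k → Enumerates (filter (λ q → descent q ℕ.≟ k) (intervals (suc m) n)) (GIntervalD m n k)
    GIntervalD-enumerated n k = enumerates-filter descent k (intervals-GInterval n)

  HasCard-length : ∀ {P c xs} → HasCard P c → Enumerates xs P → c ≡ length xs
  HasCard-length (L , u , s , c , refl) e = enumerates-length
    (record { unique = u ; sound = s _ ; complete = c _ }) e

-- Generating functions of the enumerated lists

module GeneratingFunctions where
  open BivariateSeries
  open FunctionalEquations
  open DyckWords
  open Decompositions
  open IntervalEnumeration
  open import Data.Bool using (true)
  open import Defs using (tˢ; fromℕℚ; ones)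
  open import Data.Rational as ℚ using (0ℚ; 1ℚ)
  import Data.Rational.Properties as ℚ
  open import Data.List using (List; []; _∷_; _++_; length; map; filter)
  import Data.List.Properties as List
  open import Data.List.Membership.Propositional using (_∈_)
  open import Data.List.Relation.Unary.Any using (here; there)
  open import Data.Product using (_,_; _×_; proj₁; proj₂)
  open import Data.Empty using (⊥-elim)
  open import Relation.Nullary using (¬_; yes; no)
  open ≡ using (_≡_; _≢_; refl; sym; trans; cong; cong₂; subst)

  private
    module XS = Summation X.powerSeries
    module QS = IntegerSolver ℚ-ring

  -- Multiplication by x on a single row, in a form that computes.
  shift : X.PS → X.PS
  shift p zero    = 0ℚ
  shift p (suc k) = p k

  shift-cong : ∀ {p q} → p X.≈ₚ q → shift p X.≈ₚ shift q
  shift-cong e zero    = refl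
  shift-cong e (suc k) = e k

  shift-⊕ : ∀ p q → shift (p X.⊕ q) X.≈ₚ shift p X.⊕ shift q
  shift-⊕ p q zero    = sym (ℚ.+-identityˡ 0ℚ)
  shift-⊕ p q (suc k) = refl

  shift-⊛ : ∀ p q → shift p X.⊛ q X.≈ₚ shift (p X.⊛ q)
  shift-⊛ p q zero    = trans (ℚ.+-identityʳ (0ℚ ℚ.* q 0)) (ℚ.*-zeroˡ (q 0))
  shift-⊛ p q (suc k) = trans (X.⊛-suc (shift p) q k)
    (trans (cong (ℚ._+ (p X.⊛ q) k) (ℚ.*-zeroˡ (q (suc k)))) (ℚ.+-identityˡ _))

  monomial : ℕ → X.PS
  monomial zero    = X.1ₚ
  monomial (suc d) = shift (monomial d)

  monomial-≡ : ∀ d → monomial d d ≡ 1ℚ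
  monomial-≡ zero    = refl
  monomial-≡ (suc d) = monomial-≡ d

  monomial-≢ : ∀ d k → d ≢ k → monomial d k ≡ 0ℚ
  monomial-≢ zero    zero    d≢k = ⊥-elim (d≢k refl)
  monomial-≢ zero    (suc k) d≢k = refl
  monomial-≢ (suc d) zero    d≢k = refl
  monomial-≢ (suc d) (suc k) d≢k = monomial-≢ d k (λ e → d≢k (cong suc e))

  module _ {A : Set} where

    gf : (A → ℕ) → List A → X.PS
    gf δ []       k = 0ℚ
    gf δ (x ∷ xs) k = monomial (δ x) k ℚ.+ gf δ xs k

    gf-count : ∀ δ xs k → gf δ xs k ≡ fromℕℚ (length (filter (λ x → δ x ℕ.≟ k) xs))
    gf-count δ []       k = refl
    gf-count δ (x ∷ xs) k with δ x ℕ.≟ k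
    ... | yes refl = trans (cong₂ ℚ._+_ (monomial-≡ (δ x)) (gf-count δ xs (δ x)))
      (trans (sym (fromℕℚ-suc (length (filter (λ y → δ y ℕ.≟ δ x) xs)))) (cong (λ ys → fromℕℚ (length ys)) (sym (List.filter-accept (λ y → δ y ℕ.≟ δ x) {x} {xs} refl))))
    ... | no  δ≢k  = trans (cong₂ ℚ._+_ (monomial-≢ (δ x) k δ≢k) (gf-count δ xs k))
      (trans (ℚ.+-identityˡ _) (cong (λ ys → fromℕℚ (length ys)) (sym (List.filter-reject (λ y → δ y ℕ.≟ k) {x} {xs} δ≢k))))

    gf-enumerates : ∀ δ {xs ys P} k → Enumerates xs P → Enumerates ys P → gf δ xs k ≡ gf δ ys k
    gf-enumerates δ {xs} {ys} k e e′ = trans (gf-count δ xs k) (trans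
      (cong fromℕℚ (enumerates-length (enumerates-filter δ k e) (enumerates-filter δ k e′)))
      (sym (gf-count δ ys k)))

    gf-++ : ∀ δ xs ys k → gf δ (xs ++ ys) k ≡ gf δ xs k ℚ.+ gf δ ys k
    gf-++ δ []       ys k = sym (ℚ.+-identityˡ _)
    gf-++ δ (x ∷ xs) ys k = trans (cong (monomial (δ x) k ℚ.+_) (gf-++ δ xs ys k)) (sym (ℚ.+-assoc (monomial (δ x) k) _ _))

    gf-cong : ∀ {δ δ′} xs → (∀ {x} → x ∈ xs → δ x ≡ δ′ x) → ∀ k → gf δ xs k ≡ gf δ′ xs k
    gf-cong []       e k = refl
    gf-cong (x ∷ xs) e k = cong₂ ℚ._+_ (cong (λ d → monomial d k) (e (here refl))) (gf-cong xs (λ p → e (there p)) k)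

    gf-empty : ∀ δ xs → (∀ {x} → ¬ (x ∈ xs)) → ∀ k → gf δ xs k ≡ 0ℚ
    gf-empty δ []       _ k = refl
    gf-empty δ (x ∷ xs) e k = ⊥-elim (e (here refl))

    gf-shift : ∀ δ xs → gf (λ x → suc (δ x)) xs X.≈ₚ shift (gf δ xs)
    gf-shift δ []       zero    = refl
    gf-shift δ []       (suc k) = refl
    gf-shift δ (x ∷ xs) k = trans (cong (shift (monomial (δ x)) k ℚ.+_) (gf-shift δ xs k)) (sym (shift-⊕ (monomial (δ x)) (gf δ xs) k))

    gf-scale : ∀ a δ xs → gf (λ x → a ℕ.+ δ x) xs X.≈ₚ monomial a X.⊛ gf δ xs
    gf-scale zero    δ xs k = sym (X.⊛-identityˡ (gf δ xs) k)
    gf-scale (suc a) δ xs k = trans (gf-shift (λ x → a ℕ.+ δ x) xs k)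
      (trans (shift-cong (gf-scale a δ xs) k) (sym (shift-⊛ (monomial a) (gf δ xs) k)))

    gf-constant : ∀ xs → Constant (gf (λ _ → 0) xs)
    gf-constant []       k = refl
    gf-constant (x ∷ xs) k = trans (ℚ.+-identityˡ _) (gf-constant xs k)

    gf-length : ∀ xs → gf (λ _ → 0) xs 0 ≡ fromℕℚ (length xs)
    gf-length []       = refl
    gf-length (x ∷ xs) = trans (cong (1ℚ ℚ.+_) (gf-length xs)) (sym (fromℕℚ-suc (length xs)))

    gf-finite : ∀ δ xs → Finite (gf δ xs)
    gf-finite δ []       = 0 , λ _ _ → refl
    gf-finite δ (x ∷ xs) = RowClosed.P-+ finite-closed (monomial-finite (δ x)) (gf-finite δ xs)
      where
      monomial-finite : ∀ d → Finite (monomial d)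
      monomial-finite d = d , λ k d<k → monomial-≢ d k (ℕ.<⇒≢ d<k)

  gf-map : ∀ {A B : Set} (f : A → B) δ xs k → gf δ (map f xs) k ≡ gf (λ x → δ (f x)) xs k
  gf-map f δ []       k = refl
  gf-map f δ (x ∷ xs) k = cong (monomial (δ (f x)) k ℚ.+_) (gf-map f δ xs k)

  gf-product : ∀ {A B : Set} (α : A → ℕ) (β : B → ℕ) xs ys k →
    gf (λ { (x , y) → α x ℕ.+ β y }) (sigmaList xs (λ _ → ys)) k ≡ (gf α xs X.⊛ gf β ys) k
  gf-product α β []       ys k = sym (X.⊛-zeroˡ (λ _ → 0ℚ) (gf β ys) (λ _ → refl) k)
  gf-product α β (x ∷ xs) ys k = trans (gf-++ _ (map (x ,_) ys) _ k) (trans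
    (cong₂ ℚ._+_ (trans (gf-map (x ,_) _ ys k) (gf-scale (α x) β ys k)) (gf-product α β xs ys k))
    (sym (X.⊛-distribʳ (gf β ys) (monomial (α x)) (gf α xs) k)))

  gf-sigma-range : ∀ {B : Set} (δ : ℕ × B → ℕ) lo n f k →
    gf δ (sigmaList (range lo n) f) k ≡ XS.∑ lo n (λ a → gf (λ y → δ (a , y)) (f a)) k
  gf-sigma-range δ lo zero    f k = refl
  gf-sigma-range δ lo (suc n) f k = trans (gf-++ δ (map (lo ,_) (f lo)) _ k)
    (cong₂ ℚ._+_ (gf-map (lo ,_) δ (f lo) k) (gf-sigma-range δ (suc lo) n f k))

  range-telescopes : ∀ lo n k → shift (gf (λ j → j) (range lo n)) k ℚ.- gf (λ j → j) (range lo n) k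
    ≡ monomial (n ℕ.+ lo) k ℚ.- monomial lo k
  range-telescopes lo zero    k = trans (cong (ℚ._- 0ℚ) (shift-0 k)) (sym (ℚ.+-inverseʳ (monomial lo k)))
    where
    shift-0 : ∀ k → shift (λ _ → 0ℚ) k ≡ 0ℚ
    shift-0 zero    = refl
    shift-0 (suc k) = refl
  range-telescopes lo (suc n) k = trans (cong (ℚ._- (monomial lo k ℚ.+ g k)) (shift-⊕ (monomial lo) g k))
    (trans (QS.solve 4 (λ a b s g → (a QS.:+ s) QS.:- (b QS.:+ g) QS.:= a QS.:- b QS.:+ (s QS.:- g)) refl
       (monomial (suc lo) k) (monomial lo k) (shift g k) (g k))
    (trans (cong (λ z → monomial (suc lo) k ℚ.- monomial lo k ℚ.+ z) (range-telescopes (suc lo) n k))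
    (trans (QS.solve 3 (λ a b e → a QS.:- b QS.:+ (e QS.:- a) QS.:= e QS.:- b) refl
       (monomial (suc lo) k) (monomial lo k) (monomial (n ℕ.+ suc lo) k))
    (cong (λ d → monomial d k ℚ.- monomial lo k) (ℕ.+-suc n lo)))))
    where
    g = gf (λ j → j) (range (suc lo) n)

  -- x-1 times the sum of x^j over lo ≤ j < hi is x^hi - x^lo. From 0 to d this gives the quotient
  -- for the value at x = 1, and from j₀ to d+1 the bracket of the functional equation.
  sigma-telescopes : ∀ {A : Set} (hi : A → ℕ) lo xs → (∀ {x} → x ∈ xs → lo ≤ hi x) → ∀ k →
    let S = gf proj₂ (sigmaList xs (λ x → range lo (hi x ∸ lo))) in
    shift S k ℚ.- S k ≡ gf hi xs k ℚ.- gf (λ _ → lo) xs k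
  sigma-telescopes hi lo [] _ zero    = refl
  sigma-telescopes hi lo [] _ (suc k) = refl
  sigma-telescopes hi lo (x ∷ xs) lo≤ k = trans
    (cong₂ ℚ._-_ (trans (shift-cong S≈ k) (shift-⊕ r S k)) (S≈ k))
    (trans (QS.solve 4 (λ a b s g → (a QS.:+ s) QS.:- (b QS.:+ g) QS.:= (a QS.:- b) QS.:+ (s QS.:- g)) refl
       (shift r k) (r k) (shift S k) (S k))
    (trans (cong₂ ℚ._+_ (trans (range-telescopes lo (hi x ∸ lo) k)
        (cong (λ d → monomial d k ℚ.- monomial lo k) (ℕ.m∸n+n≡m (lo≤ (here refl))))) (sigma-telescopes hi lo xs (λ p → lo≤ (there p)) k))
    (QS.solve 4 (λ a b s g → (a QS.:- b) QS.:+ (s QS.:- g) QS.:= (a QS.:+ s) QS.:- (b QS.:+ g)) refl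
       (monomial (hi x) k) (monomial lo k) (gf hi xs k) (gf (λ _ → lo) xs k))))
    where
    r = gf (λ j → j) (range lo (hi x ∸ lo))
    S = gf proj₂ (sigmaList xs (λ x → range lo (hi x ∸ lo)))
    S≈ : gf proj₂ (sigmaList (x ∷ xs) (λ x → range lo (hi x ∸ lo))) X.≈ₚ r X.⊕ S
    S≈ k = trans (gf-++ proj₂ (map (x ,_) (range lo (hi x ∸ lo))) _ k)
      (cong (ℚ._+ S k) (gf-map (x ,_) proj₂ (range lo (hi x ∸ lo)) k))

  x*-shift : ∀ f n k → coeff (x * f) n k ≡ shift (coeff f n) k
  x*-shift f n zero    = x*-zero f n
  x*-shift f n (suc k) = x*-suc f n k

  x^*-row : ∀ p f n k → coeff (x SE.^ p * f) n k ≡ (monomial p X.⊛ coeff f n) k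
  x^*-row zero    f n k = trans (at (SR.*-identityˡ f) n k) (sym (X.⊛-identityˡ (coeff f n) k))
  x^*-row (suc p) f n k = trans (at (SR.*-assoc x (x SE.^ p) f) n k) (trans (x*-shift (x SE.^ p * f) n k)
    (trans (shift-cong (x^*-row p f n) k) (sym (shift-⊛ (monomial p) (coeff f n) k))))

  module Counting (m : ℕ) where
    open Greedy m
    open Arguments m
    open Enumeration m
    open Uniqueness m

    J K shifted : ℕ → Series
    J i = series λ n → gf descent (intervals i n)
    K i = series λ n → gf (λ _ → 0) (intervals i n)
    shifted i = series λ n → gf proj₂ (shifts (m ∸ i) (intervals i n))

    intervals-0 : ∀ i {q} → i ≤ suc m → ¬ (q ∈ intervals i 0)
    intervals-0 i i≤ q∈ with sound (intervals-correct i 0 i≤) q∈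
    ... | Vv , o , _ = ℕ.<⇒≢ (V-≢[] Vv) (sym o)

    -- Lifting shows that every path above A 0^(m-i) keeps that block of zeros.
    descent-bound : ∀ {i n q} → i ≤ m → q ∈ intervals i n → m ∸ i ≤ descent q
    descent-bound {i} {n} {v , w} i≤m q∈ with sound (intervals-correct i n (ℕ.m≤n⇒m≤1+n i≤m)) q∈
    ... | Vv , _ , s with V⇒frame i≤m Vv
    ... | A , f , refl with star-lifted (frame-tight f) (frame-walk f i≤m) s
    ... | A′ , refl , _ = subst (m ∸ i ≤_) (sym (finalDescent-pad A′ (m ∸ i))) (ℕ.m≤m+n _ _)

    -- The quotient sums 1 + x + ... + x^(d-1) over the intervals.
    special : ∀ i → J i ~ K i
    special i = record
      { finite = λ n → gf-finite descent (intervals i n)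
      ; xfree = λ n → gf-constant (intervals i n)
      ; quotient = quot
      ; quotient-finite = λ n → gf-finite proj₂ (sigmaList (intervals i n) (λ q → range 0 (descent q)))
      ; difference = pointwise λ n k → sym (trans (at (x-1* quot) n k)
          (trans (cong (ℚ._- coeff quot n k) (x*-shift quot n k)) (sigma-telescopes descent 0 (intervals i n) (λ _ → z≤n) k)))
      }
      where
      quot : Series
      quot = series λ n → gf proj₂ (sigmaList (intervals i n) (λ q → range 0 (descent q)))

    order : ∀ i → i ≤ suc m → Order₁ (J i)
    order i i≤ k = gf-empty descent (intervals i 0) (intervals-0 i i≤) k

    -- The final descent of an extension is d(b′) + j, so the weight factors into a part for (b, b′)
    -- and a part for ((a, a′), j).
    tail-increment : ∀ i n → i ≤ m → ∀ k →
      gf descent (map (extend (m ∸ i)) (extensions (m ∸ i) n (intervals (suc m)) (intervals i))) k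
        ≡ XS.∑ 0 n (λ a → gf descent (intervals (suc m) a) X.⊛ gf proj₂ (shifts (m ∸ i) (intervals i (n ∸ a)))) k
    tail-increment i n i≤m k = trans (gf-map (extend (m ∸ i)) descent E k) (trans
      (gf-cong {δ′ = δ} E descent-extend k)
      (trans (gf-sigma-range δ 0 n _ k)
        (XS.∑-cong 0 n {λ a → gf (λ y → δ (a , y)) (sigmaList (intervals (suc m) a) (λ _ → shifts (m ∸ i) (intervals i (n ∸ a))))}
          (λ a _ _ → gf-product descent proj₂ (intervals (suc m) a) (shifts (m ∸ i) (intervals i (n ∸ a)))) k)))
      where
      E = extensions (m ∸ i) n (intervals (suc m)) (intervals i)
      δ : Extension → ℕ
      δ (_ , (q , (_ , j))) = descent q ℕ.+ j
      descent-extend : ∀ {e} → e ∈ E → descent (extend (m ∸ i) e) ≡ δ e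
      descent-extend e∈ with Step.E-sound {n = n} i≤m (λ {a} _ → intervals-correct (suc m) a ℕ.≤-refl)
                               (λ {a} _ → intervals-correct i a (ℕ.m≤n⇒m≤1+n i≤m)) e∈
      ... | isExtension A A′ b b′ j _ _ ob _ _ _ inn refl = trans
        (cong descent (extend-is i A A′ b b′ j (ones b)))
        (finalDescent-inserted A′ b′ j (subst (1 ≤_) (star-ones inn) ob))

    increment : ∀ i → i ≤ m → J (suc i) SR.- J i ≋ J (suc m) * shifted i
    increment i i≤m .at n k = trans
      (cong (ℚ._- coeff (J i) n k) (trans (gf-enumerates descent k (intervals-correct (suc i) n (s≤s i≤m)) (intervals-step i n i≤m))
        (gf-++ descent (intervals i n) _ k)))
      (trans (QS.solve 2 (λ a b → (a QS.:+ b) QS.:- a QS.:= b) refl (coeff (J i) n k) (gf descent ext k))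
      (trans (tail-increment i n i≤m k)
      (sym (trans (at (*≋⊛ (J (suc m)) (shifted i)) n k)
        (trans (XS.∑-snoc 0 n (λ a → coeff (J (suc m)) a X.⊛ coeff (shifted i) (n ∸ a)) k)
        (trans (cong (XS.∑ 0 n (λ a → coeff (J (suc m)) a X.⊛ coeff (shifted i) (n ∸ a)) k ℚ.+_) last) (ℚ.+-identityʳ _)))))))
      where
      ext = map (extend (m ∸ i)) (extensions (m ∸ i) n (intervals (suc m)) (intervals i))
      shifted-0 : ∀ k → coeff (shifted i) (n ∸ n) k ≡ 0ℚ
      shifted-0 rewrite ℕ.n∸n≡0 n = gf-empty proj₂ (shifts (m ∸ i) (intervals i 0))
        (λ { {q , j} p → intervals-0 i (ℕ.m≤n⇒m≤1+n i≤m) (proj₁ (∈-sigmaList⁻ (intervals i 0) p)) })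
      -- The convolution has a term a = n absent from the extensions; it vanishes because no
      -- interval has size 0.
      last : (coeff (J (suc m)) n X.⊛ coeff (shifted i) (n ∸ n)) k ≡ 0ℚ
      last = trans (X.⊛-comm (coeff (J (suc m)) n) (coeff (shifted i) (n ∸ n)) k)
        (X.⊛-zeroˡ (coeff (shifted i) (n ∸ n)) (coeff (J (suc m)) n) shifted-0 k)

    shifted-W : ∀ i → i ≤ m → x-1 * shifted i ≋ W J K i
    shifted-W i i≤m .at n k = trans (at (x-1* (shifted i)) n k)
      (trans (cong (ℚ._- coeff (shifted i) n k) (x*-shift (shifted i) n k))
      (trans (sigma-telescopes (λ q → suc (descent q)) j₀ L (λ q∈ → ℕ.m≤n⇒m≤1+n (descent-bound i≤m q∈)) k)
      (cong₂ ℚ._-_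
        (trans (gf-shift descent L k) (sym (x*-shift (J i) n k)))
        (trans (gf-cong L (λ _ → sym (ℕ.+-identityʳ j₀)) k)
          (trans (gf-scale j₀ (λ _ → 0) L k) (sym (x^*-row j₀ (K i) n k)))))))
      where
      j₀ = m ∸ i
      L = intervals i n

    step : ∀ i → i ≤ m → x-1 * (J (suc i) SR.- J i) ≋ J (suc m) * W J K i
    step i i≤m = ≋-trans (SR.*-congˡ (increment i i≤m))
      (≋-trans (solve 3 (λ v a b → v :* (a :* b) := a :* (v :* b)) ≋-refl x-1 (J (suc m)) (shifted i))
        (SR.*-congˡ (shifted-W i i≤m)))
      where open IntegerSolver Series-ring

    initial : J 0 ≋ t * x SE.^ m
    initial = ≋-trans (≋-trans rows (≋-sym (*≋⊛ t (x SE.^ m * 1#)))) (SR.*-congˡ (SR.*-identityʳ (x SE.^ m)))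
      where
      one-row : ∀ n k → coeff 1# n k ≡ T.1ₚ n k
      one-row n k = at 1≋1ₚ n k
      power-row : ∀ n k → coeff (x SE.^ m * 1#) n k ≡ (monomial m X.⊛ T.1ₚ n) k
      power-row n k = trans (x^*-row m 1# n k) (X.⊛-cong {monomial m} {monomial m} (λ _ → refl) (one-row n) k)
      t-1 : ∀ k → tˢ 1 k ≡ X.1ₚ k
      t-1 zero    = refl
      t-1 (suc k) = refl
      t-row : ∀ n k → (t ⊛ (x SE.^ m * 1#)) .coeff (suc n) k ≡ coeff (x SE.^ m * 1#) n k
      t-row n k = T.⊛-shiftˡ tˢ (coeff (x SE.^ m * 1#)) (λ _ → refl) t-1 (λ _ _ → refl) n k
      rows : J 0 ≋ t ⊛ (x SE.^ m * 1#)
      rows .at zero k = sym (trans (ℚ.+-identityʳ _) (X.⊛-zeroˡ (tˢ 0) (coeff (x SE.^ m * 1#) 0) (λ _ → refl) k))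
      rows .at (suc zero) k = sym (trans (t-row 0 k) (trans (power-row 0 k)
        (trans (X.⊛-comm (monomial m) X.1ₚ k) (trans (X.⊛-identityˡ (monomial m) k)
          (sym (trans (ℚ.+-identityʳ _) (cong (λ d → monomial d k) (trans (finalDescent-pad (true ∷ []) m) (ℕ.+-identityʳ m)))))))))
      rows .at (suc (suc n)) k = sym (trans (t-row (suc n) k) (trans (power-row (suc n) k)
        (trans (X.⊛-comm (monomial m) (λ _ → 0ℚ) k) (X.⊛-zeroˡ (λ _ → 0ℚ) (monomial m) (λ _ → refl) k))))

    system : System J K
    system = record { special = λ i _ → special i ; order = order ; initial = initial ; step = step }

-- The counted series are the claimed ones

module Solutions where
  open BivariateSeries
  open FunctionalEquations
  open IntervalEnumeration
  open GeneratingFunctions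
  open import Defs hiding (D)
  open import Data.Nat.Combinatorics using (_C_)
  open import Data.Rational as ℚ using (0ℚ; 1ℚ)
  import Data.Rational.Properties as ℚ
  open import Data.Product using (_,_; _×_; ∃-syntax)
  open import Data.Sum using (inj₁; inj₂)
  open import Data.List using (filter)

  const-* : ∀ a b → const (a ℚ.* b) ≋ const a * const b
  const-* a b = ≋-trans (pointwise eq) (series-· a (constˢ b))
    where
    eq : constˢ (a ℚ.* b) ≈ˢ a ·ˢ constˢ b
    eq zero    zero    = ≡.refl
    eq zero    (suc k) = ≡.sym (ℚ.*-zeroʳ a)
    eq (suc n) k       = ≡.sym (ℚ.*-zeroʳ a)

  const-neg : ∀ a → const (ℚ.- a) ≋ neg (const a)
  const-neg a .at zero    zero    = ≡.refl
  const-neg a .at zero    (suc k) = ≡.refl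
  const-neg a .at (suc n) k       = ≡.refl

  const-1 : const 1ℚ ≋ 1#
  const-1 .at zero    zero    = ≡.refl
  const-1 .at zero    (suc k) = ≡.refl
  const-1 .at (suc n) k       = ≡.refl

  sgn-power : ∀ k f → const (sgn k) * f SE.^ k ≋ neg f SE.^ k
  sgn-power zero    f = ≋-trans (SR.*-identityʳ _) const-1
  sgn-power (suc k) f = ≋-trans (SR.*-congʳ (const-neg (sgn k)))
    (≋-trans (solve 3 (λ s f w → :- s :* (f :* w) := :- f :* (s :* w)) ≋-refl (const (sgn k)) f (f SE.^ k))
      (SR.*-congˡ (sgn-power k f)))
    where open IntegerSolver Series-ring

  module Translation (m : ℕ) where
    open Polynomials Series-ring m using (ι; h; weightedGeometric; h-explicit; h-top)
    open SR using (*-cong; *-congˡ; *-congʳ; +-cong; +-congˡ; -‿cong)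

    series-ι· : ∀ n f → series (fromℕℚ n ·ˢ f) ≋ ι n * series f
    series-ι· n f = ≋-trans (series-· (fromℕℚ n) f) (*-congʳ (const-ι m n))

    series-minus : ∀ {f g f′ g′} → series f ≋ f′ → series g ≋ g′ → series (f -ˢ g) ≋ f′ SR.- g′
    series-minus {f} {g} e e′ = ≋-trans (series-- f g) (+-cong e (-‿cong e′))

    series-times : ∀ {f g f′ g′} → series f ≋ f′ → series g ≋ g′ → series (f *ˢ g) ≋ f′ * g′
    series-times {f} {g} e e′ = ≋-trans (series-* f g) (*-cong e e′)

    series-plus : ∀ {f g f′ g′} → series f ≋ f′ → series g ≋ g′ → series (f +ˢ g) ≋ f′ + g′
    series-plus {f} {g} e e′ = ≋-trans (series-+ f g) (+-cong e e′)

    series-power : ∀ {f f′} n → series f ≋ f′ → series (f ^ˢ n) ≋ f′ SE.^ n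
    series-power {f} n e = ≋-trans (series-^ f n) (SE.^-congˡ n e)

    series-sum : ∀ lo n {F F′} → (∀ k → series (F k) ≋ F′ k) → series (sumˢ lo n F) ≋ SS.∑ lo n F′
    series-sum lo n {F} e = ≋-trans (series-∑ lo n F) (SS.∑-cong lo n (λ k _ _ → e k))

    series-one : series 1ˢ ≋ 1#
    series-one = pointwise λ _ _ → ≡.refl

    series-1-ι : ∀ n f → series (1ˢ -ˢ fromℕℚ n ·ˢ f) ≋ 1# SR.- ι n * series f
    series-1-ι n f = series-minus series-one (series-ι· n f)

    series-top : ∀ z u → series (1ˢ -ˢ z *ˢ sumˢ 0 (suc m) (λ e → fromℕℚ (suc m ∸ e) ·ˢ u ^ˢ e)) ≋ h (suc m) (series z) (series u)
    series-top z u = ≋-trans (series-minus series-one (series-times ≋-refl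
        (series-sum 0 (suc m) λ e → ≋-trans (series-ι· (suc m ∸ e) (u ^ˢ e)) (*-congˡ (series-^ u e)))))
      (≋-sym (h-top (series z) (series u)))

    signed : ∀ k n z → series ((sgn k ℚ.* fromℕℚ n) ·ˢ z ^ˢ k) ≋ ι n * neg (series z) SE.^ k
    signed k n z = ≋-trans (series-· _ (z ^ˢ k)) (≋-trans (*-cong (const-* (sgn k) (fromℕℚ n)) (series-^ z k))
      (≋-trans (solve 3 (λ s c w → s :* c :* w := c :* (s :* w)) ≋-refl (const (sgn k)) (const (fromℕℚ n)) (series z SE.^ k))
        (*-cong (const-ι m n) (sgn-power k (series z)))))
      where open IntegerSolver Series-ring

    series-Hlow : ∀ i z u → i ≤ m → series (Hlow m i z u) ≋ series u SE.^ suc i * h i (series z) (series u)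
    series-Hlow i z u i≤m = series-times (series-^ u (suc i)) (≋-trans
      (series-plus (series-plus series-one
        (series-sum 1 (suc i) λ k → series-times (signed k (suc i C k) z)
          (series-sum 0 (suc (m ∸ i)) λ e → ≋-trans (series-ι· ((e ℕ.+ k ∸ 1) C e) (u ^ˢ e)) (*-congˡ (series-^ u e)))))
        (series-sum 1 i λ k → series-times (signed k ((m ℕ.+ k ∸ i ∸ 1) C (k ∸ 1)) z)
          (series-sum 0 (suc (i ∸ k)) λ e → ≋-trans (series-ι· ((e ℕ.+ k) C e) (u ^ˢ (suc m ∸ k ∸ e))) (*-congˡ (series-^ u (suc m ∸ k ∸ e))))))
      (≋-sym (h-explicit i (series z) (series u) i≤m)))

  module Solution (m : ℕ) (Z U : Ser)
    (Z00 : Z 0 0 ≡ 0ℚ) (Z-xfree : ∀ n k → 1 ≤ k → Z n k ≡ 0ℚ)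
    (t≈ : tˢ ≈ˢ Z *ˢ (1ˢ -ˢ fromℕℚ (suc m) ·ˢ Z) ^ˢ m)
    (U-finite : ∀ n → ∃[ K ] (∀ k → K < k → U n k ≡ 0ℚ))
    (xc≈ : xˢ *ˢ (1ˢ -ˢ fromℕℚ (suc m) ·ˢ Z) ≈ˢ U *ˢ (1ˢ -ˢ Z *ˢ sumˢ 0 (suc m) (λ e → U ^ˢ e))) where

    open Polynomials Series-ring m
    open Translation m
    open SR using (*-cong; *-congˡ; *-congʳ; +-cong; +-congˡ; -‿cong)
    open Uniqueness m

    z u c S S⁻¹ c⁻¹ R R⁻¹ : Series
    z = series Z
    u = series U
    c = 1# SR.- ι (suc m) * z
    S = h 0 z u
    R = h (suc m) z u
    S⁻¹ = inverse S
    c⁻¹ = inverse c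
    R⁻¹ = inverse R

    z-xfree : XFree z
    z-xfree n k = Z-xfree n (suc k) (s≤s z≤n)

    z-order : Order₁ z
    z-order zero    = Z00
    z-order (suc k) = Z-xfree 0 (suc k) (s≤s z≤n)

    one-minus-row : ∀ f g → f ≋ 1# SR.- g → Order₁ g → ∀ k → coeff f 0 k ≡ coeff 1# 0 k
    one-minus-row f g e o k = ≡.trans (at e 0 k) (≡.trans (≡.cong (λ a → coeff 1# 0 k ℚ.- a) (o k)) (ℚ.+-identityʳ _))

    S-inverse : S * S⁻¹ ≋ 1#
    S-inverse = inverse-correct S (one-minus-row S (z * SS.∑ 0 (suc m) (u SE.^_)) (h-zero z u) (Order₁-*ˡ z (SS.∑ 0 (suc m) (u SE.^_)) z-order))

    R-inverse : R * R⁻¹ ≋ 1#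
    R-inverse = inverse-correct R (one-minus-row R (z * weightedGeometric (suc m) u) (h-top z u) (Order₁-*ˡ z (weightedGeometric (suc m) u) z-order))

    c-inverse : c * c⁻¹ ≋ 1#
    c-inverse = inverse-correct c (one-minus-row c (ι (suc m) * z) ≋-refl (Order₁-*ʳ (ι (suc m)) z z-order))

    t≋ : t ≋ z * c SE.^ m
    t≋ = ≋-trans (pointwise t≈) (series-times ≋-refl (series-power m (series-1-ι (suc m) Z)))

    xc≋ : x * c ≋ u * S
    xc≋ = ≋-trans (*-congˡ (≋-sym (series-1-ι (suc m) Z))) (≋-trans (≋-sym (series-* xˢ _)) (≋-trans (pointwise xc≈)
      (series-times ≋-refl (≋-trans (series-minus series-one (series-times ≋-refl (series-sum 0 (suc m) (series-^ U))))
        (≋-sym (h-zero z u))))))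

    module Cd = Candidate.Closed Series-ring m z u x t S⁻¹ c⁻¹ t≋ xc≋ S-inverse c-inverse

    -- The predicate is passed as a relation that ignores its second argument.
    module Finite~ = Congruence (λ f _ → RowFinite f) Fin.Rows-0 Fin.Rows-1
      (λ {f} {_} {f′} → Fin.Rows-+ {f} {f′}) (λ {f} {_} {f′} → Fin.Rows-* {f} {f′}) (λ {f} → Fin.Rows-neg {f})

    module ~C = Congruence _~_ 0~0 1~1 +~ *~ neg~

    h-finite : ∀ i → RowFinite (h i z u)
    h-finite i = Finite~.h~ i {z} {z} {u} {u} (xfree⇒finite {z} z-xfree) U-finite

    z~z : z ~ z
    z~z = xfree⇒~ {z} z-xfree

    c~c : c ~ c
    c~c = +~ 1~1 (neg~ (*~ (~C.ι~ (suc m)) z~z))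

    c-xfree : XFree c
    c-xfree = xfree c~c

    -- U - 1 = (x-1) c / R by `U-1-quotient`, and 1/R inherits polynomial rows from Z and U.
    u~1 : u ~ 1#
    u~1 = record
      { finite = U-finite
      ; xfree = Con.Rows-1
      ; quotient = c * R⁻¹
      ; quotient-finite = Fin.Rows-* {c} {R⁻¹} (xfree⇒finite {c} c-xfree) (inverse-finite {R} (h-finite (suc m)))
      ; difference = ≋-trans (≋-sym (SR.*-identityʳ _)) (≋-trans (*-congˡ (≋-sym R-inverse))
          (≋-trans (≋-sym (SR.*-assoc (u SR.- 1#) R R⁻¹)) (≋-trans (*-congʳ Cd.U-1-quotient)
            (solve 3 (λ c v r → c :* v :* r := v :* (c :* r)) ≋-refl c x-1 R⁻¹))))
      }
      where open IntegerSolver Series-ring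

    x~1 : x ~ 1#
    x~1 = record
      { finite = λ { zero → 1 , (λ { (suc (suc k)) _ → ≡.refl ; (suc zero) (s≤s ()) }) ; (suc n) → 0 , λ _ _ → ≡.refl }
      ; xfree = Con.Rows-1
      ; quotient = 1#
      ; quotient-finite = Fin.Rows-1
      ; difference = ≋-sym (SR.*-identityʳ x-1)
      }

    t~t : t ~ t
    t~t = xfree⇒~ {t} λ { zero k → ≡.refl ; (suc zero) k → ≡.refl ; (suc (suc n)) k → ≡.refl }

    S~c : S ~ c
    S~c = ~-resp (h-zero-at-1 z) (~C.h~ 0 z~z u~1)

    -- 1/S - 1/c = -(S-c)/(Sc), so the quotient for S - c supplies this one.
    S⁻¹~c⁻¹ : S⁻¹ ~ c⁻¹
    S⁻¹~c⁻¹ = record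
      { finite = S⁻¹-finite
      ; xfree = c⁻¹-xfree
      ; quotient = neg (S⁻¹ * c⁻¹ * quotient S~c)
      ; quotient-finite = Fin.Rows-neg {S⁻¹ * c⁻¹ * quotient S~c} (Fin.Rows-* {S⁻¹ * c⁻¹} {quotient S~c}
          (Fin.Rows-* {S⁻¹} {c⁻¹} S⁻¹-finite (xfree⇒finite {c⁻¹} c⁻¹-xfree)) (quotient-finite S~c))
      ; difference = ≋-trans (+-cong (≋-trans (≋-sym (SR.*-identityʳ _)) (*-congˡ (≋-sym c-inverse)))
            (-‿cong (≋-trans (≋-sym (SR.*-identityʳ _)) (*-congˡ (≋-sym S-inverse)))))
          (≋-trans (solve 4 (λ s c s′ c′ → s′ :* (c :* c′) :- c′ :* (s :* s′) := :- (s′ :* c′ :* (s :- c))) ≋-refl S c S⁻¹ c⁻¹)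
          (≋-trans (-‿cong (*-congˡ (difference S~c)))
            (solve 3 (λ a v q → :- (a :* (v :* q)) := v :* :- (a :* q)) ≋-refl (S⁻¹ * c⁻¹) x-1 (quotient S~c))))
      }
      where
      open IntegerSolver Series-ring
      S⁻¹-finite : RowFinite S⁻¹
      S⁻¹-finite = inverse-finite {S} (h-finite 0)
      c⁻¹-xfree : XFree c⁻¹
      c⁻¹-xfree = inverse-xfree {c} c-xfree

    -- The factor x^m specialises to 1^m, which is then removed to match the form of K_i.
    J~K : ∀ i → Cd.J i ~ Cd.K i
    J~K i = ~-resp (*-congʳ (*-congʳ (≋-trans (*-congˡ (1^n≈1 m)) (SR.*-identityʳ t))))
      (*~ (*~ (*~ t~t (~C.^~ m x~1)) (~C.^~ (suc i) S⁻¹~c⁻¹)) (~C.h~ i z~z u~1))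

    candidate-system : System Cd.J Cd.K
    candidate-system = record
      { special = λ i _ → J~K i
      ; order   = λ i _ → Order₁-*ˡ (t * x SE.^ m * S⁻¹ SE.^ suc i) (h i z u)
          (Order₁-*ˡ (t * x SE.^ m) (S⁻¹ SE.^ suc i) (Order₁-*ˡ t (x SE.^ m) (λ _ → ≡.refl)))
      ; initial = Cd.J-zero
      ; step    = Cd.J-step
      }

    module Ct = Counting m
    open Enumeration m

    J≋ : ∀ i → i ≤ suc m → Ct.J i ≋ Cd.J i
    J≋ = J-unique Ct.system candidate-system

    K≋ : ∀ i → i ≤ suc m → Ct.K i ≋ Cd.K i
    K≋ = K-unique Ct.system candidate-system

    -- The cardinalities come from arbitrary lists; they are identified here with the lengths of the
    -- recursive ones.
    counted : ∀ {i} {P : ℕ → ℕ → Interval → Set} → i ≤ suc m → (∀ n k → Enumerates (filter (λ q → descent q ℕ.≟ k) (intervals i n)) (P n k)) →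
      (cP : ℕ → ℕ → ℕ) → (∀ n k → HasCard (P n k) (cP n k)) → series (natSeries cP) ≋ Cd.J i
    counted {i} i≤ e cP card = ≋-trans
      (pointwise λ n k → ≡.trans (≡.cong fromℕℚ (HasCard-length (card n k) (e n k))) (≡.sym (gf-count descent (intervals i n) k)))
      (J≋ i i≤)

    theorem-I : (cI : ℕ → ℕ → ℕ) → (∀ n k → HasCard (GIntervalD m n k) (cI n k)) →
        (xˢ ^ˢ 2 *ˢ natSeries cI *ˢ (1ˢ -ˢ fromℕℚ (suc m) ·ˢ Z) ^ˢ 2
          ≈ˢ Z *ˢ U ^ˢ (m ℕ.+ 2)
               *ˢ (1ˢ -ˢ Z *ˢ sumˢ 0 (suc m)
                     (λ e → fromℕℚ (suc m ∸ e) ·ˢ U ^ˢ e)))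
        ×
        (xˢ ^ˢ 2 *ˢ natSeries cI *ˢ (1ˢ -ˢ fromℕℚ (suc m) ·ˢ Z) *ˢ (U -ˢ 1ˢ)
          ≈ˢ Z *ˢ U ^ˢ (m ℕ.+ 2) *ˢ (xˢ -ˢ 1ˢ))
    theorem-I cI card =
      at (≋-trans left₁ (≋-trans Cd.J-top (≋-trans (≋-sym (SR.*-assoc z (u SE.^ suc (suc m)) R)) (≋-sym right₁)))) ,
      at (≋-trans left₂ (≋-trans Cd.J-top-quotient (≋-sym right₂)))
      where
      open IntegerSolver Series-ring
      U^m+2 : series (U ^ˢ (m ℕ.+ 2)) ≋ u SE.^ suc (suc m)
      U^m+2 = ≋-trans (series-^ U (m ℕ.+ 2)) (SR.reflexive (≡.cong (u SE.^_) (ℕ.+-comm m 2)))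
      J-top≋ : series (natSeries cI) ≋ Cd.J (suc m)
      J-top≋ = counted ℕ.≤-refl GIntervalD-enumerated cI card
      left₁ : series (xˢ ^ˢ 2 *ˢ natSeries cI *ˢ (1ˢ -ˢ fromℕℚ (suc m) ·ˢ Z) ^ˢ 2) ≋ x SE.^ 2 * c SE.^ 2 * Cd.J (suc m)
      left₁ = ≋-trans (series-times (series-times (series-^ xˢ 2) J-top≋) (series-power 2 (series-1-ι (suc m) Z)))
        (solve 3 (λ a j b → a :* j :* b := a :* b :* j) ≋-refl (x SE.^ 2) (Cd.J (suc m)) (c SE.^ 2))
      right₁ : series (Z *ˢ U ^ˢ (m ℕ.+ 2) *ˢ (1ˢ -ˢ Z *ˢ sumˢ 0 (suc m) (λ e → fromℕℚ (suc m ∸ e) ·ˢ U ^ˢ e)))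
        ≋ z * u SE.^ suc (suc m) * R
      right₁ = series-times (series-times ≋-refl U^m+2) (series-top Z U)
      left₂ : series (xˢ ^ˢ 2 *ˢ natSeries cI *ˢ (1ˢ -ˢ fromℕℚ (suc m) ·ˢ Z) *ˢ (U -ˢ 1ˢ))
        ≋ x SE.^ 2 * Cd.J (suc m) * c * (u SR.- 1#)
      left₂ = series-times (series-times (series-times (series-^ xˢ 2) J-top≋) (series-1-ι (suc m) Z)) (series-minus ≋-refl series-one)
      right₂ : series (Z *ˢ U ^ˢ (m ℕ.+ 2) *ˢ (xˢ -ˢ 1ˢ)) ≋ z * u SE.^ suc (suc m) * x-1
      right₂ = series-times (series-times ≋-refl U^m+2) (series-minus ≋-refl series-one)

    theorem-I1 : (c1 : ℕ → ℕ) → (∀ n → HasCard (GInterval m n) (c1 n)) →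
        tSeries c1 *ˢ (1ˢ -ˢ fromℕℚ (suc m) ·ˢ Z) ^ˢ 2
          ≈ˢ Z *ˢ (1ˢ -ˢ fromℕℚ ((m ℕ.+ 2) C 2) ·ˢ Z)
    theorem-I1 c1 card =
      at (≋-trans (series-times K-top≋ (series-power 2 (series-1-ι (suc m) Z)))
         (≋-trans Cd.K-top
         (≋-sym (series-times ≋-refl (≋-trans (series-1-ι ((m ℕ.+ 2) C 2) Z) (+-congˡ (-‿cong (*-congʳ (ι-cong (≡.cong (_C 2) (ℕ.+-comm m 2)))))))))))
      where
      rows : ∀ n k → tSeries c1 n k ≡ coeff (Ct.K (suc m)) n k
      rows n zero    = ≡.trans (≡.cong fromℕℚ (HasCard-length (card n) (intervals-GInterval n))) (≡.sym (gf-length (intervals (suc m) n)))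
      rows n (suc k) = ≡.sym (gf-constant (intervals (suc m) n) k)
      K-top≋ : series (tSeries c1) ≋ Cd.K (suc m)
      K-top≋ = ≋-trans (pointwise rows) (K≋ (suc m) ℕ.≤-refl)

    theorem-J : (i : ℕ) → i ≤ m → (cJ : ℕ → ℕ → ℕ) →
        (∀ n k → HasCard (JInterval m i n k) (cJ n k)) →
        xˢ ^ˢ (suc i ∸ m) *ˢ (1ˢ -ˢ fromℕℚ (suc m) ·ˢ Z) ^ˢ (suc i ∸ m)
            *ˢ natSeries cJ
          ≈ˢ xˢ ^ˢ (m ∸ suc i) *ˢ Z *ˢ (1ˢ -ˢ fromℕℚ (suc m) ·ˢ Z) ^ˢ (m ∸ suc i)
            *ˢ Hlow m i Z U
    theorem-J i i≤m cJ card =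
      at (≋-trans (series-times (series-times (series-^ xˢ p) (series-power p (series-1-ι (suc m) Z)))
           (counted (ℕ.m≤n⇒m≤1+n i≤m) (λ n k → JInterval-enumerated i n k (ℕ.m≤n⇒m≤1+n i≤m)) cJ card))
         (≋-trans (Cd.J-closed p q i p+m)
         (≋-sym (series-times (series-times (series-times (series-^ xˢ q) ≋-refl) (series-power q (series-1-ι (suc m) Z)))
           (series-Hlow i Z U i≤m)))))
      where
      p = suc i ∸ m
      q = m ∸ suc i
      -- At least one of the two truncated differences is 0.
      p+m : p ℕ.+ m ≡ q ℕ.+ suc i
      p+m with ℕ.≤-total m (suc i)
      ... | inj₁ l = ≡.trans (ℕ.m∸n+n≡m l) (≡.cong (ℕ._+ suc i) (≡.sym (ℕ.m≤n⇒m∸n≡0 l)))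
      ... | inj₂ l = ≡.trans (≡.cong (ℕ._+ m) (ℕ.m≤n⇒m∸n≡0 l)) (≡.sym (ℕ.m∸n+n≡m l))

    theorem-J-top : (cJ : ℕ → ℕ → ℕ) →
        (∀ n k → HasCard (JInterval m (suc m) n k) (cJ n k)) →
        xˢ ^ˢ 2 *ˢ (1ˢ -ˢ fromℕℚ (suc m) ·ˢ Z) ^ˢ 2 *ˢ natSeries cJ
          ≈ˢ Z *ˢ Htop m Z U
    theorem-J-top cJ card =
      at (≋-trans (series-times (series-times (series-^ xˢ 2) (series-power 2 (series-1-ι (suc m) Z)))
           (counted ℕ.≤-refl (λ n k → JInterval-enumerated (suc m) n k ℕ.≤-refl) cJ card))
         (≋-trans Cd.J-top
         (≋-sym (series-times ≋-refl (series-times (series-^ U (suc (suc m))) (series-top Z U))))))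

open import Defs
open import Data.Nat using (ℕ; suc; _+_; _*_; _∸_; _≤_; _<_)
open import Data.Nat.Combinatorics using (_C_)
open import Data.Rational using (0ℚ)
open import Data.Product using (_×_; ∃-syntax; _,_)
open import Relation.Binary.PropositionalEquality using (_≡_)

theorem4p1 : (m : ℕ) → 1 ≤ m →
    (Z U : Ser) →
    Z 0 0 ≡ 0ℚ → (∀ n k → 1 ≤ k → Z n k ≡ 0ℚ) →
    tˢ ≈ˢ Z *ˢ (1ˢ -ˢ fromℕℚ (suc m) ·ˢ Z) ^ˢ m →
    (∀ n → ∃[ K ] (∀ k → K < k → U n k ≡ 0ℚ)) →
    xˢ *ˢ (1ˢ -ˢ fromℕℚ (suc m) ·ˢ Z)
    ≈ˢ U *ˢ (1ˢ -ˢ Z *ˢ sumˢ 0 (suc m) (λ e → U ^ˢ e)) →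
    ((cI : ℕ → ℕ → ℕ) → (∀ n k → HasCard (GIntervalD m n k) (cI n k)) →
    (xˢ ^ˢ 2 *ˢ natSeries cI *ˢ (1ˢ -ˢ fromℕℚ (suc m) ·ˢ Z) ^ˢ 2
    ≈ˢ Z *ˢ U ^ˢ (m + 2)
    *ˢ (1ˢ -ˢ Z *ˢ sumˢ 0 (suc m)
    (λ e → fromℕℚ (suc m ∸ e) ·ˢ U ^ˢ e)))
    ×
    (xˢ ^ˢ 2 *ˢ natSeries cI *ˢ (1ˢ -ˢ fromℕℚ (suc m) ·ˢ Z) *ˢ (U -ˢ 1ˢ)
    ≈ˢ Z *ˢ U ^ˢ (m + 2) *ˢ (xˢ -ˢ 1ˢ)))
    ×
    ((c1 : ℕ → ℕ) → (∀ n → HasCard (GInterval m n) (c1 n)) →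
    tSeries c1 *ˢ (1ˢ -ˢ fromℕℚ (suc m) ·ˢ Z) ^ˢ 2
    ≈ˢ Z *ˢ (1ˢ -ˢ fromℕℚ ((m + 2) C 2) ·ˢ Z))
    ×
    ((i : ℕ) → i ≤ m → (cJ : ℕ → ℕ → ℕ) →
    (∀ n k → HasCard (JInterval m i n k) (cJ n k)) →
    xˢ ^ˢ (suc i ∸ m) *ˢ (1ˢ -ˢ fromℕℚ (suc m) ·ˢ Z) ^ˢ (suc i ∸ m)
    *ˢ natSeries cJ
    ≈ˢ xˢ ^ˢ (m ∸ suc i) *ˢ Z *ˢ (1ˢ -ˢ fromℕℚ (suc m) ·ˢ Z) ^ˢ (m ∸ suc i)
    *ˢ Hlow m i Z U)
    ×
    ((cJ : ℕ → ℕ → ℕ) →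
    (∀ n k → HasCard (JInterval m (suc m) n k) (cJ n k)) →
    xˢ ^ˢ 2 *ˢ (1ˢ -ˢ fromℕℚ (suc m) ·ˢ Z) ^ˢ 2 *ˢ natSeries cJ
    ≈ˢ Z *ˢ Htop m Z U)
theorem4p1 m _ Z U Z00 Z-xfree t≈ U-finite xc≈ =
  theorem-I , theorem-I1 , theorem-J , theorem-J-top
  where open Solutions.Solution m Z U Z00 Z-xfree t≈ U-finite xc≈
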